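{- Let $(W_1,S_1)$ and $(W_2,S_2)$ be arbitrary Coxeter systems with identity elements $e_1$ and $e_2$, let $H_1\subseteq S_1$ and $H_2\subseteq S_2$, and let $v_1\in W_1^{H_1}$ and $v_2\in W_2^{H_2}$. Suppose there exists a poset isomorphism $\psi$ from the Bruhat interval $[e_1,v_1]$ to $[e_2,v_2]$ that restricts to a poset isomorphism from $[e_1,v_1]^{H_1}$ to $[e_2,v_2]^{H_2}$. Then, for each $x\in\{ -1,q\}$ and all $u,w\in[e_1,v_1]^{H_1}$, $$P^{H_1,x}_{u,w}(q)=P^{H_2,x}_{\psi(u),\psi(w)}(q)\quad\text{and}\quad R^{H_1,x}_{u,w}(q)=R^{H_2,x}_{\psi(u),\psi(w)}(q).$$
   Context: For a Coxeter system $(W,S)$ with identity $e$ and length function $\ell$, $\le$ denotes Bruhat order, $[u,v]=\{z\in W: u\le z\le v\}$, $D_L(w)=\{s\in S:\ell(sw)<\ell(w)\}$, $D_R(w)=\{s\in S:\ell(ws)<\ell(w)\}$. For $H\subseteq S$, $W^H=\{w\in W: D_R(w)\subseteq S\setminus H\}$ and $[u,v]^H=[u,v]\cap W^H$. For $x\in\{ -1,q\}$, the parabolic Kazhdan–Lusztig $R$-polynomials $\{R^{H,x}_{u,v}(q)\}_{u,v\in W^H}\subseteq\mathbb Z[q]$ (Deodhar) are the unique family such that: $R^{H,x}_{u,v}=0$ if $u\not\le v$; $R^{H,x}_{u,u}=1$; and if $u<v$ and $s\in D_L(v)$, then $R^{H,x}_{u,v}=R^{H,x}_{su,sv}$ if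 $s\in D_L(u)$; $R^{H,x}_{u,v}=(q-1)R^{H,x}_{u,sv}+qR^{H,x}_{su,sv}$ if $s\notin D_L(u)$ and $su\in W^H$; $R^{H,x}_{u,v}=(q-1-x)R^{H,x}_{u,sv}$ if $s\notin D_L(u)$ and $su\notin W^H$. The parabolic Kazhdan–Lusztig polynomials $\{P^{H,x}_{u,v}(q)\}_{u,v\in W^H}\subseteq\mathbb Z[q]$ are the unique family such that: $P^{H,x}_{u,v}=0$ if $u\not\le v$; $P^{H,x}_{u,u}=1$; $\deg P^{H,x}_{u,v}\le\frac12(\ell(v)-\ell(u)-1)$ if $u<v$; and $q^{\ell(v)-\ell(u)}P^{H,x}_{u,v}(1/q)=\sum_{z\in[u,v]^H}R^{H,x}_{u,z}(q)P^{H,x}_{z,v}(q)$. -}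

module Defs where

open import Data.Nat using (ℕ; zero; suc; _≤_; _<_; _∸_; _*_)
open import Data.Integer as ℤ using (ℤ)
open import Data.List using (List; []; _∷_; _++_; [_]; reverse; length; foldr)
open import Data.List.Relation.Unary.Any using (Any)
open import Data.List.Relation.Unary.AllPairs using (AllPairs)
open import Data.Maybe using (Maybe; just)
open import Data.Product using (Σ; ∃; ∃-syntax; _×_; _,_)
open import Relation.Nullary using (¬_; yes; no)
open import Relation.Binary.PropositionalEquality using (_≡_)
open import Relation.Binary.Construct.Closure.Equivalence using (EqClosure)
open import Function.Bundles using (_⇔_)

-- Polynomials in ℤ[q], as coefficient sequences (coefficient of q^n).

Poly : Set
Poly = ℕ → ℤ

_≗ₚ_ : Poly → Poly → Set
P ≗ₚ Q = ∀ n → P n ≡ Q n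

0ₚ : Poly
0ₚ _ = ℤ.0ℤ

1ₚ : Poly
1ₚ zero = ℤ.1ℤ
1ₚ (suc _) = ℤ.0ℤ

qₚ : Poly
qₚ (suc zero) = ℤ.1ℤ
qₚ _ = ℤ.0ℤ

_+ₚ_ : Poly → Poly → Poly
(P +ₚ Q) n = P n ℤ.+ Q n

-ₚ_ : Poly → Poly
(-ₚ P) n = ℤ.- P n

sumUpTo : ℕ → (ℕ → ℤ) → ℤ
sumUpTo zero f = f zero
sumUpTo (suc n) f = sumUpTo n f ℤ.+ f (suc n)

_*ₚ_ : Poly → Poly → Poly
(P *ₚ Q) n = sumUpTo n (λ i → P i ℤ.* Q (n ∸ i))

-- q^d P(1/q), valid (as an element of ℤ[q]) whenever deg P ≤ d
revₚ : ℕ → Poly → Poly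
revₚ d P n with n Data.Nat.≤? d
... | yes _ = P (d ∸ n)
... | no _ = ℤ.0ℤ

data X : Set where
  x=-1 : X
  x=q  : X

xₚ : X → Poly
xₚ x=-1 = -ₚ 1ₚ
xₚ x=q  = qₚ

-- Coxeter systems, given by a Coxeter matrix over an arbitrary index
-- set S (nothing = ∞).  W is the group of words in S modulo the
-- Coxeter relations s² = e and the braid relations.

record CoxeterSystem : Set₁ where
  field
    S      : Set
    m      : S → S → Maybe ℕ
    m-diag : ∀ s → m s s ≡ just 1
    m-sym  : ∀ s t → m s t ≡ m t s
    m-off  : ∀ s t k → ¬ s ≡ t → m s t ≡ just k → 2 ≤ k

module Coxeter (C : CoxeterSystem) where
  open CoxeterSystem C

  -- words represent elements of W; [] is the identity e, _++_ the product
  Word : Set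
  Word = List S

  alt : S → S → ℕ → Word
  alt s t zero = []
  alt s t (suc k) = s ∷ alt t s k

  data Step : Word → Word → Set where
    cancel : ∀ u s v → Step (u ++ s ∷ s ∷ v) (u ++ v)
    braid  : ∀ u s t k v → m s t ≡ just k →
             Step (u ++ alt s t k ++ v) (u ++ alt t s k ++ v)

  _≈_ : Word → Word → Set
  _≈_ = EqClosure Step

  inv : Word → Word
  inv = reverse

  Len : Word → ℕ → Set
  Len w n = (∃[ w' ] (w' ≈ w × length w' ≡ n)) × (∀ w' → w' ≈ w → n ≤ length w')

  _ℓ<_ : Word → Word → Set
  u ℓ< w = ∃[ a ] ∃[ b ] (Len u a × Len w b × a < b)

  DL : S → Word → Set
  DL s w = (s ∷ w) ℓ< w

  DR : S → Word → Set
  DR s w = (w ++ [ s ]) ℓ< w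

  BruhatStep : Word → Word → Set
  BruhatStep v w = ∃[ r ] ∃[ s ] (w ≈ (v ++ r ++ [ s ] ++ inv r) × v ℓ< w)

  data _≤B_ : Word → Word → Set where
    ≤B-refl : ∀ {u v} → u ≈ v → u ≤B v
    ≤B-step : ∀ {u v w} → u ≤B v → BruhatStep v w → u ≤B w

  _<B_ : Word → Word → Set
  u <B v = u ≤B v × ¬ (u ≈ v)

  module Parabolic (H : S → Set) where

    InWH : Word → Set
    InWH w = ∀ s → H s → ¬ DR s w

    InIntervalH : Word → Word → Word → Set
    InIntervalH u v z = u ≤B z × z ≤B v × InWH z

    EnumIntervalH : Word → Word → List Word → Set
    EnumIntervalH u v zs =
      (∀ z → InIntervalH u v z ⇔ Any (λ z' → z ≈ z') zs) ×
      AllPairs (λ a b → ¬ (a ≈ b)) zs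

    WellDefined : (Word → Word → Poly) → Set
    WellDefined F = ∀ u u' v v' → u ≈ u' → v ≈ v' → F u v ≗ₚ F u' v'

    IsParabolicR : X → (Word → Word → Poly) → Set
    IsParabolicR x R =
      WellDefined R ×
      (∀ u v → InWH u → InWH v → ¬ (u ≤B v) → R u v ≗ₚ 0ₚ) ×
      (∀ u → InWH u → R u u ≗ₚ 1ₚ) ×
      (∀ u v s → InWH u → InWH v → u <B v → DL s v →
         DL s u → R u v ≗ₚ R (s ∷ u) (s ∷ v)) ×
      (∀ u v s → InWH u → InWH v → u <B v → DL s v →
         ¬ DL s u → InWH (s ∷ u) →
         R u v ≗ₚ (((qₚ +ₚ (-ₚ 1ₚ)) *ₚ R u (s ∷ v)) +ₚ (qₚ *ₚ R (s ∷ u) (s ∷ v)))) ×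
      (∀ u v s → InWH u → InWH v → u <B v → DL s v →
         ¬ DL s u → ¬ InWH (s ∷ u) →
         R u v ≗ₚ ((qₚ +ₚ ((-ₚ 1ₚ) +ₚ (-ₚ xₚ x))) *ₚ R u (s ∷ v)))

    sumRP : (Word → Word → Poly) → (Word → Word → Poly) →
            Word → Word → List Word → Poly
    sumRP R P u v zs = foldr (λ z acc → (R u z *ₚ P z v) +ₚ acc) 0ₚ zs

    IsParabolicP : (Word → Word → Poly) → (Word → Word → Poly) → Set
    IsParabolicP R P =
      WellDefined P ×
      (∀ u v → InWH u → InWH v → ¬ (u ≤B v) → P u v ≗ₚ 0ₚ) ×
      (∀ u → InWH u → P u u ≗ₚ 1ₚ) ×
      -- deg P_{u,v} ≤ (ℓ(v) - ℓ(u) - 1)/2, i.e. coefficients of q^k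
      -- with 2k ≥ ℓ(v) - ℓ(u) vanish
      (∀ u v → InWH u → InWH v → u <B v → ∀ a b → Len u a → Len v b →
         ∀ k → b ∸ a ≤ 2 * k → P u v k ≡ ℤ.0ℤ) ×
      (∀ u v → InWH u → InWH v → ∀ a b → Len u a → Len v b →
         ∀ zs → EnumIntervalH u v zs →
         revₚ (b ∸ a) (P u v) ≗ₚ sumRP R P u v zs)

module _ (C₁ C₂ : CoxeterSystem) where
  private
    module W₁ = Coxeter C₁
    module W₂ = Coxeter C₂

  IntervalIso : (H₁ : CoxeterSystem.S C₁ → Set) (H₂ : CoxeterSystem.S C₂ → Set) →
                W₁.Word → W₂.Word → (W₁.Word → W₂.Word) → Set
  IntervalIso H₁ H₂ v₁ v₂ ψ =
    (∀ z z' → z W₁.≈ z' → ψ z W₂.≈ ψ z') ×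
    (∀ z → [] W₁.≤B z → z W₁.≤B v₁ → ([] W₂.≤B ψ z) × (ψ z W₂.≤B v₂)) ×
    (∀ z z' → [] W₁.≤B z → z W₁.≤B v₁ → [] W₁.≤B z' → z' W₁.≤B v₁ →
       ψ z W₂.≈ ψ z' → z W₁.≈ z') ×
    (∀ y → [] W₂.≤B y → y W₂.≤B v₂ →
       ∃[ z ] ([] W₁.≤B z × z W₁.≤B v₁ × ψ z W₂.≈ y)) ×
    (∀ z z' → [] W₁.≤B z → z W₁.≤B v₁ → [] W₁.≤B z' → z' W₁.≤B v₁ →
       (z W₁.≤B z' ⇔ ψ z W₂.≤B ψ z')) ×
    (∀ z → [] W₁.≤B z → z W₁.≤B v₁ → W₁.Parabolic.InWH H₁ z →
       W₂.Parabolic.InWH H₂ (ψ z)) ×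
    (∀ y → [] W₂.≤B y → y W₂.≤B v₂ → W₂.Parabolic.InWH H₂ y →
       ∃[ z ] ([] W₁.≤B z × z W₁.≤B v₁ × W₁.Parabolic.InWH H₁ z × ψ z W₂.≈ y))

{-# OPTIONS --safe #-}
-- Multiplication by a left or right descent of w is a special matching of the Bruhat interval [e,w].  These
-- intervals are graded, and two elements never have three common upper or lower covers; the latter holds because
-- the reflection subgroup generated by the reflections r for which r f is a reflection, for a fixed product f of
-- two reflections, is dihedral, with two canonical generators.  In a graded poset with these properties every special
-- matching computes the same R-polynomials: if M and N are matchings of w with M w ≠ N w, then following M on the
-- orbits of ⟨M,N⟩ of the same size as the one of w, and N on the others, is again a special matching, and
-- comparing the three by induction leaves only a braid relation on orbits of equal size.  So ordinary
-- R-polynomials are invariants of the poset [e,v].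
--
-- Parabolic R-polynomials are the sums of (-x)^(ℓ(z)-ℓ(u)) R(z,v) over those z whose largest lower bound in W^H is u,
-- and depend only on the poset [e,v] with its subset [e,v]^H.  The polynomials P follow by the degree bound.
--
-- Equality of coefficients is decidable, so the proof may use classical logic; only the enumeration of [u,w]^H needs
-- witnesses, namely that elements below w are given by subwords of a word for w.

module Submission where

-- The recursion for R through a matching M applies an operator T_M that satisfies the quadratic
-- relation of a Hecke generator. Unfolding it along the orbit of w under ⟨M,N⟩ writes R(x,w) in two
-- ways, as alternating words of length m in T_M and T_N applied to R(·,u), where u is the bottom of
-- that orbit and m its height. At points x whose orbit has height m as well, the words agree by the
-- braid relation; at other points nothing relates them directly. There the mixed matching helps: it
-- and M both send v = M u to u, so by induction both compute R(·,v), and on the other orbits this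
-- says that T_M and T_N agree on R(·,u). A mixed matching need not be a multiplication in the
-- group, so the induction has to cover all special matchings and takes place in an axiomatic class
-- of posets. Matchings with the same value at w are compared through one with a different value; as
-- w may have a single left descent, right descents are used too.
--
-- The sum for parabolic R-polynomials is Deodhar's sum over a coset, whose minimal representative
-- is recovered from the order alone.

open import Defs
open import Algebra.Bundles using (CommutativeMonoid; Group)
import Algebra.Properties.CommutativeMonoid.Sum as Summation
import Algebra.Properties.Group as GroupProperties
open import Data.Bool using (Bool; true; false; not; if_then_else_; _xor_)
import Data.Bool.Properties as Boolₚ
open import Data.Bool.Properties using (not-involutive; xor-assoc; xor-comm; xor-same)
open import Data.Empty using (⊥; ⊥-elim)
open import Data.Fin using (Fin; punchIn)
import Data.Fin as Fin
open import Data.Fin.Permutation using (permutation)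
import Data.Fin.Properties as Finₚ
import Data.Integer as ℤ
import Data.Integer.Properties as ℤₚ
open import Data.Integer.Solver using (module +-*-Solver)
open import Data.List using (List; []; _∷_; _++_; [_]; foldr; length; lookup; map)
open import Data.List.Base using (InitLast; initLast; _∷ʳ′_)
open import Data.List.Membership.Propositional using (_∈_; find)
open import Data.List.Membership.Propositional.Properties using (∈-++⁺ˡ; ∈-++⁺ʳ; ∈-lookup; ∈-map⁺)
open import Data.List.Properties using (++-assoc; ++-identityʳ; length-++; length-reverse; reverse-++; reverse-involutive; unfold-reverse; ∷-injective)
open import Data.List.Relation.Binary.Sublist.Propositional using (_⊆_; []; _∷_; _∷ʳ_; ⊆-refl; ⊆-trans)
open import Data.List.Relation.Unary.All using (All; []; _∷_)
import Data.List.Relation.Unary.All as All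
import Data.List.Relation.Unary.All.Properties as Allₚ
open import Data.List.Relation.Unary.AllPairs using (AllPairs; []; _∷_)
open import Data.List.Relation.Unary.Any using (Any; here; there; index)
import Data.List.Relation.Unary.Any as Any
import Data.List.Relation.Unary.Any.Properties as Anyₚ
open import Data.Nat using (ℕ; zero; suc; _<_; _∸_; z≤n; s≤s; s≤s⁻¹) renaming (_≤_ to _≤ⁿ_)
import Data.Nat as ℕ
import Data.Nat.Properties as ℕₚ
import Data.Nat.Solver as ℕSolver
open import Data.Product using (∃; ∃-syntax; _×_; _,_; proj₁; proj₂)
open import Data.Sum using (_⊎_; inj₁; inj₂)
open import Data.Vec using (Vec) renaming ([] to ⟨⟩; _∷_ to _◂_)
import Data.Vec as Vec
open import Function using (_∘_; case_of_; id)
open import Function.Bundles using (_⇔_; mk⇔; Equivalence)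
open import Level using (0ℓ)
open import Relation.Binary using (DecidableEquality; Decidable; IsEquivalence; tri<; tri≈; tri>)
import Relation.Binary.Construct.Closure.Equivalence as EqC
import Relation.Binary.Construct.Closure.Symmetric as Sym
open import Relation.Binary.PropositionalEquality using (_≡_; _≢_; refl; sym; trans; cong; cong₂; subst; subst₂; module ≡-Reasoning)
import Relation.Binary.Reasoning.Setoid as SetoidReasoning
open import Relation.Nullary using (¬_; Dec; yes; no; ⌊_⌋; _×-dec_; _⊎-dec_)
open import Relation.Nullary.Decidable using (decidable-stable)

-- Normalisation of group expressions, where some variables are involutions.
module Solver (G : Group 0ℓ 0ℓ) where
  open Group G renaming (refl to ≈-refl; sym to ≈-sym; trans to ≈-trans)
  open GroupProperties G using (⁻¹-anti-homo-∙; ⁻¹-involutive; inverseˡ-unique)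
  open SetoidReasoning setoid

  data Var : Set where
    free : Carrier → Var
    invo : ∀ x → x ∙ x ≈ ε → Var

  data Exp (n : ℕ) : Set where
    var : Fin n → Exp n
    _⊙_ : Exp n → Exp n → Exp n
    _′  : Exp n → Exp n

  v₀ : ∀ {n} → Exp (suc n)
  v₀ = var Fin.zero
  v₁ : ∀ {n} → Exp (suc (suc n))
  v₁ = var (Fin.suc Fin.zero)
  v₂ : ∀ {n} → Exp (suc (suc (suc n)))
  v₂ = var (Fin.suc (Fin.suc Fin.zero))
  v₃ : ∀ {n} → Exp (suc (suc (suc (suc n))))
  v₃ = var (Fin.suc (Fin.suc (Fin.suc Fin.zero)))

  infixr 6 _⊙_
  infix 8 _′

  value : Var → Carrier
  value (free x)   = x
  value (invo x _) = x

  involutive : Var → Bool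
  involutive (free _)   = false
  involutive (invo _ _) = true

  module _ {n} (ρ : Vec Var n) where
    ⟦_⟧ : Exp n → Carrier
    ⟦ var i ⟧ = value (Vec.lookup ρ i)
    ⟦ e ⊙ f ⟧ = ⟦ e ⟧ ∙ ⟦ f ⟧
    ⟦ e ′ ⟧   = ⟦ e ⟧ ⁻¹

    Letter : Set
    Letter = Fin n × Bool

    letter : Letter → Carrier
    letter (i , true)  = value (Vec.lookup ρ i)
    letter (i , false) = value (Vec.lookup ρ i) ⁻¹

    list : List Letter → Carrier
    list []       = ε
    list (l ∷ ls) = letter l ∙ list ls

    push : Fin n → Bool → List Letter → List Letter
    push i b [] = (i , b) ∷ []
    push i b ((j , c) ∷ ls) with i Finₚ.≟ j | b xor c
    ... | yes _ | true  = ls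
    ... | yes _ | false = (i , b) ∷ (j , c) ∷ ls
    ... | no  _ | _     = (i , b) ∷ (j , c) ∷ ls

    cancel : Fin n → List Letter → List Letter
    cancel i [] = (i , true) ∷ []
    cancel i ((j , c) ∷ ls) with i Finₚ.≟ j
    ... | yes _ = ls
    ... | no  _ = (i , true) ∷ (j , c) ∷ ls

    add : Fin n → Bool → List Letter → List Letter
    add i b ls with involutive (Vec.lookup ρ i)
    ... | false = push i b ls
    ... | true  = cancel i ls

    -- The flag is an exponent: `true` prepends `e` to `ls`, `false` prepends its inverse. Inverses
    -- are thus driven down to the letters, and every new letter is cancelled against the head of
    -- `ls` at once.
    nf : Bool → Exp n → List Letter → List Letter
    nf b     (var i) ls = add i b ls
    nf true  (e ⊙ f) ls = nf true e (nf true f ls)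
    nf false (e ⊙ f) ls = nf false f (nf false e ls)
    nf b     (e ′)   ls = nf (not b) e ls

    cancel-left : ∀ x y z → x ∙ y ≈ ε → z ≈ x ∙ (y ∙ z)
    cancel-left x y z p = begin
      z             ≈⟨ identityˡ z ⟨
      ε ∙ z         ≈⟨ ∙-congʳ p ⟨
      (x ∙ y) ∙ z   ≈⟨ assoc x y z ⟩
      x ∙ (y ∙ z)   ∎

    push-sound : ∀ i b ls → list (push i b ls) ≈ letter (i , b) ∙ list ls
    push-sound i b [] = ≈-refl
    push-sound i b ((j , c) ∷ ls) with i Finₚ.≟ j
    push-sound i true  ((j , true)  ∷ ls) | yes _    = ≈-refl
    push-sound i true  ((j , false) ∷ ls) | yes refl = cancel-left _ _ _ (inverseʳ _)
    push-sound i false ((j , true)  ∷ ls) | yes refl = cancel-left _ _ _ (inverseˡ _)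
    push-sound i false ((j , false) ∷ ls) | yes _    = ≈-refl
    push-sound i b ((j , c) ∷ ls) | no _ = ≈-refl

    add-sound : ∀ i b ls → list (add i b ls) ≈ letter (i , b) ∙ list ls
    add-sound i b ls with Vec.lookup ρ i in eq
    ... | free x = push-sound i b ls
    add-sound i b ls | invo x p = ≈-trans (cancel-sound ls) (∙-congʳ (≈-sym (same b)))
      where
      x≈ : value (Vec.lookup ρ i) ≡ x
      x≈ rewrite eq = refl
      same : ∀ b → letter (i , b) ≈ value (Vec.lookup ρ i)
      same true  = ≈-refl
      same false rewrite x≈ = ≈-sym (inverseˡ-unique x x p)
      square : value (Vec.lookup ρ i) ∙ value (Vec.lookup ρ i) ≈ ε
      square rewrite x≈ = p
      same′ : ∀ c → letter (i , true) ∙ letter (i , c) ≈ ε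
      same′ c = ≈-trans (∙-congˡ (same c)) square
      cancel-sound : ∀ ls → list (cancel i ls) ≈ letter (i , true) ∙ list ls
      cancel-sound [] = ≈-refl
      cancel-sound ((j , c) ∷ ls) with i Finₚ.≟ j
      ... | yes refl = cancel-left _ _ _ (same′ c)
      ... | no  _    = ≈-refl

    nf-sound : ∀ b e ls → list (nf b e ls) ≈ (if b then ⟦ e ⟧ else ⟦ e ⟧ ⁻¹) ∙ list ls
    nf-sound true  (var i) ls = add-sound i true ls
    nf-sound false (var i) ls = add-sound i false ls
    nf-sound true  (e ⊙ f) ls = ≈-trans (nf-sound true e _) (≈-trans (∙-congˡ (nf-sound true f ls)) (≈-sym (assoc _ _ _)))
    nf-sound false (e ⊙ f) ls = ≈-trans (nf-sound false f _) (≈-trans (∙-congˡ (nf-sound false e ls))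
      (≈-trans (≈-sym (assoc _ _ _)) (∙-congʳ (≈-sym (⁻¹-anti-homo-∙ _ _)))))
    nf-sound true  (e ′) ls = nf-sound false e ls
    nf-sound false (e ′) ls = ≈-trans (nf-sound true e ls) (∙-congʳ (≈-sym (⁻¹-involutive _)))

    solve : ∀ e f → nf true e [] ≡ nf true f [] → ⟦ e ⟧ ≈ ⟦ f ⟧
    solve e f eq = begin
      ⟦ e ⟧                ≈⟨ identityʳ _ ⟨
      ⟦ e ⟧ ∙ ε            ≈⟨ nf-sound true e [] ⟨
      list (nf true e [])  ≡⟨ cong-list eq ⟩
      list (nf true f [])  ≈⟨ nf-sound true f [] ⟩
      ⟦ f ⟧ ∙ ε            ≈⟨ identityʳ _ ⟩
      ⟦ f ⟧                ∎
      where
      cong-list : ∀ {l l′} → l ≡ l′ → list l ≡ list l′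
      cong-list refl = refl

-- Classical reasoning takes place in the continuation monad with answer type G.  It is ordinary
-- double negation for G = ⊥; other answer types extract witnesses from classical proofs.
module Classical (G : Set) where
  C : Set → Set
  C A = (A → G) → G

  infixl 1 _>>=_ _>>_
  _>>=_ : {A B : Set} → C A → (A → C B) → C B
  (m >>= f) k = m λ a → f a k

  _>>_ : {A B : Set} → C A → C B → C B
  m >> n = m >>= λ _ → n

  return : {A : Set} → A → C A
  return a k = k a

  em : (A : Set) → C (A ⊎ (A → G))
  em A k = k (inj₂ λ a → k (inj₁ a))

  run : C G → G
  run m = m id

  impossible : {A : Set} → G → C A
  impossible g _ = g

  -- A truth value as a Boolean, with negation relative to `G`. With Booleans, parity arguments
  -- become computations with `xor`.
  Is : Bool → Set → Set
  Is true  A = A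
  Is false A = A → G

  Is-total : (A : Set) → C (∃[ b ] Is b A)
  Is-total A = do
    inj₁ a ← em A
      where inj₂ ¬a → return (false , ¬a)
    return (true , a)

  Is-unique : ∀ {A} b b′ → Is b A → Is b′ A → C (b ≡ b′)
  Is-unique true  true  _ _ = return refl
  Is-unique true  false a n = impossible (n a)
  Is-unique false true  n a = impossible (n a)
  Is-unique false false _ _ = return refl

  Is-map : ∀ {A B} b → (A → B) → (B → A) → Is b A → Is b B
  Is-map true  f g a = f a
  Is-map false f g n = n ∘ g

xor-cancel : ∀ a b → a xor (a xor b) ≡ b
xor-cancel true  true  = refl
xor-cancel true  false = refl
xor-cancel false b     = refl

xor-injective : ∀ a {b c} → a xor b ≡ a xor c → b ≡ c
xor-injective a {b} {c} eq = trans (sym (xor-cancel a b)) (trans (cong (a xor_) eq) (xor-cancel a c))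

-- Inversions and length

module Words (W : CoxeterSystem) (G : Set) where
  open import Data.Nat using (_+_)
  open Classical G
  open import Relation.Binary.Construct.Closure.ReflexiveTransitive using (ε; _◅_; _◅◅_)
  open CoxeterSystem W
  open Coxeter W renaming (_≈_ to infix 4 _≈_; _≤B_ to infix 4 _≤B_; _ℓ<_ to infix 4 _ℓ<_)

  ≈-refl : ∀ {u} → u ≈ u
  ≈-refl = ε

  ≈-sym : ∀ {u v} → u ≈ v → v ≈ u
  ≈-sym = EqC.symmetric Step

  ≈-trans : ∀ {u v w} → u ≈ v → v ≈ w → u ≈ w
  ≈-trans = _◅◅_

  Step-context : ∀ a b {u v} → Step u v → Step (a ++ u ++ b) (a ++ v ++ b)
  Step-context a b (cancel u s v) = subst₂ Step (eq (s ∷ s ∷ v)) (eq v) (cancel (a ++ u) s (v ++ b))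
    where
    eq : ∀ x → (a ++ u) ++ x ++ b ≡ a ++ (u ++ x) ++ b
    eq x = trans (++-assoc a u _) (cong (a ++_) (sym (++-assoc u x b)))
  Step-context a b (braid u s t k v m≡) = subst₂ Step (eq (alt s t k)) (eq (alt t s k)) (braid (a ++ u) s t k (v ++ b) m≡)
    where
    eq : ∀ x → (a ++ u) ++ x ++ v ++ b ≡ a ++ (u ++ x ++ v) ++ b
    eq x = trans (++-assoc a u _) (cong (a ++_) (trans (cong (u ++_) (sym (++-assoc x v b))) (sym (++-assoc u _ b))))

  ≈-context : ∀ a b {u v} → u ≈ v → a ++ u ++ b ≈ a ++ v ++ b
  ≈-context a b = EqC.gmap (λ u → a ++ u ++ b) (Step-context a b)

  ≈-++ : ∀ {a a′ b b′} → a ≈ a′ → b ≈ b′ → a ++ b ≈ a′ ++ b′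
  ≈-++ {a} {a′} {b} {b′} p q = ≈-trans (≈-context [] b p)
    (subst₂ _≈_ (cong (a′ ++_) (++-identityʳ b)) (cong (a′ ++_) (++-identityʳ b′)) (≈-context a′ [] q))

  infix 4 _~_
  -- Equality in the group inside the continuation monad. Equational reasoning may then use
  -- classical case distinctions, and an actual `_≈_` is released only into a goal that lies in the
  -- monad itself.
  _~_ : Word → Word → Set
  u ~ v = C (u ≈ v)

  ~-refl : ∀ {u} → u ~ u
  ~-refl = return ≈-refl

  ~-reflexive : ∀ {u v} → u ≡ v → u ~ v
  ~-reflexive refl = ~-refl

  ~-sym : ∀ {u v} → u ~ v → v ~ u
  ~-sym p = p >>= return ∘ ≈-sym

  ~-trans : ∀ {u v w} → u ~ v → v ~ w → u ~ w
  ~-trans p q = do p ← p ; q ← q ; return (≈-trans p q)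

  ~-++ : ∀ {a a′ b b′} → a ~ a′ → b ~ b′ → a ++ b ~ a′ ++ b′
  ~-++ p q = do p ← p ; q ← q ; return (≈-++ p q)

  ss≈ : ∀ s → s ∷ s ∷ [] ≈ []
  ss≈ s = EqC.return (cancel [] s [])

  inv-left : ∀ w → inv w ++ w ≈ []
  inv-left [] = ≈-refl
  inv-left (s ∷ w) = subst (_≈ []) eq (≈-trans (≈-context (inv w) w (ss≈ s)) (inv-left w))
    where
    eq : inv w ++ (s ∷ s ∷ []) ++ w ≡ inv (s ∷ w) ++ s ∷ w
    eq = trans (sym (++-assoc (inv w) [ s ] (s ∷ w))) (cong (_++ s ∷ w) (sym (unfold-reverse s w)))

  inv-right : ∀ w → w ++ inv w ≈ []
  inv-right w = subst (λ v → v ++ inv w ≈ []) (reverse-involutive w) (inv-left (inv w))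

  inv-cong : ∀ {u v} → u ~ v → inv u ~ inv v
  inv-cong {u} {v} p = ~-trans (~-reflexive (sym (++-identityʳ _)))
    (~-trans (~-++ ~-refl (~-sym (return (inv-right v))))
    (~-trans (~-reflexive (sym (++-assoc (inv u) v (inv v))))
    (~-++ (~-trans (~-++ ~-refl (~-sym p)) (return (inv-left u))) ~-refl)))

  group : Group 0ℓ 0ℓ
  group = record
    { Carrier = Word ; _≈_ = _~_ ; _∙_ = _++_ ; ε = [] ; _⁻¹ = inv
    ; isGroup = record
      { isMonoid = record
        { isSemigroup = record
          { isMagma = record
            { isEquivalence = record { refl = ~-refl ; sym = ~-sym ; trans = ~-trans }
            ; ∙-cong = ~-++ }
          ; assoc = λ u v w → ~-reflexive (++-assoc u v w) }
        ; identity = (λ _ → ~-refl) , λ w → ~-reflexive (++-identityʳ w) }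
      ; inverse = (λ w → return (inv-left w)) , λ w → return (inv-right w)
      ; ⁻¹-cong = inv-cong } }

  open Solver group public using (free; invo; _⊙_; _′; v₀; v₁; v₂; v₃; solve)
  module ~-Reasoning = SetoidReasoning (Group.setoid group)

  -- Par w t b: the parity of the number of occurrences of t among the
  -- left inversions s₁⋯sᵢ⋯s₁ of the word w = s₁⋯sₙ is b.
  Par : Word → Word → Bool → Set
  Par []      t b = b ≡ false
  Par (s ∷ w) t b = ∃[ b₁ ] (Is b₁ ([ s ] ~ t) × Par w (s ∷ t ++ [ s ]) (b₁ xor b))

  conj-s : ∀ s {t t′} → t ~ t′ → s ∷ t ++ [ s ] ~ s ∷ t′ ++ [ s ]
  conj-s s p = ~-++ {[ s ]} ~-refl (~-++ p ~-refl)

  Par-cong : ∀ w {t t′ b} → t ~ t′ → Par w t b → Par w t′ b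
  Par-cong []      p q = q
  Par-cong (s ∷ w) p (b₁ , i , q) =
    b₁ , Is-map b₁ (λ e → ~-trans e p) (λ e → ~-trans e (~-sym p)) i , Par-cong w (conj-s s p) q

  Par-total : ∀ w t → C (∃[ b ] Par w t b)
  Par-total []      t = return (false , refl)
  Par-total (s ∷ w) t = do
    (b₁ , i) ← Is-total ([ s ] ~ t)
    (b , p) ← Par-total w (s ∷ t ++ [ s ])
    return (b₁ xor b , b₁ , i , subst (Par w _) (sym (xor-cancel b₁ b)) p)

  Par-unique : ∀ w {t b b′} → Par w t b → Par w t b′ → C (b ≡ b′)
  Par-unique []      refl refl = return refl
  Par-unique (s ∷ w) (b₁ , i , p) (b₁′ , i′ , p′) = do
    refl ← Is-unique b₁ b₁′ i i′
    eq ← Par-unique w p p′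
    return (xor-injective b₁ eq)

  conj : Word → Word → Word
  conj u t = inv u ++ t ++ u

  conj-cong : ∀ {u u′ t t′} → u ~ u′ → t ~ t′ → conj u t ~ conj u′ t′
  conj-cong p q = ~-++ (inv-cong p) (~-++ q p)

  conj-∷ : ∀ s u t → conj u (s ∷ t ++ [ s ]) ~ conj (s ∷ u) t
  conj-∷ s u t = ~-reflexive (trans (cong (λ z → inv u ++ s ∷ z) (++-assoc t [ s ] u))
    (trans (sym (++-assoc (inv u) [ s ] _)) (cong (_++ t ++ s ∷ u) (sym (unfold-reverse s u)))))

  -- The cocycle property of inversion parity: seen from the start of `u ++ v`, the inversions of
  -- `v` are conjugated by `u`. Nearly all later computations with inversions are instances of it.
  Par-++ : ∀ u v {t b b′} → Par u t b → Par v (conj u t) b′ → Par (u ++ v) t (b xor b′)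
  Par-++ []      v {t} refl q = Par-cong v (~-reflexive (++-identityʳ t)) q
  Par-++ (s ∷ u) v {t} {b} {b′} (b₁ , i , p) q = b₁ , i ,
    subst (Par (u ++ v) _) (xor-assoc b₁ b b′) (Par-++ u v p (Par-cong v (~-sym (conj-∷ s u t)) q))

  infix 4 _≋_
  -- The parity of occurrences of an inversion, unlike their number, survives cancellations and
  -- braid moves. Checking this for both kinds of `Step` makes it a function on the group, from
  -- which the exchange condition follows.
  _≋_ : Word → Word → Set
  u ≋ v = ∀ t b → Par u t b → C (Par v t b)

  ≋-sym : ∀ {u v} → u ≋ v → v ≋ u
  ≋-sym {u} {v} p t b q = do
    (b′ , r) ← Par-total u t
    r′ ← p t b′ r
    eq ← Par-unique v r′ q
    return (subst (Par u t) eq r)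

  ≋-context : ∀ a b {u v} → u ~ v → u ≋ v → a ++ u ++ b ≋ a ++ v ++ b
  ≋-context a b {u} {v} e p t c q = do
    (c₁ , q₁) ← Par-total a t
    (c₂ , q₂) ← Par-total u (conj a t)
    (c₃ , q₃) ← Par-total b (conj u (conj a t))
    q₂′ ← p (conj a t) c₂ q₂
    eq ← Par-unique (a ++ u ++ b) (Par-++ a (u ++ b) q₁ (Par-++ u b q₂ q₃)) q
    return (subst (Par (a ++ v ++ b) t) eq
      (Par-++ a (v ++ b) q₁ (Par-++ v b q₂′ (Par-cong b (conj-cong e ~-refl) q₃))))

  ss-invol : ∀ s → [ s ] ++ [ s ] ~ []
  ss-invol s = return (ss≈ s)

  ss≋ : ∀ s → s ∷ s ∷ [] ≋ []
  ss≋ s t b (b₁ , i , b₂ , j , p) = do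
      refl ← Is-unique b₂ b₁ (Is-map b₂ back forth j) i
      return (trans (sym (xor-cancel b₁ b)) p)
    where
    forth : [ s ] ~ t → [ s ] ~ s ∷ t ++ [ s ]
    forth e = ~-trans (solve (invo [ s ] (ss-invol s) ◂ ⟨⟩) v₀ (v₀ ⊙ v₀ ⊙ v₀) refl) (conj-s s e)
    back : [ s ] ~ s ∷ t ++ [ s ] → [ s ] ~ t
    back e = ~-trans (solve (invo [ s ] (ss-invol s) ◂ ⟨⟩) v₀ (v₀ ⊙ v₀ ⊙ v₀) refl)
        (~-trans (conj-s s e) (solve (invo [ s ] (ss-invol s) ◂ free t ◂ ⟨⟩) (v₀ ⊙ (v₀ ⊙ v₁ ⊙ v₀) ⊙ v₀) v₁ refl))

  nxt : S → S → ℕ → S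
  nxt s t zero    = s
  nxt s t (suc n) = nxt t s n

  alt-+ : ∀ s t m n → alt s t (m + n) ≡ alt s t m ++ alt (nxt s t m) (nxt t s m) n
  alt-+ s t zero    n = refl
  alt-+ s t (suc m) n = cong (s ∷_) (alt-+ t s m n)

  alt-snoc : ∀ s t n → alt s t (suc n) ≡ alt s t n ++ [ nxt s t n ]
  alt-snoc s t n = trans (cong (alt s t) (ℕₚ.+-comm 1 n)) (alt-+ s t n 1)

  alt-reverse : ∀ s t n → inv (alt s t n) ≡ alt (nxt t s n) (nxt s t n) n
  alt-reverse s t zero    = refl
  alt-reverse s t (suc n) = trans (cong inv (alt-snoc s t n)) (trans (reverse-++ (alt s t n) _)
    (cong (nxt s t n ∷_) (alt-reverse s t n)))

  nxt-even : ∀ s t n → nxt s t (n + n) ≡ s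
  nxt-even s t zero    = refl
  nxt-even s t (suc n) = trans (cong (nxt t s) (ℕₚ.+-suc n n)) (nxt-even s t n)

  -- The i-th inversion of alt s t k.
  rot : S → S → ℕ → Word
  rot s t i = alt s t (suc (i + i))

  rot-suc : ∀ s t i → s ∷ rot t s i ++ [ s ] ≡ rot s t (suc i)
  rot-suc s t i = cong (s ∷_) (trans (cong (λ z → rot t s i ++ [ z ]) (sym (nxt-even s t i)))
    (trans (sym (alt-snoc t s (suc (i + i)))) (cong (alt t s ∘ suc) (sym (ℕₚ.+-suc i i)))))

  -- The braid relation gives `(st)ᵏ = 1`, so `alt s t (i + i)` is the inverse of
  -- `alt s t (suc j + suc j)`. The two sides of the relation therefore have the same inversions in
  -- opposite order.
  rot-swap : ∀ s t k → alt s t k ~ alt t s k → ∀ i j → suc (i + j) ≡ k → rot s t i ~ rot t s j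
  rot-swap s t k br i j refl = begin
      rot s t i                                  ≈⟨ ~-reflexive (trans (alt-snoc s t (i + i)) (cong (λ z → alt s t (i + i) ++ [ z ]) (nxt-even s t i))) ⟩
      alt s t (i + i) ++ [ s ]                   ≈⟨ cancel-right ⟩
      inv (alt s t (suc j + suc j)) ++ [ s ]     ≈⟨ ~-reflexive last ⟩
      rot t s j ++ s ∷ [ s ]                     ≈⟨ ~-++ {rot t s j} ~-refl (ss-invol s) ⟩
      rot t s j ++ []                            ≈⟨ ~-reflexive (++-identityʳ _) ⟩
      rot t s j                                  ∎
    where
    open ~-Reasoning
    k₀ = suc (i + j)
    swap : ∀ {s t} n → alt s t k₀ ~ alt t s k₀ → alt (nxt s t n) (nxt t s n) k₀ ~ alt (nxt t s n) (nxt s t n) k₀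
    swap zero    p = p
    swap (suc n) p = swap n (~-sym p)
    full : alt s t (k₀ + k₀) ~ []
    full = ~-trans (~-reflexive (alt-+ s t k₀ k₀)) (~-trans
      (~-++ {alt s t k₀} ~-refl (~-trans (swap k₀ br) (~-reflexive (sym (alt-reverse s t k₀)))))
      (return (inv-right (alt s t k₀))))
    product : alt s t (i + i) ++ alt s t (suc j + suc j) ~ []
    product = ~-trans (~-reflexive (trans (cong₂ (λ x y → alt s t (i + i) ++ alt x y (suc j + suc j)) (sym (nxt-even s t i)) (sym (nxt-even t s i)))
      (trans (sym (alt-+ s t (i + i) (suc j + suc j))) (cong (alt s t) arith)))) full
      where
      open ℕSolver.+-*-Solver renaming (solve to solveℕ)
      arith : i + i + (suc j + suc j) ≡ k₀ + k₀
      arith = solveℕ 2 (λ i j → i :+ i :+ (con 1 :+ j :+ (con 1 :+ j)) := con 1 :+ (i :+ j) :+ (con 1 :+ (i :+ j))) refl i j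
    cancel-right : alt s t (i + i) ++ [ s ] ~ inv (alt s t (suc j + suc j)) ++ [ s ]
    cancel-right = ~-++ (inverseˡ-unique (alt s t (i + i)) (alt s t (suc j + suc j)) product) ~-refl
      where open import Algebra.Properties.Group group using (inverseˡ-unique)
    last : inv (alt s t (suc j + suc j)) ++ [ s ] ≡ rot t s j ++ s ∷ [ s ]
    last = trans (cong (_++ [ s ]) (trans (alt-reverse s t (suc j + suc j))
        (trans (cong₂ (λ x y → alt x y (suc j + suc j)) (nxt-even t s (suc j)) (nxt-even s t (suc j)))
        (trans (cong (alt t s ∘ suc) (ℕₚ.+-suc j j)) (trans (alt-snoc t s (suc (j + j)))
          (cong (λ z → rot t s j ++ [ z ]) (nxt-even s t j))))))) (++-assoc (rot t s j) [ s ] [ s ])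

  -- Parity of the number of true P i with i < k.
  Count : ℕ → (ℕ → Set) → Bool → Set
  Count zero    P b = b ≡ false
  Count (suc k) P b = ∃[ b₁ ] (Is b₁ (P 0) × Count k (P ∘ suc) (b₁ xor b))

  Count-snoc : ∀ k {P : ℕ → Set} {b b₁} → Is b₁ (P k) → Count k P b → Count (suc k) P (b₁ xor b)
  Count-snoc zero    {b₁ = b₁} i refl = b₁ , i , xor-cancel b₁ false
  Count-snoc (suc k) {P} {b} {b₁} i (b₂ , j , p) = b₂ , j ,
    subst (Count (suc k) (P ∘ suc)) (trans (sym (xor-assoc b₁ b₂ b)) (trans (cong (_xor b) (xor-comm b₁ b₂)) (xor-assoc b₂ b₁ b)))
      (Count-snoc k i p)

  Count-reverse : ∀ k {P Q : ℕ → Set} → (∀ i j → suc (i + j) ≡ k → (P i → Q j) × (Q j → P i)) →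
    ∀ {b} → Count k P b → Count k Q b
  Count-reverse zero    f p = p
  Count-reverse (suc k) {P} {Q} f {b} (b₁ , i , p) = subst (Count (suc k) Q) (xor-cancel b₁ b)
    (Count-snoc k (Is-map b₁ (proj₁ (f 0 k refl)) (proj₂ (f 0 k refl)) i)
      (Count-reverse k (λ i j eq → f (suc i) j (cong suc eq)) p))

  Count-map : ∀ k {P Q : ℕ → Set} → (∀ i → (P i → Q i) × (Q i → P i)) → ∀ {b} → Count k P b → Count k Q b
  Count-map zero    f p = p
  Count-map (suc k) f (b₁ , i , p) = b₁ , Is-map b₁ (proj₁ (f 0)) (proj₂ (f 0)) i , Count-map k (f ∘ suc) p

  move : ∀ s {t t′} → t ~ s ∷ t′ ++ [ s ] → s ∷ t ++ [ s ] ~ t′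
  move s {t} {t′} e = ~-trans (conj-s s e)
    (solve (invo [ s ] (ss-invol s) ◂ free t′ ◂ ⟨⟩) (v₀ ⊙ (v₀ ⊙ v₁ ⊙ v₀) ⊙ v₀) v₁ refl)

  Par⇒Count : ∀ k s t {τ b} → Par (alt s t k) τ b → Count k (λ i → rot s t i ~ τ) b
  Par⇒Count zero    s t p = p
  Par⇒Count (suc k) s t (b₁ , i , p) = b₁ , i , Count-map k
    (λ i → (λ e → ~-trans (~-sym (~-reflexive (rot-suc s t i))) (move s e))
         , (λ e → ~-sym (move s (~-trans (~-sym e) (~-sym (~-reflexive (rot-suc s t i)))))))
    (Par⇒Count k t s p)

  Count⇒Par : ∀ k s t {τ b} → Count k (λ i → rot s t i ~ τ) b → Par (alt s t k) τ b
  Count⇒Par zero    s t p = p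
  Count⇒Par (suc k) s t (b₁ , i , p) = b₁ , i , Count⇒Par k t s (Count-map k
    (λ i → (λ e → ~-sym (move s (~-trans (~-sym e) (~-sym (~-reflexive (rot-suc s t i))))))
         , (λ e → ~-trans (~-sym (~-reflexive (rot-suc s t i))) (move s e))) p)

  braid≋ : ∀ s t k → alt s t k ~ alt t s k → alt s t k ≋ alt t s k
  braid≋ s t k br τ b p = return (Count⇒Par k t s (Count-reverse k
    (λ i j eq → (λ e → ~-trans (~-sym (rot-swap s t k br i j eq)) e) , (λ e → ~-trans (rot-swap s t k br i j eq) e))
    (Par⇒Count k s t p)))

  Step≋ : ∀ {u v} → Step u v → u ≋ v
  Step≋ (cancel u s v) = ≋-context u v (return (ss≈ s)) (ss≋ s)
  Step≋ (braid u s t k v m≡) = ≋-context u v br (braid≋ s t k br)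
    where
    br : alt s t k ~ alt t s k
    br = return (subst₂ _≈_ (++-identityʳ _) (++-identityʳ _) (EqC.return (braid [] s t k [] m≡)))

  ≈⇒≋ : ∀ {u v} → u ≈ v → u ≋ v
  ≈⇒≋ ε t b p = return p
  ≈⇒≋ (Sym.fwd st ◅ r) t b p = Step≋ st t b p >>= ≈⇒≋ r t b
  ≈⇒≋ (Sym.bwd st ◅ r) t b p = ≋-sym (Step≋ st) t b p >>= ≈⇒≋ r t b

  Par-~ : ∀ {u v} → u ~ v → u ≋ v
  Par-~ e t b p = e >>= λ e → ≈⇒≋ e t b p

true≢false : true ≢ false
true≢false ()

module Inversions (W : CoxeterSystem) (G : Set) where
  open import Data.Nat using (_+_; _≤_)
  open CoxeterSystem W
  open Coxeter W renaming (_≈_ to infix 4 _≈_; _≤B_ to infix 4 _≤B_; _ℓ<_ to infix 4 _ℓ<_)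
  open Classical G
  open Words W G

  -- N w t: the reflection t is a left inversion of w.
  N : Word → Word → Set
  N w t = C (Par w t true)

  Par⇒Is : ∀ {w t} b → C (Par w t b) → Is b (N w t)
  Par⇒Is true  p = p
  Par⇒Is {w} false p q = run (do
    p ← p
    q ← q
    eq ← Par-unique w q p
    λ _ → ⊥-elim (true≢false eq))

  Is⇒Par : ∀ {w t} b → Is b (N w t) → C (Par w t b)
  Is⇒Par true  p = p
  Is⇒Par {w} {t} false ¬p = do
    (true , q) ← Par-total w t
      where (false , q) → return q
    impossible (¬p (return q))

  N-cong : ∀ {w w′ t t′} → w ~ w′ → t ~ t′ → N w t → N w′ t′
  N-cong {w′ = w′} p q n = n >>= λ n → Par-~ p _ _ n >>= λ n → return (Par-cong w′ q n)

  Is-cong : ∀ {w w′ t t′} b → w ~ w′ → t ~ t′ → Is b (N w t) → Is b (N w′ t′)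
  Is-cong b p q = Is-map b (N-cong p q) (N-cong (~-sym p) (~-sym q))

  N-++ : ∀ u v {t} a b → Is a (N u t) → Is b (N v (conj u t)) → Is (a xor b) (N (u ++ v) t)
  N-++ u v a b p q = Par⇒Is (a xor b) (do p ← Is⇒Par a p ; q ← Is⇒Par b q ; return (Par-++ u v p q))

  N-[] : ∀ t → N [] t → G
  N-[] t n = n λ ()

  N-letter : ∀ {s t} a → Is a ([ s ] ~ t) → Is a (N [ s ] t)
  N-letter {s} {t} a p = Par⇒Is a (return (a , p , xor-same a))

  N-letter⁻ : ∀ {s t} → N [ s ] t → [ s ] ~ t
  N-letter⁻ n = n >>= λ where
    (true  , p , _)  → p
    (false , p , ())

  N-∷ : ∀ s w {t} a b → Is a ([ s ] ~ t) → Is b (N w (s ∷ t ++ [ s ])) → Is (a xor b) (N (s ∷ w) t)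
  N-∷ s w a b p q = N-++ [ s ] w a b (N-letter a p) q

  infixr 6 _◁_
  _◁_ : Word → Word → Word
  w ◁ t = w ++ t ++ inv w

  ◁-cong : ∀ {w w′ t t′} → w ~ w′ → t ~ t′ → w ◁ t ~ w′ ◁ t′
  ◁-cong p q = ~-++ p (~-++ q (inv-cong p))

  conj-inv : ∀ w t → conj (inv w) t ~ w ◁ t
  conj-inv w t = solve (free w ◂ free t ◂ ⟨⟩) (v₀ ′ ′ ⊙ v₁ ⊙ v₀ ′) (v₀ ⊙ v₁ ⊙ v₀ ′) refl

  conj-◁ : ∀ w t → conj w (w ◁ t) ~ t
  conj-◁ w t = solve (free w ◂ free t ◂ ⟨⟩) (v₀ ′ ⊙ (v₀ ⊙ v₁ ⊙ v₀ ′) ⊙ v₀) v₁ refl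

  ◁-conj : ∀ w t → w ◁ conj w t ~ t
  ◁-conj w t = solve (free w ◂ free t ◂ ⟨⟩) (v₀ ⊙ (v₀ ′ ⊙ v₁ ⊙ v₀) ⊙ v₀ ′) v₁ refl

  false≡xor : ∀ {a b} → a xor b ≡ false → a ≡ b
  false≡xor {true}  {true}  _ = refl
  false≡xor {false} {false} _ = refl

  -- Turns a claim about inversions into an equation between Booleans: the truth value `b` may be
  -- taken as known and is then computed.
  N-value : ∀ {w t} a → (∀ b → Is b (N w t) → C (b ≡ a)) → Is a (N w t)
  N-value {w} {t} true f = do
    (false , p) ← Par-total w t
      where (true , p) → return p
    eq ← f false (Par⇒Is false (return p))
    ⊥-elim (true≢false (sym eq))
  N-value false f n = f true n (⊥-elim ∘ true≢false)

  N-inv : ∀ w {t} a → Is a (N w (w ◁ t)) → Is a (N (inv w) t)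
  N-inv w {t} a n = N-value a λ b m → Is-unique {N (inv w ++ w) t} (b xor a) false
    (N-++ (inv w) w b a m (Is-cong a ~-refl (~-sym (conj-inv w t)) n))
    (λ k → N-[] t (N-cong {t = t} (return (inv-left w)) ~-refl k))
    >>= λ eq → return (false≡xor {b} {a} eq)

  Refl : Word → Set
  Refl t = C (∃[ r ] ∃[ s ] t ~ r ◁ [ s ])

  Refl-invol : ∀ {t} → Refl t → t ++ t ~ []
  Refl-invol {t} p = do
    (r , s , e) ← p
    ~-trans (~-++ e e) (~-trans (solve (free r ◂ invo [ s ] (ss-invol s) ◂ ⟨⟩) ((v₀ ⊙ v₁ ⊙ v₀ ′) ⊙ (v₀ ⊙ v₁ ⊙ v₀ ′)) (v₀ ⊙ v₀ ′) refl)
      (return (inv-right r)))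

  Refl-cong : ∀ {t t′} → t ~ t′ → Refl t → Refl t′
  Refl-cong e p = do
    (r , s , f) ← p
    return (r , s , ~-trans (~-sym e) f)

  Refl-◁ : ∀ w {t} → Refl t → Refl (w ◁ t)
  Refl-◁ w {t} p = do
    (r , s , e) ← p
    return (w ++ r , s , ~-trans (◁-cong (~-refl {w}) e)
      (solve (free w ◂ free r ◂ free [ s ] ◂ ⟨⟩) (v₀ ⊙ (v₁ ⊙ v₂ ⊙ v₁ ′) ⊙ v₀ ′) ((v₀ ⊙ v₁) ⊙ v₂ ⊙ (v₀ ⊙ v₁) ′) refl))

  Refl-letter : ∀ s → Refl [ s ]
  Refl-letter s = return ([] , s , ~-refl)

  Refl-conj : ∀ w {t} → Refl t → Refl (conj w t)
  Refl-conj w {t} p = Refl-cong (solve (free w ◂ free t ◂ ⟨⟩) (v₀ ′ ⊙ v₁ ⊙ v₀ ′ ′) (v₀ ′ ⊙ v₁ ⊙ v₀) refl) (Refl-◁ (inv w) p)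

  -- An inversion of the palindrome `r s r⁻¹` comes from its first half (`a`), its centre (`b`) or
  -- its second half (`c`); conjugation by the reflection itself interchanges the halves.
  N-palindrome : ∀ r s x a b c → Is a (N r x) → Is b ([ s ] ~ conj r x) → Is c (N r ((r ◁ [ s ]) ◁ x)) →
    Is (a xor (b xor c)) (N (r ◁ [ s ]) x)
  N-palindrome r s x a b c p q o = N-++ r ([ s ] ++ inv r) a (b xor c) p
    (N-∷ s (inv r) b c q (N-inv r c (Is-cong c ~-refl
      (solve (free r ◂ invo [ s ] (ss-invol s) ◂ free x ◂ ⟨⟩)
        ((v₀ ⊙ v₁ ⊙ v₀ ′) ⊙ v₂ ⊙ (v₀ ⊙ v₁ ⊙ v₀ ′) ′)
        (v₀ ⊙ (v₁ ⊙ (v₀ ′ ⊙ v₂ ⊙ v₀) ⊙ v₁) ⊙ v₀ ′) refl) o)))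

  N-self : ∀ {t} → Refl t → N t t
  N-self {t} p = p >>= λ (r , s , e) → N-cong (~-sym e) (~-sym e) (self r s)
    where
    self : ∀ r s → N (r ◁ [ s ]) (r ◁ [ s ])
    self r s = N-value true λ b m → go b m
      where
      go : ∀ b → Is b (N (r ◁ [ s ]) (r ◁ [ s ])) → C (b ≡ true)
      go true  _ = return refl
      go false m = do
        (a , p) ← Is-total (N r (r ◁ [ s ]))
        impossible (contra a (N-palindrome r s (r ◁ [ s ]) a true a p (~-sym (conj-◁ r [ s ]))
          (Is-cong a ~-refl (solve (free (r ◁ [ s ]) ◂ ⟨⟩) v₀ (v₀ ⊙ v₀ ⊙ v₀ ′) refl) p)))
        where
        contra : ∀ a → Is (a xor (true xor a)) (N (r ◁ [ s ]) (r ◁ [ s ])) → G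
        contra true  n = m n
        contra false n = m n

  -- As `t` fixes `x` under conjugation, the two halves of the palindrome contribute equally and
  -- cancel, and `x` is not its centre.
  N-commute : ∀ {t x} → Refl t → t ◁ x ~ x → (x ~ t → G) → N t x → G
  N-commute {t} {x} p comm x≁t n = run (do
    (r , s , e) ← p
    (a , q) ← Is-total (N r x)
    return (contra r s e a (N-palindrome r s x a false a q
      (λ f → x≁t (~-trans (~-sym (◁-conj r x)) (~-trans (◁-cong {r} ~-refl (~-sym f)) (~-sym e))))
      (Is-cong a ~-refl (~-trans (~-sym comm) (◁-cong e ~-refl)) q))))
    where
    contra : ∀ r s → t ~ r ◁ [ s ] → ∀ a → Is (a xor (false xor a)) (N (r ◁ [ s ]) x) → G
    contra r s e true  m = m (N-cong e ~-refl n)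
    contra r s e false m = m (N-cong e ~-refl n)

  -- The walk stops at the first letter whose inversion is `t`; an odd count guarantees that there
  -- is one. The shortened word is kept as a sublist, because elements below a given one have to be
  -- produced as subwords.
  exchange : ∀ w {t} → Par w t true → C (∃[ w′ ] (suc (length w′) ≡ length w × w′ ⊆ w × t ++ w ~ w′))
  exchange (s ∷ w) {t} (true , e , p) = return (w , refl , s ∷ʳ ⊆-refl ,
    ~-trans (~-++ (~-sym e) (~-refl {s ∷ w})) (solve (invo [ s ] (ss-invol s) ◂ free w ◂ ⟨⟩) (v₀ ⊙ v₀ ⊙ v₁) v₁ refl))
  exchange (s ∷ w) {t} (false , e , p) = do
    (w′ , l , sub , f) ← exchange w p
    return (s ∷ w′ , cong suc l , refl ∷ sub ,
      ~-trans (solve (invo [ s ] (ss-invol s) ◂ free t ◂ free w ◂ ⟨⟩) (v₁ ⊙ v₀ ⊙ v₂) (v₀ ⊙ (v₀ ⊙ v₁ ⊙ v₀) ⊙ v₂) refl)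
        (~-++ {[ s ]} ~-refl f))

  N-t· : ∀ {t w} → Refl t → ∀ a → Is a (N w t) → Is (not a) (N (t ++ w) t)
  N-t· {t} {w} r a n = N-++ t w true a (N-self r) (Is-cong a ~-refl (solve (free t ◂ ⟨⟩) v₀ (v₀ ′ ⊙ v₀ ⊙ v₀) refl) n)

  tt-cancel : ∀ {t} w → Refl t → t ++ t ++ w ~ w
  tt-cancel {t} w r = solve (invo t (Refl-invol r) ◂ free w ◂ ⟨⟩) (v₀ ⊙ v₀ ⊙ v₁) v₁ refl

module Length (W : CoxeterSystem) where
  open import Data.Nat using (_+_; _≤_)
  open CoxeterSystem W
  open Coxeter W renaming (_≈_ to infix 4 _≈_; _≤B_ to infix 4 _≤B_; _ℓ<_ to infix 4 _ℓ<_)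
  open Classical ⊥
  open Words W ⊥
  open Inversions W ⊥ public

  least : (P : ℕ → Set) → ∀ {n} → P n → C (∃[ n ] (P n × (∀ m → P m → n ≤ m)))
  least P {n} p = go n p ℕₚ.≤-refl
    where
    go : ∀ m {n} → P n → n ≤ m → C (∃[ n ] (P n × (∀ m → P m → n ≤ m)))
    go m {n} p n≤m = em (∃[ k ] (P k × k < n)) >>= λ
      { (inj₂ none) → return (n , p , λ k q → ℕₚ.≮⇒≥ λ lt → none (k , q , lt))
      ; (inj₁ (k , q , lt)) → smaller m q (ℕₚ.<-≤-trans lt n≤m) }
      where
      smaller : ∀ m {n} → P n → n < m → C (∃[ n ] (P n × (∀ m → P m → n ≤ m)))
      smaller (suc m) p lt = go m p (s≤s⁻¹ lt)

  Red : Word → Set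
  Red w = Len w (length w)

  Len-total : ∀ w → C (∃[ n ] Len w n)
  Len-total w = do
    (n , p , m) ← least (λ n → ∃[ w′ ] (w′ ≈ w × length w′ ≡ n)) (w , ≈-refl , refl)
    return (n , p , λ w′ e → m (length w′) (w′ , e , refl))

  Len-cong : ∀ {u v n} → u ≈ v → Len u n → Len v n
  Len-cong e ((w , f , l) , m) = (w , ≈-trans f e , l) , λ w′ g → m w′ (≈-trans g (≈-sym e))

  Len-min : ∀ {u v a} → Len u a → v ~ u → a ≤ length v
  Len-min {u} {v} {a} (_ , m) e = decidable-stable (a ℕ.≤? length v) (e >>= λ e → return (m v e))

  Len-≤ : ∀ {u v a b} → Len u a → Len v b → u ~ v → a ≤ b
  Len-≤ p ((w , e , refl) , _) f = Len-min p (~-trans (return e) (~-sym f))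

  Len-unique : ∀ {u v a b} → Len u a → Len v b → u ~ v → a ≡ b
  Len-unique p q e = ℕₚ.≤-antisym (Len-≤ p q e) (Len-≤ q p (~-sym e))

  reduced : ∀ {w n} → Len w n → ∃[ w′ ] (w′ ≈ w × length w′ ≡ n × Red w′)
  reduced {w} ((w′ , e , refl) , m) = w′ , e , refl , (w′ , ≈-refl , refl) , λ v f → m v (≈-trans f e)

  N⇒< : ∀ {w t a b} → N w t → Len w a → Len (t ++ w) b → b < a
  N⇒< {w} {t} {a} {b} n p q = decidable-stable (b ℕ.<? a) (go (reduced p))
    where
    go : ∃[ w′ ] (w′ ≈ w × length w′ ≡ a × Red w′) → C (b < a)
    go (w′ , e , refl , _) = do
      m ← N-cong {t = t} {t} (~-sym (return e)) ~-refl n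
      (v , l , _ , f) ← exchange w′ m
      return (subst (b <_) l (s≤s (Len-min q (~-trans (~-sym f) (~-++ (~-refl {t}) (return e))))))

  ¬N⇒> : ∀ {w t a b} → Refl t → ¬ N w t → Len w a → Len (t ++ w) b → a < b
  ¬N⇒> {w} {t} {a} {b} r n p q = decidable-stable (a ℕ.<? b) do
    (c , p′) ← Len-total (t ++ t ++ w)
    return (subst (_< b) (Len-unique p′ p (tt-cancel w r)) (N⇒< (N-t· r false n) q p′))

  Len-++ : ∀ {u v a b c} → Len u a → Len v b → Len (u ++ v) c → c ≤ a + b
  Len-++ ((u′ , e , refl) , _) ((v′ , f , refl) , _) p =
    subst (_ ≤_) (length-++ u′) (Len-min p (return (≈-++ e f)))

  Len-letter : ∀ {s a} → Len [ s ] a → a ≤ 1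
  Len-letter {s} p = Len-min p (~-refl {[ s ]})

  <⇒N : ∀ {w t a b} → Refl t → Len w a → Len (t ++ w) b → b < a → N w t
  <⇒N {w} {t} r p q lt k = run (em (N w t) >>= λ
    { (inj₁ n) → impossible (n k)
    ; (inj₂ n) → impossible (ℕₚ.<-asym lt (¬N⇒> r n p q)) })

  >⇒¬N : ∀ {w t a b} → Len w a → Len (t ++ w) b → a < b → ¬ N w t
  >⇒¬N p q lt n = ℕₚ.<-asym lt (N⇒< n p q)

  Len-up : ∀ {s w a b} → ¬ N w [ s ] → Len w a → Len (s ∷ w) b → b ≡ suc a
  Len-up {s} {w} {a} n p q = ℕₚ.≤-antisym up (¬N⇒> (Refl-letter s) n p q)
    where
    up = decidable-stable (_ ℕ.≤? suc a) do
      (c , r) ← Len-total [ s ]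
      return (ℕₚ.≤-trans (Len-++ r p q) (ℕₚ.+-monoˡ-≤ a (Len-letter r)))

  Len-down : ∀ {s w a b} → N w [ s ] → Len w a → Len (s ∷ w) b → a ≡ suc b
  Len-down {s} {w} n p q = decidable-stable (_ ℕ.≟ _) do
    (c , r) ← Len-total (s ∷ s ∷ w)
    return (trans (Len-unique p r (~-sym (tt-cancel w (Refl-letter s)))) (Len-up (N-t· (Refl-letter s) true n) q r))

  Len-inv : ∀ {w a} → Len w a → Len (inv w) a
  Len-inv {w} ((w′ , e , refl) , m) = (inv w′ , inv-≈ e , length-reverse w′) ,
      λ v f → subst (length w′ ≤_) (length-reverse v) (m (inv v) (subst (inv v ≈_) (reverse-involutive w) (inv-≈ f)))
    where
    inv-≈ : ∀ {u v} → u ≈ v → inv u ≈ inv v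
    inv-≈ {u} {v} e = ≈-trans (subst (_≈ inv u ++ v ++ inv v) (++-identityʳ _) (≈-sym (subst (_≈ inv u ++ []) refl (≈-++ (≈-refl {inv u}) (inv-right v)))))
      (subst (_≈ inv v) (++-assoc (inv u) v (inv v)) (≈-++ (≈-trans (≈-++ (≈-refl {inv u}) (≈-sym e)) (inv-left u)) ≈-refl))

  N-join : ∀ {w t} → ¬ ¬ N w t → N w t
  N-join n = n >>= id

  N-right : ∀ u v {t} → ¬ N u t → N (u ++ v) t → N v (conj u t)
  N-right u v nu n = N-join λ nv → N-++ u v false false nu nv n

  N-left : ∀ u v {t} → N (u ++ v) t → ¬ N v (conj u t) → N u t
  N-left u v n nv = N-join λ nu → N-++ u v false false nu nv n

  -- Otherwise exchange deletes one letter from `u` and one from `v`. Together this multiplies by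
  -- `t` twice, so the same element would have a shorter word.
  Red-disjoint : ∀ u v {t} → Red (u ++ v) → Refl t → N u t → ¬ N v (conj u t)
  Red-disjoint u v {t} (_ , m) r nu nv = run (do
    nu ← nu
    nv ← nv
    (u′ , l , _ , e) ← exchange u nu
    (v′ , l′ , _ , e′) ← exchange v nv
    f ← ~-trans (~-++ (~-sym e) (~-sym e′)) (solve (invo t (Refl-invol r) ◂ free u ◂ free v ◂ ⟨⟩)
      ((v₀ ⊙ v₁) ⊙ (v₁ ′ ⊙ v₀ ⊙ v₁) ⊙ v₂) (v₁ ⊙ v₂) refl)
    return (ℕₚ.<⇒≱ (subst₂ _<_ (sym (length-++ u′)) (sym (length-++ u))
      (ℕₚ.+-mono-<-≤ (ℕₚ.≤-reflexive l) (ℕₚ.≤-trans (ℕₚ.n≤1+n _) (ℕₚ.≤-reflexive l′)))) (m (u′ ++ v′) f)))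

  N-prefix : ∀ u v {t} → Red (u ++ v) → Refl t → N u t → N (u ++ v) t
  N-prefix u v red r nu = N-++ u v true false nu (Red-disjoint u v red r nu)

  Red-prefix : ∀ u v → Red (u ++ v) → Red u
  Red-prefix u v (_ , m) = (u , ≈-refl , refl) , λ w e → ℕₚ.+-cancelʳ-≤ (length v) (length u) (length w)
    (subst₂ _≤_ (length-++ u) (length-++ w) (m (w ++ v) (≈-++ e ≈-refl)))

  Red-suffix : ∀ u v → Red (u ++ v) → Red v
  Red-suffix u v (_ , m) = (v , ≈-refl , refl) , λ w e → ℕₚ.+-cancelˡ-≤ (length u) (length v) (length w)
    (subst₂ _≤_ (length-++ u) (length-++ u) (m (u ++ w) (≈-++ (≈-refl {u}) e)))

  position : ∀ p {t} → Par p t true → C (∃[ q ] ∃[ s ] ∃[ q′ ] (p ≡ q ++ s ∷ q′ × t ~ q ◁ [ s ]))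
  position (s ∷ p) (true , e , _) = return ([] , s , p , refl , ~-sym e)
  position (s ∷ p) {t} (false , _ , n) = do
    (q , s′ , q′ , eq , e) ← position p n
    return (s ∷ q , s′ , q′ , cong (s ∷_) eq , ~-trans
      (solve (invo [ s ] (ss-invol s) ◂ free t ◂ ⟨⟩) v₁ (v₀ ⊙ (v₀ ⊙ v₁ ⊙ v₀) ⊙ v₀) refl)
      (~-trans (conj-s s e) (solve (invo [ s ] (ss-invol s) ◂ free q ◂ free [ s′ ] ◂ ⟨⟩)
        (v₀ ⊙ (v₁ ⊙ v₂ ⊙ v₁ ′) ⊙ v₀) ((v₀ ⊙ v₁) ⊙ v₂ ⊙ (v₀ ⊙ v₁) ′) refl)))

-- Reflections and covers in the Bruhat order

module Pencils (W : CoxeterSystem) where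
  open import Data.Nat using (_+_; _≤_)
  open CoxeterSystem W
  open Coxeter W renaming (_≈_ to infix 4 _≈_; _≤B_ to infix 4 _≤B_; _ℓ<_ to infix 4 _ℓ<_)
  open Classical ⊥
  open Words W ⊥
  open Length W
  open ~-Reasoning

  ~-join : ∀ {u v} → C (u ~ v) → u ~ v
  ~-join p = p >>= id

  -- The pencil of f: the reflections r such that r f is a reflection.
  In : Word → Word → Set
  In f r = Refl r × Refl (r ++ f)

  In-cong : ∀ {f f′ r r′} → f ~ f′ → r ~ r′ → In f r → In f′ r′
  In-cong p q (a , b) = Refl-cong q a , Refl-cong (~-++ q p) b

  left-~ : ∀ a {b b′} → b ~ b′ → a ++ b ~ a ++ b′
  left-~ a = ~-++ (~-refl {a})

  right-~ : ∀ {a a′} b → a ~ a′ → a ++ b ~ a′ ++ b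
  right-~ b p = ~-++ p (~-refl {b})

  -- This is `(rf)² = 1`. Conjugation by a member thus takes the pencil of `f` to the pencil of
  -- `f⁻¹`, which is the same set: a pencil is closed under conjugation by its members.
  In-inverts : ∀ {f r} → In f r → r ++ f ++ r ~ inv f
  In-inverts {f} {r} (a , b) = begin
    r ++ f ++ r                       ≈⟨ solve (free r ◂ free f ◂ ⟨⟩) (v₀ ⊙ v₁ ⊙ v₀) (((v₀ ⊙ v₁) ⊙ (v₀ ⊙ v₁)) ⊙ v₁ ′) refl ⟩
    ((r ++ f) ++ (r ++ f)) ++ inv f   ≈⟨ right-~ (inv f) (Refl-invol b) ⟩
    inv f                             ∎

  In-mul : ∀ {f r} → In f r → In f (r ++ f)
  In-mul {f} {r} (a , b) = b , Refl-cong (begin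
      (r ++ f) ◁ r           ≈⟨ solve (invo r (Refl-invol a) ◂ free f ◂ ⟨⟩) ((v₀ ⊙ v₁) ⊙ v₀ ⊙ (v₀ ⊙ v₁) ′) ((v₀ ⊙ v₁) ⊙ v₀ ⊙ v₁ ′ ⊙ v₀) refl ⟩
      (r ++ f) ++ r ++ inv f ++ r ≈⟨ left-~ (r ++ f) (left-~ r (right-~ r (~-sym (In-inverts (a , b))))) ⟩
      (r ++ f) ++ r ++ (r ++ f ++ r) ++ r ≈⟨ solve (invo r (Refl-invol a) ◂ free f ◂ ⟨⟩) ((v₀ ⊙ v₁) ⊙ v₀ ⊙ (v₀ ⊙ v₁ ⊙ v₀) ⊙ v₀) ((v₀ ⊙ v₁) ⊙ v₁) refl ⟩
      (r ++ f) ++ f          ∎)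
    (Refl-◁ (r ++ f) a)

  In-inv : ∀ {f r} → In f r → In (inv f) r
  In-inv {f} {r} p@(a , b) = a , Refl-cong
    (~-trans (solve (invo r (Refl-invol a) ◂ free f ◂ ⟨⟩) (v₀ ⊙ (v₀ ⊙ v₁) ⊙ v₀ ′) (v₀ ⊙ (v₀ ⊙ v₁ ⊙ v₀)) refl)
      (left-~ r (In-inverts p))) (Refl-◁ r b)

  In-inv⁻ : ∀ {f r} → In (inv f) r → In f r
  In-inv⁻ {f} p = In-cong (solve (free f ◂ ⟨⟩) (v₀ ′ ′) v₀ refl) ~-refl (In-inv p)

  In-◁ : ∀ w {f r} → In f r → In (w ◁ f) (w ◁ r)
  In-◁ w {f} {r} (a , b) = Refl-◁ w a , Refl-cong
    (solve (free w ◂ free r ◂ free f ◂ ⟨⟩) (v₀ ⊙ (v₁ ⊙ v₂) ⊙ v₀ ′) ((v₀ ⊙ v₁ ⊙ v₀ ′) ⊙ (v₀ ⊙ v₂ ⊙ v₀ ′)) refl) (Refl-◁ w b)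

  In-conj : ∀ w {f r} → In f r → In (conj w f) (conj w r)
  In-conj w {f} {r} p = In-cong (back f) (back r) (In-◁ (inv w) p)
    where
    back : ∀ t → inv w ◁ t ~ conj w t
    back t = solve (free w ◂ free t ◂ ⟨⟩) (v₀ ′ ⊙ v₁ ⊙ v₀ ′ ′) (v₀ ′ ⊙ v₁ ⊙ v₀) refl

  In-self : ∀ {f r t} → In f r → In f t → In f (r ◁ t)
  In-self {f} {r} {t} p q = In-inv⁻ (In-cong
    (~-trans (solve (invo r (Refl-invol (proj₁ p)) ◂ free f ◂ ⟨⟩) (v₀ ⊙ v₁ ⊙ v₀ ′) (v₀ ⊙ v₁ ⊙ v₀) refl) (In-inverts p))
    ~-refl (In-◁ r q))

  refl-◁ : ∀ {r} t → Refl r → r ◁ t ~ conj r t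
  refl-◁ {r} t p = solve (invo r (Refl-invol p) ◂ free t ◂ ⟨⟩) (v₀ ⊙ v₁ ⊙ v₀ ′) (v₀ ′ ⊙ v₁ ⊙ v₀) refl

  In-conj-self : ∀ {f r t} → In f r → In f t → In f (conj r t)
  In-conj-self {t = t} p q = In-cong ~-refl (refl-◁ t (proj₁ p)) (In-self p q)

  In-conj-f : ∀ {f t} → In f t → In f (conj f t)
  In-conj-f {f} {t} q = In-cong (conj-self f) ~-refl (In-conj f q)
    where conj-self : ∀ f → conj f f ~ f
          conj-self f = solve (free f ◂ ⟨⟩) (v₀ ′ ⊙ v₀ ⊙ v₀) v₀ refl

  ◁-inj : ∀ w {t t′} → w ◁ t ~ w ◁ t′ → t ~ t′
  ◁-inj w {t} {t′} e = ~-trans (~-sym (conj-◁ w t)) (~-trans (conj-cong (~-refl {w}) e) (conj-◁ w t′))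

  conj⇒◁ : ∀ w {t t′} → conj w t ~ t′ → t ~ w ◁ t′
  conj⇒◁ w {t} e = ~-trans (~-sym (◁-conj w t)) (◁-cong (~-refl {w}) e)

  ◁⇒conj : ∀ w {t t′} → t ~ w ◁ t′ → conj w t ~ t′
  ◁⇒conj w {t} {t′} e = ~-trans (conj-cong (~-refl {w}) e) (conj-◁ w t′)

  ◁-◁ : ∀ {r} t → Refl r → r ◁ (r ◁ t) ~ t
  ◁-◁ {r} t p = solve (invo r (Refl-invol p) ◂ free t ◂ ⟨⟩) (v₀ ⊙ (v₀ ⊙ v₁ ⊙ v₀ ′) ⊙ v₀ ′) v₁ refl

  ◁-id : ∀ r → r ◁ r ~ r
  ◁-id r = solve (free r ◂ ⟨⟩) (v₀ ⊙ v₀ ⊙ v₀ ′) v₀ refl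

  conj-id : ∀ r → conj r r ~ r
  conj-id r = solve (free r ◂ ⟨⟩) (v₀ ′ ⊙ v₀ ⊙ v₀) v₀ refl

  ◁-sym : ∀ {x z} → Refl x → Refl z → x ◁ z ~ z → z ◁ x ~ x
  ◁-sym {x} {z} a b e = begin
    z ++ x ++ inv z               ≈⟨ right-~ (x ++ inv z) (~-sym e) ⟩
    (x ◁ z) ++ x ++ inv z         ≈⟨ solve (invo x (Refl-invol a) ◂ invo z (Refl-invol b) ◂ ⟨⟩) ((v₀ ⊙ v₁ ⊙ v₀ ′) ⊙ v₀ ⊙ v₁ ′) v₀ refl ⟩
    x                             ∎

  -- x is a canonical generator of the reflection subgroup of the pencil.
  Canonical : Word → Word → Set
  Canonical f x = In f x × (∀ t → In f t → N x t → t ~ x)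

  Canonical-inv : ∀ {f x} → Canonical f x → Canonical (inv f) x
  Canonical-inv (a , b) = In-inv a , λ t p → b t (In-inv⁻ p)

  Canonical-N : ∀ {f x t} a → Canonical f x → In f t → Is a (t ~ x) → Is a (N x t)
  Canonical-N true  (p , c) q e = N-cong ~-refl (~-sym e) (N-self (proj₁ p))
  Canonical-N false (p , c) q ne = λ n → ne (c _ q n)

  Canonical-letter : ∀ {f s} → In f [ s ] → Canonical f [ s ]
  Canonical-letter p = p , λ t q n → ~-sym (N-letter⁻ n)

  module Dihedral {f x z : Word} (cx : Canonical f x) (cz : Canonical f z) (x≁z : ¬ (x ~ z)) where
    el : Bool → Word
    el true  = x
    el false = z

    c-el : ∀ c → Canonical f (el c)
    c-el true  = cx
    c-el false = cz

    Rel : ∀ c → Refl (el c)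
    Rel c = proj₁ (proj₁ (c-el c))

    dw : List Bool → Word
    dw []      = []
    dw (c ∷ l) = el c ++ dw l

    dw-++ : ∀ l m → dw (l ++ m) ~ dw l ++ dw m
    dw-++ []      m = ~-refl
    dw-++ (c ∷ l) m = ~-trans (left-~ (el c) (dw-++ l m)) (~-reflexive (sym (++-assoc (el c) _ _)))

    dw-snoc : ∀ l c → dw (l ++ [ c ]) ~ dw l ++ el c
    dw-snoc l c = ~-trans (dw-++ l [ c ]) (left-~ (dw l) (~-reflexive (++-identityʳ _)))

    cancel-el : ∀ c w → el c ++ el c ++ w ~ w
    cancel-el c w = tt-cancel w (Rel c)

    dw-inv : ∀ l → C (∃[ m ] inv (dw l) ~ dw m)
    dw-inv [] = return ([] , ~-refl)
    dw-inv (c ∷ l) = do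
      (m , e) ← dw-inv l
      return (m ++ [ c ] , ~-trans (solve (invo (el c) (Refl-invol (Rel c)) ◂ free (dw l) ◂ ⟨⟩) ((v₀ ⊙ v₁) ′) (v₁ ′ ⊙ v₀) refl)
        (~-trans (right-~ (el c) e) (~-sym (dw-snoc m c))))

    -- The proof of the exchange condition with `x` and `z` as generators: by canonicity the only
    -- inversion of `el c` in the pencil is `el c`.
    exchange-dw : ∀ l {t} → In f t → N (dw l) t → C (∃[ m ] (suc (length m) ≡ length l × t ++ dw l ~ dw m))
    exchange-dw [] {t} p n = impossible (N-[] t n)
    exchange-dw (c ∷ l) {t} p n = em (t ~ el c) >>= λ
      { (inj₁ e) → return (l , refl , ~-trans (right-~ (dw (c ∷ l)) e) (cancel-el c (dw l)))
      ; (inj₂ ne) → do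
          (m , eq , e) ← exchange-dw l (In-conj-self (proj₁ (c-el c)) p)
            (N-right (el c) (dw l) (Canonical-N false (c-el c) p ne) n)
          return (c ∷ m , cong suc eq , ~-trans
            (solve (invo (el c) (Refl-invol (Rel c)) ◂ free t ◂ free (dw l) ◂ ⟨⟩) (v₁ ⊙ v₀ ⊙ v₂) (v₀ ⊙ (v₀ ′ ⊙ v₁ ⊙ v₀) ⊙ v₂) refl)
            (left-~ (el c) e)) }

    -- Factorisation along the left cosets of the subgroup generated by x and z.
    record Factor (w : Word) : Set where
      field
        l  : List Bool
        w₀ : Word
        eq : w ~ dw l ++ w₀
        coset-min : ∀ t m → Refl t → t ~ dw m → ¬ N w₀ t
        word-min  : ∀ m → dw m ~ dw l → length l ≤ length m

    factor : ∀ w → C (Factor w)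
    factor w = do
      (n , (l , w₀ , e , len) , min) ← Len-total w >>= λ (n , len) → least (λ n → ∃[ l ] ∃[ w₀ ] (w ~ dw l ++ w₀ × Len w₀ n)) ([] , w , ~-refl , len)
      (k , (m , eq , e′) , min′) ← least (λ k → ∃[ m ] (length m ≡ k × dw m ~ dw l)) (l , refl , ~-refl)
      return record
        { l = m ; w₀ = w₀ ; eq = ~-trans e (right-~ w₀ (~-sym e′))
        ; coset-min = λ t p r q nt → run (do
            (b , len′) ← Len-total (t ++ w₀)
            return (ℕₚ.<⇒≱ (N⇒< nt len len′) (min b (l ++ p , t ++ w₀ ,
              ~-trans e (~-trans (left-~ (dw l) (~-sym (tt-cancel w₀ r)))
                (~-trans (left-~ (dw l) (right-~ (t ++ w₀) q)) (~-trans (~-reflexive (sym (++-assoc (dw l) _ _)))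
                  (right-~ (t ++ w₀) (~-sym (dw-++ l p)))))) , len′))))
        ; word-min = λ p q → subst (_≤ length p) (sym eq) (min′ (length p) (p , refl , ~-trans q e′)) }

    module Fac {w} (F : Factor w) where
      open Factor F public

      -- Conjugation by `dw l` keeps a reflection of the dihedral group in that group, where `w₀`
      -- has no inversions. So only `dw l` contributes.
      N-word : ∀ {t m} a → Refl t → t ~ dw m → Is a (N w t) → Is a (N (dw l) t)
      N-word {t} {m} a r e n = N-value a λ b nb → Is-unique {N w t} b a
        (Is-cong b (~-sym eq) ~-refl (subst (λ c → Is c (N (dw l ++ w₀) t)) (Boolₚ.xor-identityʳ b)
          (N-++ (dw l) w₀ b false nb λ k → run (do
            (l′ , e′) ← dw-inv l
            return (coset-min (conj (dw l) t) (l′ ++ m ++ l) (Refl-conj (dw l) r)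
              (~-trans (~-++ e′ (right-~ (dw l) e)) (~-trans (left-~ (dw l′) (~-sym (dw-++ m l))) (~-sym (dw-++ l′ (m ++ l))))) k))))) n

      N-first : ∀ {c m} → l ≡ c ∷ m → N (dw l) (el c)
      N-first {c} {m} eq = subst (λ l → N (dw l) (el c)) (sym eq) (N-++ (el c) (dw m) true false (N-self (Rel c)) λ n → run (do
        (m′ , e , q) ← exchange-dw m (proj₁ (c-el c)) (N-cong ~-refl (conj-id (el c)) n)
        return (ℕₚ.<⇒≱ (s≤s (ℕₚ.≤-trans (ℕₚ.n≤1+n _) (ℕₚ.≤-reflexive e)))
          (subst (λ l → length l ≤ length m′) eq (word-min m′ (~-trans (~-sym q) (~-reflexive (cong dw (sym eq)))))))))

    el-word : ∀ c → el c ~ dw [ c ]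
    el-word c = ~-reflexive (sym (++-identityʳ (el c)))

    ◁-word : ∀ c d → el c ◁ el d ~ dw (c ∷ d ∷ c ∷ [])
    ◁-word c d = ~-trans (solve (invo (el c) (Refl-invol (Rel c)) ◂ free (el d) ◂ ⟨⟩) (v₀ ⊙ v₁ ⊙ v₀ ′) (v₀ ⊙ v₁ ⊙ v₀ ⊙ (v₀ ⊙ v₀)) refl)
      (left-~ (el c) (left-~ (el d) (left-~ (el c) (Refl-invol (Rel c)))))

    -- If the dihedral part of `w` were nonempty, the first letter of its shortest word would be an
    -- inversion of `w`. Hence that part is trivial.
    both-up : ∀ w → ¬ N w x → ¬ N w z → ¬ N w (x ◁ z)
    both-up w nx nz n = run (factor w >>= λ F → return (go F (Factor.l F) refl))
      where
      none : ∀ c → ¬ N w (el c)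
      none true  = nx
      none false = nz
      go : (F : Factor w) → ∀ l → Factor.l F ≡ l → ⊥
      go F (c ∷ m) eq = Fac.N-word F {m = [ c ]} false (Rel c) (el-word c) (none c) (Fac.N-first F eq)
      go F [] eq = N-[] (x ◁ z) (subst (λ l → N (dw l) (x ◁ z)) eq
        (Fac.N-word F {m = true ∷ false ∷ true ∷ []} true (Refl-◁ x (Rel false)) (◁-word true false) n))

    x◁z≁x : ¬ (x ◁ z ~ x)
    x◁z≁x e = x≁z (~-sym (◁-inj x (~-trans e (~-sym (◁-id x)))))

    -- If `x ◁ z` were not an inversion of `w`, then neither `x` nor `z` would be an inversion of
    -- `x ++ w`, but `x ◁ z` would, against `both-up`.
    both-down : ∀ w → N w x → N w z → N w (x ◁ z)
    both-down w nx nz = N-join λ n → both-up (x ++ w)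
      (N-t· (Rel true) true nx)
      (N-++ x w false false (Canonical-N false cx (proj₁ cz) (x≁z ∘ ~-sym)) (n ∘ N-cong ~-refl (~-sym (refl-◁ z (Rel true)))))
      (N-++ x w false true (Canonical-N false cx (In-self (proj₁ cx) (proj₁ cz)) x◁z≁x) (N-cong ~-refl (~-sym (conj-◁ x z)) nz))

    altB : Bool → ℕ → List Bool
    altB c zero    = []
    altB c (suc n) = c ∷ altB (not c) n

    odd : ℕ → Bool
    odd zero    = false
    odd (suc n) = not (odd n)

    altB-snoc : ∀ c n → altB c (suc n) ≡ altB c n ++ [ odd n xor c ]
    altB-snoc c zero    = refl
    altB-snoc c (suc n) = cong (c ∷_) (trans (altB-snoc (not c) n) (cong (λ d → altB (not c) n ++ [ d ]) (flip (odd n) c)))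
      where
      flip : ∀ a c → a xor not c ≡ not a xor c
      flip true  c = not-involutive c
      flip false c = refl

    Shortest : List Bool → Set
    Shortest p = ∀ m → dw m ~ dw p → length p ≤ length m

    Shortest-tail : ∀ {c p} → Shortest (c ∷ p) → Shortest p
    Shortest-tail {c} s m e = s≤s⁻¹ (s (c ∷ m) (left-~ (el c) e))

    Shortest-alt : ∀ {c p} → Shortest (c ∷ p) → c ∷ p ≡ altB c (suc (length p))
    Shortest-alt {c} {[]} s = refl
    Shortest-alt {c} {d ∷ p} s with c Boolₚ.≟ d
    ... | yes refl = ⊥-elim (ℕₚ.<⇒≱ (ℕₚ.n<1+n _) (ℕₚ.≤-trans (s p (~-sym (cancel-el c (dw p)))) (ℕₚ.n≤1+n _)))
    ... | no c≢d with Shortest-alt {d} {p} (Shortest-tail {c} {d ∷ p} s)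
    ...   | eq = cong (c ∷_) (trans eq (cong (λ b → altB b (suc (length p))) (Boolₚ.¬-not (c≢d ∘ sym))))

    even : ∀ i → odd (i + i) ≡ false
    even zero    = refl
    even (suc i) = trans (cong (not ∘ odd) (ℕₚ.+-suc i i)) (trans (not-involutive _) (even i))

    In-dw-odd : ∀ c i → In f (dw (altB c (suc (i + i))))
    In-dw-odd c zero = In-cong ~-refl (el-word c) (proj₁ (c-el c))
    In-dw-odd c (suc i) = In-cong ~-refl
      (~-trans (~-trans (refl-◁′ (dw (altB (not c) (suc (i + i))))) (left-~ (el c) (~-sym (dw-snoc (altB (not c) (suc (i + i))) c))))
        (~-reflexive (cong (λ l → dw (c ∷ l)) (trans (cong (λ d → altB (not c) (suc (i + i)) ++ [ d ]) (last i))
          (trans (sym (altB-snoc (not c) (suc (i + i)))) (cong (λ n → altB (not c) (suc n)) (sym (ℕₚ.+-suc i i))))))))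
      (In-self (proj₁ (c-el c)) (In-dw-odd (not c) i))
      where
      refl-◁′ : ∀ t → el c ◁ t ~ el c ++ t ++ el c
      refl-◁′ t = solve (invo (el c) (Refl-invol (Rel c)) ◂ free t ◂ ⟨⟩) (v₀ ⊙ v₁ ⊙ v₀ ′) (v₀ ⊙ v₁ ⊙ v₀) refl
      last : ∀ i → c ≡ odd (suc (i + i)) xor not c
      last i rewrite even i = sym (not-involutive c)

    half : ∀ n → (∃[ i ] n ≡ i + i) ⊎ (∃[ i ] n ≡ suc (i + i))
    half zero = inj₁ (0 , refl)
    half (suc n) with half n
    ... | inj₁ (i , eq) = inj₂ (i , cong suc eq)
    ... | inj₂ (i , eq) = inj₁ (suc i , trans (cong suc eq) (cong suc (sym (ℕₚ.+-suc i i))))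

    -- The longest element v of the dihedral group either commutes with the
    -- generators, and then x v is in the pencil, or it exchanges them.
    longest : ∀ p → Shortest p → N (dw p) x → N (dw p) z →
      C ((In f (x ++ dw p) × dw p ++ x ~ x ++ dw p) ⊎ (In f (dw p) × dw p ++ x ~ z ++ dw p × dw p ++ z ~ x ++ dw p))
    longest [] _ nx _ = impossible (N-[] x nx)
    longest (c ∷ p) s nx nz = do
        -- The letter `d` is an inversion too, so `v` has a second shortest word, which begins with
        -- `d`. Both words alternate; comparing the last letter of one with the first letter of the
        -- other gives the two cases, according to the parity of the length.
        (m , e , q) ← exchange-dw (c ∷ p) (proj₁ (c-el d)) (inversion d)
        let s′ : Shortest (d ∷ m)
            s′ = λ k r → subst (_≤ length k) (sym e) (s k (~-trans r (flip-eq m q)))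
            other : v ~ dw (altB d n)
            other = ~-trans (~-sym (flip-eq m q)) (~-reflexive (cong dw (trans (Shortest-alt {d} {m} s′) (cong (altB d) e))))
        return (conclude other (half (length p)))
      where
      d = not c
      n = suc (length p)
      v = dw (c ∷ p)
      inversion : ∀ c → N v (el c)
      inversion true  = nx
      inversion false = nz
      flip-eq : ∀ m → el d ++ v ~ dw m → dw (d ∷ m) ~ v
      flip-eq m q = ~-trans (left-~ (el d) (~-sym q)) (cancel-el d v)
      v-alt : v ~ dw (altB c n)
      v-alt = ~-reflexive (cong dw (Shortest-alt {c} {p} s))
      strip : ∀ b e → v ~ dw (altB b n) → odd (length p) xor b ≡ e → v ++ el e ~ dw (altB b (length p))
      strip b e q r = ~-trans (right-~ (el e) (~-trans q (~-trans (~-reflexive (cong dw (trans (altB-snoc b (length p)) (cong (λ e → altB b (length p) ++ [ e ]) r)))) (dw-snoc (altB b (length p)) e))))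
        (solve (free (dw (altB b (length p))) ◂ invo (el e) (Refl-invol (Rel e)) ◂ ⟨⟩) ((v₀ ⊙ v₁) ⊙ v₁) v₀ refl)
      unhead : ∀ b → v ~ dw (altB b n) → el b ++ v ~ dw (altB (not b) (length p))
      unhead b q = ~-trans (left-~ (el b) q) (cancel-el b _)
      conclude : v ~ dw (altB d n) → (∃[ i ] length p ≡ i + i) ⊎ (∃[ i ] length p ≡ suc (i + i)) →
        (In f (x ++ v) × v ++ x ~ x ++ v) ⊎ (In f v × v ++ x ~ z ++ v × v ++ z ~ x ++ v)
      conclude other (inj₁ (i , len)) = inj₂ (In-cong ~-refl (~-trans (~-reflexive (cong (λ k → dw (altB c (suc k))) (sym len))) (~-sym v-alt)) (In-dw-odd c i) , swaps)
        where
        o : odd (length p) ≡ false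
        o = trans (cong odd len) (even i)
        back : altB (not d) (length p) ≡ altB c (length p)
        back = cong (λ b → altB b (length p)) (not-involutive c)
        s₁ : v ++ el c ~ el d ++ v
        s₁ = ~-trans (strip c c v-alt (cong (_xor c) o)) (~-sym (~-trans (unhead d other) (~-reflexive (cong dw back))))
        s₂ : v ++ el d ~ el c ++ v
        s₂ = ~-trans (strip d d other (cong (_xor d) o)) (~-sym (unhead c v-alt))
        pick : ∀ b → v ++ el b ~ el (not b) ++ v → v ++ el (not b) ~ el b ++ v → v ++ x ~ z ++ v × v ++ z ~ x ++ v
        pick true  a b = a , b
        pick false a b = b , a
        swaps : v ++ x ~ z ++ v × v ++ z ~ x ++ v
        swaps = pick c s₁ s₂
      conclude other (inj₂ (i , len)) = inj₁ commuting
        where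
        o : odd (length p) ≡ true
        o = trans (cong odd len) (cong not (even i))
        v-all : ∀ b → v ~ dw (altB b n)
        v-all b with b Boolₚ.≟ c
        ... | yes refl = v-alt
        ... | no b≢c = subst (λ b → v ~ dw (altB b n)) (sym (Boolₚ.¬-not b≢c)) other
        commuting : In f (x ++ v) × v ++ x ~ x ++ v
        commuting = In-cong ~-refl (~-trans (~-reflexive (cong (λ k → dw (altB false k)) (sym len))) (~-sym (unhead true (v-all true)))) (In-dw-odd false i)
          , ~-trans (strip false true (v-all false) (cong (_xor false) o)) (~-sym (unhead true (v-all true)))

  -- A reduced word of g = z u x crosses the reflection z u z, so for some prefix q the element D = z q has a letter σ
  -- with u D = D σ.  But x is an inversion of u D, and not of D σ.
  no-swap : ∀ {f x z u} → Canonical f x → Canonical f z → ¬ (x ~ z) → In f u → ¬ (u ~ x) → ¬ (u ~ z) →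
    u ◁ x ~ z → ¬ N u x → ¬ N u z → ⊥
  no-swap {f} {x} {z} {u} cx cz x≁z iu u≁x u≁z swap nx nz = run (do
      (n , len) ← Len-total g
      let (p , e , _ , red) = reduced len
      np ← N-cong {g} {p} {z ◁ u} {z ◁ u} (~-sym (return e)) ~-refl N-g-zuz
      (q , σ , q′ , eq , τ) ← position p np
      return (contra p (return e) red q σ q′ eq τ))
    where
    g = z ++ u ++ x
    Rx = proj₁ (proj₁ cx)
    Rz = proj₁ (proj₁ cz)
    Ru = proj₁ iu
    swap′ : u ◁ z ~ x
    swap′ = ~-trans (◁-cong (~-refl {u}) (~-sym swap)) (◁-◁ x Ru)
    conj-ux : conj u x ~ z
    conj-ux = ~-trans (~-sym (refl-◁ x Ru)) swap
    conj-uz : conj u z ~ x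
    conj-uz = ~-trans (~-sym (refl-◁ z Ru)) swap′
    conj-zz : conj z (z ◁ u) ~ u
    conj-zz = conj-◁ z u
    z◁≁z : ∀ {t} → ¬ (t ~ z) → ¬ (z ◁ t ~ z)
    z◁≁z ne e = ne (◁-inj z (~-trans e (~-sym (◁-id z))))
    N-g-zuz : N g (z ◁ u)
    N-g-zuz = N-++ z (u ++ x) false true
      (Canonical-N false cz (In-self (proj₁ cz) iu) (z◁≁z u≁z))
      (N-++ u x true false (N-cong ~-refl (~-sym conj-zz) (N-self Ru))
        (λ n → Canonical-N false cx iu u≁x (N-cong ~-refl (~-trans (conj-cong (~-refl {u}) conj-zz) (conj-id u)) n)))
    ¬N-g-zx : ¬ N g (z ◁ x)
    ¬N-g-zx = N-++ z (u ++ x) false false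
      (Canonical-N false cz (In-self (proj₁ cz) (proj₁ cx)) (z◁≁z x≁z))
      (N-++ u x false false (λ n → nx (N-cong ~-refl (conj-◁ z x) n))
        (λ n → Canonical-N false cx (proj₁ cz) (x≁z ∘ ~-sym) (N-cong ~-refl (~-trans (conj-cong (~-refl {u}) (conj-◁ z x)) conj-ux) n)))
    ¬N-g-z : ¬ N g z
    ¬N-g-z = N-++ z (u ++ x) true true (N-self Rz)
      (N-++ u x false true (λ n → nz (N-cong ~-refl (conj-id z) n))
        (N-cong ~-refl (~-sym (~-trans (conj-cong (~-refl {u}) (conj-id z)) conj-uz)) (N-self Rx)))
    contra : ∀ p → p ~ g → Red p → ∀ q σ q′ → p ≡ q ++ σ ∷ q′ → z ◁ u ~ q ◁ [ σ ] → ⊥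
    contra p e red q σ q′ eq τ = N-D-u (N-cong cross ~-refl N-uD-x)
      where
      prefix : ∀ {t} → Refl t → N q t → N g t
      prefix {t} r n = N-cong e ~-refl (subst (λ p → N p t) (sym eq) (N-prefix q (σ ∷ q′) (subst Red eq red) r n))
      N-D-x : ¬ N (z ++ q) x
      N-D-x = N-++ z q false false (Canonical-N false cz (proj₁ cx) x≁z)
        (λ n → ¬N-g-zx (prefix (Refl-◁ z Rx) (N-cong ~-refl (~-sym (refl-◁ x Rz)) n)))
      N-D-z : N (z ++ q) z
      N-D-z = N-++ z q true false (N-self Rz) (λ n → ¬N-g-z (prefix Rz (N-cong ~-refl (conj-id z) n)))
      D-σ : (z ++ q) ◁ [ σ ] ~ u
      D-σ = ~-trans (solve (free z ◂ free q ◂ free [ σ ] ◂ ⟨⟩) ((v₀ ⊙ v₁) ⊙ v₂ ⊙ (v₀ ⊙ v₁) ′) (v₀ ⊙ (v₁ ⊙ v₂ ⊙ v₁ ′) ⊙ v₀ ′) refl)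
        (~-trans (◁-cong (~-refl {z}) (~-sym τ)) (◁-◁ u Rz))
      cross : u ++ z ++ q ~ (z ++ q) ++ [ σ ]
      cross = ~-trans (right-~ (z ++ q) (~-sym D-σ))
        (solve (free (z ++ q) ◂ free [ σ ] ◂ ⟨⟩) ((v₀ ⊙ v₁ ⊙ v₀ ′) ⊙ v₀) (v₀ ⊙ v₁) refl)
      N-D-u : ¬ N ((z ++ q) ++ [ σ ]) x
      N-D-u = N-++ (z ++ q) [ σ ] false false N-D-x
        (λ n → u≁x (~-sym (~-trans (conj⇒◁ (z ++ q) (~-sym (N-letter⁻ n))) D-σ)))
      N-uD-x : N (u ++ z ++ q) x
      N-uD-x = N-++ u (z ++ q) false true nx (N-cong ~-refl (~-sym conj-ux) N-D-z)

  In-commute : ∀ {f r} → In f r → f ++ r ~ r ++ inv f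
  In-commute {f} {r} p = ~-trans (solve (invo r (Refl-invol (proj₁ p)) ◂ free f ◂ ⟨⟩) (v₁ ⊙ v₀) (v₀ ⊙ v₀ ⊙ v₁ ⊙ v₀) refl)
    (left-~ r (In-inverts p))

  -- The cocycle property for `f⁻¹ = x f x`, where each factor `x` contributes only at `x` itself.
  N-inverse : ∀ {f x t} a b c → Canonical f x → In f t → Is a (t ~ x) → Is b (N f (x ◁ t)) → Is c (x ◁ t ~ f ◁ x) →
    Is (a xor (b xor c)) (N (inv f) t)
  N-inverse {f} {x} {t} a b c cx it p q r = Is-cong (a xor (b xor c)) (In-inverts (proj₁ cx)) ~-refl
    (N-++ x (f ++ x) a (b xor c) (Canonical-N a cx it p)
      (N-++ f x b c (Is-cong b ~-refl (refl-◁ t (proj₁ (proj₁ cx))) q)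
        (Canonical-N c cx (In-conj-f (In-conj-self (proj₁ cx) it))
          (Is-map c (λ e → ◁⇒conj f (~-trans (~-sym (refl-◁ t Rx)) e)) (λ e → ~-trans (refl-◁ t Rx) (conj⇒◁ f e)) r))))
    where Rx = proj₁ (proj₁ cx)

  -- Evaluating `f⁻¹ = x f x` at `z` and at `x ◁ z` forces `x ◁ z = z = f ◁ x`. So `x` and `z`
  -- commute, `f² = z x` and `f⁴ = 1`. Then `y`, which inverts `f`, commutes with `f²`, and
  -- `f = z x f⁻¹` makes `y` an inversion of both or neither of `f` and `f⁻¹`. But `f⁻¹ = y f y`
  -- makes it an inversion of exactly one of them.
  two-inversions : ∀ {f x z y} → Canonical f x → Canonical f z → Canonical f y → ¬ (x ~ z) → ¬ (x ~ y) → ¬ (z ~ y) →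
    ¬ (y ~ f ◁ y) → N f x → N f z → ¬ N (inv f) x → ¬ N (inv f) z → ⊥
  two-inversions {f} {x} {z} {y} cx cz cy x≁z x≁y z≁y y-moves nx nz nx′ nz′ = run (do
      inj₁ e₁ ← em (x ◁ z ~ f ◁ x)
        where inj₂ ne → impossible (nz′ (N-inverse false true false cx iz (x≁z ∘ ~-sym) n-xz ne))
      inj₁ e₂ ← em (x ◁ (x ◁ z) ~ f ◁ x)
        where inj₂ ne → impossible (n′-xz (N-inverse false true false cx (In-self ix iz) Di.x◁z≁x
                (N-cong ~-refl (~-sym (◁-◁ z Rx)) nz) ne))
      (b , nb) ← Is-total (N f y)
      return (finish e₁ e₂ b nb))
    where
    module Di = Dihedral cx cz x≁z
    ix = proj₁ cx
    iz = proj₁ cz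
    iy = proj₁ cy
    Rx = proj₁ ix
    Rz = proj₁ iz
    n-xz : N f (x ◁ z)
    n-xz = Di.both-down f nx nz
    n′-xz : ¬ N (inv f) (x ◁ z)
    n′-xz = Di.both-up (inv f) nx′ nz′
    finish : x ◁ z ~ f ◁ x → x ◁ (x ◁ z) ~ f ◁ x → ∀ b → Is b (N f y) → ⊥
    finish e₁ e₂ b nb = same b nb (value b nb)
      where
      z~fx : z ~ f ◁ x
      z~fx = ~-trans (~-sym (◁-◁ z Rx)) e₂
      xz~z : x ◁ z ~ z
      xz~z = ~-trans e₁ (~-sym z~fx)
      zx~x : z ◁ x ~ x
      zx~x = ◁-sym Rx Rz xz~z
      f-eq : f ~ z ++ x ++ inv f
      f-eq = begin
        f                              ≈⟨ solve (free f ◂ invo x (Refl-invol Rx) ◂ ⟨⟩) v₀ ((v₀ ⊙ v₁ ⊙ v₀ ′) ⊙ v₀ ⊙ v₁) refl ⟩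
        (f ◁ x) ++ f ++ x              ≈⟨ ~-++ (~-sym z~fx) (In-commute ix) ⟩
        z ++ x ++ inv f                ∎
      zx~ff : z ++ x ~ f ++ f
      zx~ff = ~-trans (solve (free z ◂ free x ◂ free f ◂ ⟨⟩) (v₀ ⊙ v₁) ((v₀ ⊙ v₁ ⊙ v₂ ′) ⊙ v₂) refl) (right-~ f (~-sym f-eq))
      f⁴ : (f ++ f) ++ (f ++ f) ~ []
      f⁴ = ~-trans (~-++ (~-sym zx~ff) (~-sym zx~ff)) (~-trans (solve (free z ◂ free x ◂ ⟨⟩) ((v₀ ⊙ v₁) ⊙ (v₀ ⊙ v₁)) ((v₀ ⊙ v₁ ⊙ v₀ ′) ⊙ v₀ ⊙ v₀ ⊙ v₁) refl)
        (~-trans (right-~ (z ++ z ++ x) zx~x) (~-trans (solve (invo x (Refl-invol Rx) ◂ invo z (Refl-invol Rz) ◂ ⟨⟩) (v₀ ⊙ v₁ ⊙ v₁ ⊙ v₀) (v₀ ⊙ v₀) refl) (Refl-invol Rx))))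
      -- y inverts f, and f⁴ = 1
      y-comm : (f ++ f) ◁ y ~ y
      y-comm = begin
        (f ++ f) ++ y ++ inv (f ++ f)                ≈⟨ solve (free f ◂ free y ◂ ⟨⟩) ((v₀ ⊙ v₀) ⊙ v₁ ⊙ (v₀ ⊙ v₀) ′) (v₀ ⊙ (v₀ ⊙ v₁) ⊙ (v₀ ⊙ v₀) ′) refl ⟩
        f ++ (f ++ y) ++ inv (f ++ f)                ≈⟨ left-~ f (right-~ (inv (f ++ f)) (In-commute iy)) ⟩
        f ++ (y ++ inv f) ++ inv (f ++ f)            ≈⟨ solve (free f ◂ free y ◂ ⟨⟩) (v₀ ⊙ (v₁ ⊙ v₀ ′) ⊙ (v₀ ⊙ v₀) ′) ((v₀ ⊙ v₁) ⊙ v₀ ′ ⊙ (v₀ ⊙ v₀) ′) refl ⟩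
        (f ++ y) ++ inv f ++ inv (f ++ f)            ≈⟨ right-~ (inv f ++ inv (f ++ f)) (In-commute iy) ⟩
        (y ++ inv f) ++ inv f ++ inv (f ++ f)        ≈⟨ solve (free f ◂ free y ◂ ⟨⟩) ((v₁ ⊙ v₀ ′) ⊙ v₀ ′ ⊙ (v₀ ⊙ v₀) ′) (v₁ ⊙ ((v₀ ⊙ v₀) ⊙ (v₀ ⊙ v₀)) ′) refl ⟩
        y ++ inv ((f ++ f) ++ (f ++ f))              ≈⟨ left-~ y (inv-cong f⁴) ⟩
        y ++ []                                      ≈⟨ ~-reflexive (++-identityʳ y) ⟩
        y                                            ∎
      zy≁x : ¬ (conj z y ~ x)
      zy≁x e = x≁y (~-sym (~-trans (conj⇒◁ z e) zx~x))
      conj-zx : conj x (conj z y) ~ y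
      conj-zx = ~-trans (solve (free x ◂ free z ◂ free y ◂ ⟨⟩) (v₀ ′ ⊙ (v₁ ′ ⊙ v₂ ⊙ v₁) ⊙ v₀) ((v₁ ⊙ v₀) ′ ⊙ v₂ ⊙ (v₁ ⊙ v₀)) refl)
        (~-trans (conj-cong zx~ff (~-refl {y})) (◁⇒conj (f ++ f) (~-sym y-comm)))
      value : ∀ b → Is b (N f y) → Is b (N (inv f) y)
      value b nb = N-value b λ c nc → Is-unique {N f y} c b
        (Is-cong c (~-sym f-eq) ~-refl (N-++ z (x ++ inv f) false c (Canonical-N false cz iy (z≁y ∘ ~-sym))
          (N-++ x (inv f) false c (Canonical-N false cx (In-conj-self iz iy) zy≁x) (Is-cong c ~-refl (~-sym conj-zx) nc)))) nb
      same : ∀ b → Is b (N f y) → Is b (N (inv f) y) → ⊥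
      same b nb nb′ = Is-unique {N (inv f) y} b (not b) nb′ (subst (λ c → Is c (N (inv f) y)) (cong not (Boolₚ.xor-identityʳ b))
        (N-inverse true b false cy iy (~-refl {y}) (Is-cong b ~-refl (~-sym (◁-id y)) nb) (y-moves ∘ ~-trans (~-sym (◁-id y))))) (absurd b)
        where
        absurd : ∀ b → b ≡ not b → ⊥
        absurd true  ()
        absurd false ()

  -- An involution f is central in the group generated by its pencil.
  module Involution {f} (ff : f ++ f ~ []) (f≁1 : ¬ (f ~ [])) where
    f-inv : inv f ~ f
    f-inv = ~-trans (solve (free f ◂ ⟨⟩) (v₀ ′) (v₀ ⊙ (v₀ ⊙ v₀) ′) refl) (~-trans (left-~ f (inv-cong ff)) (~-reflexive (++-identityʳ f)))

    comm : ∀ {r} → In f r → f ++ r ~ r ++ f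
    comm {r} p = ~-trans (In-commute p) (left-~ r f-inv)

    commutes-mul : ∀ {x y} → In f x → In f y → x ◁ y ~ y → (x ++ f) ◁ y ~ y
    commutes-mul {x} {y} ix iy e = ~-trans
      (solve (free x ◂ free f ◂ free y ◂ ⟨⟩) ((v₀ ⊙ v₁) ⊙ v₂ ⊙ (v₀ ⊙ v₁) ′) (v₀ ⊙ ((v₁ ⊙ v₂) ⊙ v₁ ′) ⊙ v₀ ′) refl)
      (~-trans (left-~ x (right-~ (inv x) (right-~ (inv f) (comm iy))))
        (~-trans (solve (free x ◂ free f ◂ free y ◂ ⟨⟩) (v₀ ⊙ ((v₂ ⊙ v₁) ⊙ v₁ ′) ⊙ v₀ ′) (v₀ ⊙ v₂ ⊙ v₀ ′) refl) e))

    -- Write `f = x (xf)`: the reflection `xf` commutes with `x` and differs from it, so by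
    -- `N-commute` it does not have `x` as an inversion.
    N-canonical : ∀ {x} → Canonical f x → N f x
    N-canonical {x} cx = N-cong (tt-cancel f Rx) ~-refl
        (N-++ x (x ++ f) true false (N-self Rx) λ n →
          N-commute (proj₂ ix) (commutes-mul ix ix (◁-id x)) x≁xf (N-cong ~-refl (conj-id x) n))
      where
      ix = proj₁ cx
      Rx = proj₁ ix
      x≁xf : ¬ (x ~ x ++ f)
      x≁xf e = f≁1 (~-trans (~-sym (tt-cancel f Rx)) (~-trans (left-~ x (~-sym e)) (Refl-invol Rx)))

    commuting : ∀ {x y} → Canonical f x → In f y → ¬ (y ~ x) → x ◁ y ~ y → N f y → y ~ x ++ f
    commuting {x} {y} cx iy y≁x e n = ~-join λ ne → N-commute (proj₂ ix) (commutes-mul ix iy e) ne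
        (N-++ x f false true (Canonical-N false cx iy y≁x) (N-cong ~-refl (~-sym (~-trans (~-sym (refl-◁ y (proj₁ ix))) e)) n))
      where ix = proj₁ cx

    f-eq : ∀ {x y} → Refl x → y ~ x ++ f → f ~ x ++ y
    f-eq {x} r e = ~-trans (~-sym (tt-cancel f r)) (left-~ x (~-sym e))

    -- If `x` and `z` commute, then `f = x z`, which does not have `y` as an inversion. In general
    -- the part `v` of `f` in `⟨x,z⟩` has both `x` and `z` as inversions and is a longest element.
    -- If it commutes with `x`, then `f = v`, so exchange puts `y` into `⟨x,z⟩`, against `not-word`.
    -- If it swaps `x` and `z`, so does `u = v f`, since `f` is central, and `no-swap` applies.
    three : ∀ {x z y} → Canonical f x → Canonical f z → Canonical f y → ¬ (x ~ z) → ¬ (x ~ y) → ¬ (z ~ y) → ⊥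
    three {x} {z} {y} cx cz cy x≁z x≁y z≁y = run (do
        F ← factor f
        inj₂ ne ← em (x ◁ z ~ z)
          where inj₁ e → return (orthogonal e)
        cases ← longest (Factor.l F) (λ m e → Factor.word-min F m e)
                  (Fac.N-word F {m = [ true ]} true (Rel true) (el-word true) (N-canonical cx))
                  (Fac.N-word F {m = [ false ]} true (Rel false) (el-word false) (N-canonical cz))
        return (conclude F cases))
      where
      open Dihedral cx cz x≁z
      ix = proj₁ cx
      iz = proj₁ cz
      iy = proj₁ cy
      Rx = proj₁ ix
      orthogonal : x ◁ z ~ z → ⊥
      orthogonal e = N-++ x z false false (Canonical-N false cx iy (x≁y ∘ ~-sym))
          (Canonical-N false cz (In-conj-self ix iy) (λ q → z≁y (~-trans (~-sym e) (~-sym (conj⇒◁ x q)))))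
          (N-cong (f-eq Rx (commuting cx iz (x≁z ∘ ~-sym) e (N-canonical cz))) ~-refl (N-canonical cy))
      -- The first letter of a shortest word for `y` is an inversion of `y`, and by canonicity of
      -- `y` it would equal `y`.
      not-word : ∀ l → ¬ (y ~ dw l)
      not-word l e = run (do
          (k , (p , len , q) , min) ← least (λ k → ∃[ p ] (length p ≡ k × y ~ dw p)) (l , refl , e)
          go p q (λ m r → subst (_≤ length m) (sym len) (min (length m) (m , refl , r))))
        where
        go : ∀ p → y ~ dw p → (∀ m → y ~ dw m → length p ≤ length m) → C ⊥
        go [] q min = return (N-[] y (N-cong q ~-refl (N-self (proj₁ iy))))
        go (c ∷ p) q min = em (N (dw p) (el c)) >>= λ
          { (inj₁ n) → do
              (m , len , r) ← exchange-dw p (proj₁ (c-el c)) n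
              return (ℕₚ.<⇒≱ (s≤s (ℕₚ.≤-trans (ℕₚ.n≤1+n _) (ℕₚ.≤-reflexive len))) (min m (~-trans q r)))
          ; (inj₂ nn) → return (el≁y c (proj₂ cy (el c) (proj₁ (c-el c))
              (N-cong (~-sym q) ~-refl (N-++ (el c) (dw p) true false (N-self (Rel c)) (nn ∘ N-cong ~-refl (conj-id (el c))))))) }
          where
          el≁y : ∀ c → ¬ (el c ~ y)
          el≁y true  = x≁y
          el≁y false = z≁y
      conclude : (F : Factor f) →
        (In f (x ++ dw (Factor.l F)) × dw (Factor.l F) ++ x ~ x ++ dw (Factor.l F)) ⊎
        (In f (dw (Factor.l F)) × dw (Factor.l F) ++ x ~ z ++ dw (Factor.l F) × dw (Factor.l F) ++ z ~ x ++ dw (Factor.l F)) → ⊥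
      conclude F (inj₁ (ix* , vx)) = run (do
          (m , _ , e) ← exchange-dw l iy (N-cong (~-trans f~ (tt-cancel v Rx)) ~-refl (N-canonical cy))
          (l′ , e′) ← dw-inv l
          return (not-word (m ++ l′) (~-trans (solve (free y ◂ free v ◂ ⟨⟩) v₀ ((v₀ ⊙ v₁) ⊙ v₁ ′) refl)
            (~-trans (~-++ e e′) (~-sym (dw-++ m l′))))))
        where
        open Fac F
        v = dw l
        x* = x ++ v
        n-vx : N v x
        n-vx = N-word {m = [ true ]} true Rx (el-word true) (N-canonical cx)
        x*≁x : ¬ (x* ~ x)
        x*≁x e = N-[] x (N-cong (~-trans (~-sym (tt-cancel v Rx)) (~-trans (left-~ x e) (Refl-invol Rx))) ~-refl n-vx)
        conj-x : conj x x* ~ x*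
        conj-x = ~-trans (solve (invo x (Refl-invol Rx) ◂ free v ◂ ⟨⟩) (v₀ ′ ⊙ (v₀ ⊙ v₁) ⊙ v₀) (v₁ ⊙ v₀) refl) vx
        conj-v : conj v x* ~ x*
        conj-v = ~-trans (left-~ (inv v) (right-~ v (~-sym vx))) (solve (free x ◂ free v ◂ ⟨⟩) (v₁ ′ ⊙ (v₁ ⊙ v₀) ⊙ v₁) (v₀ ⊙ v₁) refl)
        n-v : N v x*
        n-v = N-cong (tt-cancel v Rx) ~-refl (N-++ x x* false true (Canonical-N false cx ix* x*≁x)
                (N-cong ~-refl (~-sym conj-x) (N-self (proj₁ ix*))))
        n-f : N f x*
        n-f = N-cong (~-sym eq) ~-refl (N-++ v w₀ true false n-v
                (λ n → coset-min x* (true ∷ l) (proj₁ ix*) ~-refl (N-cong ~-refl conj-v n)))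
        f~ : f ~ x ++ x*
        f~ = f-eq Rx (commuting cx ix* x*≁x (~-trans (refl-◁ x* Rx) conj-x) n-f)
      conclude F (inj₂ (iv , vx , vz)) = no-swap cx cz x≁z iu (u≁ true) (u≁ false) swap (n-u true) (n-u false)
        where
        open Fac F
        v = dw l
        u = v ++ f
        iu : In f u
        iu = In-mul iv
        u~w₀ : u ~ w₀
        u~w₀ = ~-trans (left-~ v eq) (tt-cancel w₀ (proj₁ iv))
        n-u : ∀ c → ¬ N u (el c)
        n-u c n = coset-min (el c) [ c ] (Rel c) (el-word c) (N-cong u~w₀ ~-refl n)
        u≁ : ∀ c → ¬ (u ~ el c)
        u≁ c e = n-u c (N-cong (~-sym e) ~-refl (N-self (Rel c)))
        swap : u ◁ x ~ z
        swap = ~-trans (solve (free v ◂ free f ◂ free x ◂ ⟨⟩) ((v₀ ⊙ v₁) ⊙ v₂ ⊙ (v₀ ⊙ v₁) ′) (v₀ ⊙ ((v₁ ⊙ v₂) ⊙ v₁ ′) ⊙ v₀ ′) refl)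
          (~-trans (left-~ v (right-~ (inv v) (right-~ (inv f) (comm ix))))
          (~-trans (solve (free v ◂ free f ◂ free x ◂ ⟨⟩) (v₀ ⊙ ((v₂ ⊙ v₁) ⊙ v₁ ′) ⊙ v₀ ′) ((v₀ ⊙ v₂) ⊙ v₀ ′) refl)
          (~-trans (right-~ (inv v) vx) (solve (free z ◂ free v ◂ ⟨⟩) ((v₀ ⊙ v₁) ⊙ v₁ ′) v₀ refl))))

  -- If `f² ≠ 1`, every canonical generator is an inversion of exactly one of `f` and `f⁻¹`. Two of
  -- three then behave alike, and `two-inversions` applies to `f` or to `f⁻¹`. If `f² = 1` this
  -- distinction is lost, but `f` is central.
  at-most-two : ∀ {f x y z} → ¬ (f ~ []) → Canonical f x → Canonical f y → Canonical f z →
    ¬ (x ~ y) → ¬ (x ~ z) → ¬ (y ~ z) → ⊥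
  at-most-two {f} {x} {y} {z} f≁1 cx cy cz xy xz yz = run (do
      inj₂ ff ← em (f ++ f ~ [])
        where inj₁ ff → return (Involution.three ff f≁1 cx cy cz xy xz yz)
      (a , na) ← Is-total (N f x)
      (b , nb) ← Is-total (N f y)
      (c , nc) ← Is-total (N f z)
      return (pick ff a b c na nb nc))
    where
    moves : ¬ (f ++ f ~ []) → ∀ {r} → In f r → ¬ (r ~ f ◁ r)
    moves ff {r} p e = ff (begin
      f ++ f                    ≈⟨ solve (invo r (Refl-invol (proj₁ p)) ◂ free f ◂ ⟨⟩) (v₁ ⊙ v₁) ((v₁ ⊙ v₀) ⊙ v₀ ⊙ v₁) refl ⟩
      (f ++ r) ++ r ++ f        ≈⟨ right-~ (r ++ f) (In-commute p) ⟩
      (r ++ inv f) ++ r ++ f    ≈⟨ solve (free r ◂ free f ◂ ⟨⟩) ((v₀ ⊙ v₁ ′) ⊙ v₀ ⊙ v₁) (v₀ ⊙ (v₁ ′ ⊙ v₀ ⊙ v₁)) refl ⟩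
      r ++ conj f r             ≈⟨ left-~ r (◁⇒conj f e) ⟩
      r ++ r                    ≈⟨ Refl-invol (proj₁ p) ⟩
      []                        ∎)
    other : ¬ (f ++ f ~ []) → ∀ a {r} → Canonical f r → Is a (N f r) → Is (not a) (N (inv f) r)
    other ff a {r} cr n = subst (λ c → Is c (N (inv f) r)) (cong not (Boolₚ.xor-identityʳ a))
      (N-inverse true a false cr (proj₁ cr) (~-refl {r}) (Is-cong a ~-refl (~-sym (◁-id r)) n) (moves ff (proj₁ cr) ∘ ~-trans (~-sym (◁-id r))))
    moves⁻ : ¬ (f ++ f ~ []) → ∀ {r} → In f r → ¬ (r ~ inv f ◁ r)
    moves⁻ ff {r} p e = moves ff p (~-sym (~-trans (◁-cong (~-refl {f}) e)
      (solve (free f ◂ free r ◂ ⟨⟩) (v₀ ⊙ (v₀ ′ ⊙ v₁ ⊙ v₀ ′ ′) ⊙ v₀ ′) v₁ refl)))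
    pair : ¬ (f ++ f ~ []) → ∀ a {x y z} → Canonical f x → Canonical f y → Canonical f z →
      ¬ (x ~ y) → ¬ (x ~ z) → ¬ (y ~ z) → Is a (N f x) → Is a (N f y) → ⊥
    pair ff true  cx cy cz xy xz yz nx ny = two-inversions cx cy cz xy xz yz (moves ff (proj₁ cz)) nx ny (other ff true cx nx) (other ff true cy ny)
    pair ff false {x} {y} cx cy cz xy xz yz nx ny = two-inversions (Canonical-inv cx) (Canonical-inv cy) (Canonical-inv cz) xy xz yz
      (moves⁻ ff (proj₁ cz)) (other ff false cx nx) (other ff false cy ny)
      (nx ∘ N-cong ff⁻ ~-refl) (ny ∘ N-cong ff⁻ ~-refl)
      where ff⁻ : inv (inv f) ~ f
            ff⁻ = solve (free f ◂ ⟨⟩) (v₀ ′ ′) v₀ refl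
    pick : ¬ (f ++ f ~ []) → ∀ a b c → Is a (N f x) → Is b (N f y) → Is c (N f z) → ⊥
    pick ff true  true  c     na nb nc = pair ff true cx cy cz xy xz yz na nb
    pick ff false false c     na nb nc = pair ff false cx cy cz xy xz yz na nb
    pick ff true  false true  na nb nc = pair ff true cx cz cy xz xy (yz ∘ ~-sym) na nc
    pick ff true  false false na nb nc = pair ff false cy cz cx yz (xy ∘ ~-sym) (xz ∘ ~-sym) nb nc
    pick ff false true  true  na nb nc = pair ff true cy cz cx yz (xy ∘ ~-sym) (xz ∘ ~-sym) nb nc
    pick ff false true  false na nb nc = pair ff false cx cz cy xz xy (yz ∘ ~-sym) na nc

-- Pencils along reduced words and common covers

module WordCovers (W : CoxeterSystem) where
  open CoxeterSystem W
  open Coxeter W renaming (_≈_ to infix 4 _≈_; _≤B_ to infix 4 _≤B_; _ℓ<_ to infix 4 _ℓ<_)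
  open Classical ⊥
  open Words W ⊥
  open Length W
  open Pencils W

  -- The first member of the pencil met along `p` is canonical: conjugating back by the letters
  -- already passed turns it into a letter. Those letters lie outside the successive conjugates of
  -- the pencil, so they add no inversions inside it.
  first-crossing : ∀ p f r → Red p → In f r → N p r → C (∃[ ω ] (Canonical f ω × N p ω))
  first-crossing [] f r _ _ n = impossible (N-[] r n)
  first-crossing (s ∷ p) f r red ir n = do
      inj₂ ns ← em (In f [ s ])
        where inj₁ is → return ([ s ] , Canonical-letter is ,
                N-++ [ s ] p true false (N-letter true ~-refl)
                  (Red-disjoint [ s ] p red (Refl-letter s) (N-letter true ~-refl)))
      (ω , (iω , c) , nω) ← first-crossing p (conj [ s ] f) (conj [ s ] r) (Red-suffix [ s ] p red) (In-conj [ s ] ir)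
        (N-right [ s ] p (λ k → ns (In-cong ~-refl (~-sym (N-letter⁻ k)) ir)) n)
      let ω′ = [ s ] ◁ ω
          iω′ : In f ω′
          iω′ = In-cong (◁-conj [ s ] f) ~-refl (In-◁ [ s ] iω)
          s≁ω′ : ¬ ([ s ] ~ ω′)
          s≁ω′ e = ns (In-cong ~-refl (~-sym e) iω′)
      return (ω′ , (iω′ , λ t it n → conj⇒◁ [ s ] (c (conj [ s ] t) (In-conj [ s ] it) (N-ω ω t iω′ it ns n)))
        , N-++ [ s ] p false true (s≁ω′ ∘ N-letter⁻) (N-cong ~-refl (~-sym (conj-◁ [ s ] ω)) nω))
    where
    N-ω : ∀ ω t → In f ([ s ] ◁ ω) → In f t → ¬ In f [ s ] → N ([ s ] ◁ ω) t → N ω (conj [ s ] t)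
    N-ω ω t iω it ns n = N-left ω (inv [ s ])
      (N-right [ s ] (ω ++ inv [ s ]) (λ k → ns (In-cong ~-refl (~-sym (N-letter⁻ k)) it)) n)
      λ k → ns (In-cong ~-refl (◁⇒conj ([ s ] ◁ ω) (~-trans (conj⇒◁ [ s ] (conj⇒◁ ω (~-sym (N-letter⁻ k))))
          (solve (invo [ s ] (ss-invol s) ◂ free ω ◂ ⟨⟩) (v₀ ⊙ (v₁ ⊙ v₀ ⊙ v₁ ′) ⊙ v₀ ′) ((v₀ ⊙ v₁ ⊙ v₀ ′) ⊙ v₀ ⊙ (v₀ ⊙ v₁ ⊙ v₀ ′) ′) refl)))
        (In-conj-self iω it))

  Red-inv : ∀ w → Red w → Red (inv w)
  Red-inv w r = subst (Len (inv w)) (sym (length-reverse w)) (Len-inv r)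

  module Position {q σ q′} (red : Red (q ++ σ ∷ q′)) where
    r = q ◁ [ σ ]

    r-refl : Refl r
    r-refl = Refl-◁ q (Refl-letter σ)

    not-before : ¬ N q r
    not-before n = Red-disjoint q (σ ∷ q′) red r-refl n (N-cong ~-refl (~-sym (conj-◁ q [ σ ]))
      (N-++ [ σ ] q′ true false (N-letter true ~-refl)
        (Red-disjoint [ σ ] q′ (Red-suffix q (σ ∷ q′) red) (Refl-letter σ) (N-letter true ~-refl))))

    after : N (q ++ [ σ ]) r
    after = N-++ q [ σ ] false true not-before (N-letter true (~-sym (conj-◁ q [ σ ])))

    red-after : Red ((q ++ [ σ ]) ++ q′)
    red-after = subst Red (sym (++-assoc q [ σ ] q′)) red

  prefix-< : ∀ q₁ q₂ {s₁ s₂ : S} {q₁′ q₂′} → q₁ ++ s₁ ∷ q₁′ ≡ q₂ ++ s₂ ∷ q₂′ → length q₁ < length q₂ →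
    ∃[ e ] q₂ ≡ (q₁ ++ [ s₁ ]) ++ e
  prefix-< []       (x ∷ q₂) eq _ with ∷-injective eq
  ... | refl , _ = q₂ , refl
  prefix-< (x ∷ q₁) (y ∷ q₂) eq (s≤s lt) with ∷-injective eq
  ... | refl , eq′ with prefix-< q₁ q₂ eq′ lt
  ...   | e , refl = e , refl

  prefix-≡ : ∀ q₁ q₂ {s₁ s₂ : S} {q₁′ q₂′} → q₁ ++ s₁ ∷ q₁′ ≡ q₂ ++ s₂ ∷ q₂′ → length q₁ ≡ length q₂ →
    q₁ ≡ q₂ × s₁ ≡ s₂
  prefix-≡ [] [] eq _ = refl , proj₁ (∷-injective eq)
  prefix-≡ (x ∷ q₁) (y ∷ q₂) eq len with ∷-injective eq
  ... | refl , eq′ with prefix-≡ q₁ q₂ eq′ (ℕₚ.suc-injective len)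
  ...   | refl , refl = refl , refl

  -- Deleting a letter whose inversion lies strictly between two others of the
  -- same pencil does not leave a reduced word.
  not-middle : ∀ {f q σ q′ t t′} → ¬ (f ~ []) → Red (q ++ σ ∷ q′) → Red (q ++ q′) → In f (q ◁ [ σ ]) →
    In f t → N q t → In f t′ → N (q ++ σ ∷ q′) t′ → ¬ N (q ++ [ σ ]) t′ → ⊥
  not-middle {f} {q} {σ} {q′} {t} {t′} f≁1 red red′ ir it nt it′ nt′ nt″ = run (do
      (ω , cω , nω) ← first-crossing (inv q) f′ (conj q t) (Red-inv q (Red-prefix q (σ ∷ q′) red)) (In-conj q it)
        (N-inv q true (N-cong ~-refl (~-sym (◁-conj q t)) nt))
      (ψ , cψ , nψ) ← first-crossing q′ f′ (conj (q ++ [ σ ]) t′) (Red-suffix q q′ red′) it″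
        (N-right (q ++ [ σ ]) q′ nt″ (subst (λ w → N w t′) (sym (++-assoc q [ σ ] q′)) nt′))
      -- Seen from the end of `q` there are three canonical generators: `σ`, the first crossing
      -- backwards through `q` and the first crossing forwards through `q′`. Reducedness of the word
      -- with and without `σ` keeps them distinct.
      return (at-most-two f′≁1 (Canonical-letter iα) cω cψ
        (λ e → not-before (N-q (N-cong ~-refl (~-sym e) nω)))
        (λ e → Red-disjoint (q ++ [ σ ]) q′ red-after r-refl after
          (N-cong ~-refl (~-trans (~-sym e) (~-sym (solve (free q ◂ invo [ σ ] (ss-invol σ) ◂ ⟨⟩) ((v₀ ⊙ v₁) ′ ⊙ (v₀ ⊙ v₁ ⊙ v₀ ′) ⊙ (v₀ ⊙ v₁)) v₁ refl))) nψ))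
        (λ e → Red-disjoint q q′ red′ (Refl-◁ q (proj₁ (proj₁ cω))) (N-q nω)
          (N-cong ~-refl (~-trans (~-sym e) (~-sym (conj-◁ q ω))) nψ))))
    where
    open Position {q} {σ} {q′} red
    f′ = conj q f
    f′≁1 : ¬ (f′ ~ [])
    f′≁1 e = f≁1 (~-trans (conj⇒◁ q e) (return (inv-right q)))
    iα : In f′ [ σ ]
    iα = In-cong ~-refl (conj-◁ q [ σ ]) (In-conj q ir)
    it″ : In f′ (conj (q ++ [ σ ]) t′)
    it″ = In-inv⁻ (In-cong (~-trans (solve (free q ◂ free [ σ ] ◂ free f ◂ ⟨⟩) ((v₀ ⊙ v₁) ′ ⊙ v₂ ⊙ (v₀ ⊙ v₁)) (v₁ ′ ⊙ (v₀ ′ ⊙ v₂ ⊙ v₀) ⊙ v₁) refl)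
      (In-inverts iα))
      ~-refl (In-conj (q ++ [ σ ]) it′))
    N-q : ∀ {ω} → N (inv q) ω → N q (q ◁ ω)
    N-q {ω} n = N-join λ k → N-inv q false k n

  Cov : Word → Word → Set
  Cov b y = C (∃[ t ] (Refl t × y ~ t ++ b))

  swap-refl : ∀ {t y b} → Refl t → y ~ t ++ b → b ~ t ++ y
  swap-refl {t} {y} {b} r e = ~-trans (~-sym (tt-cancel b r)) (left-~ t (~-sym e))

  N-cov : ∀ {t y b n} → Refl t → y ~ t ++ b → Len b n → Len y (suc n) → N y t
  N-cov {t} {y} {b} r e lb ly = N-join (do
    e′ ← swap-refl r e
    return (<⇒N r ly (Len-cong e′ lb) (ℕₚ.n<1+n _)))

  cover-deletion : ∀ {Y n t b q σ q′} → Red Y → length Y ≡ suc n → Y ≡ q ++ σ ∷ q′ → t ~ q ◁ [ σ ] → Refl t →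
    Y ~ t ++ b → Len b n → C (Red (q ++ q′))
  cover-deletion {n = n} {t} {b} {q} {σ} {q′} red len refl τ r e lb = do
      e′ ← ~-trans (swap-refl r e) (~-trans (right-~ (q ++ σ ∷ q′) τ)
        (solve (free q ◂ invo [ σ ] (ss-invol σ) ◂ free q′ ◂ ⟨⟩) ((v₀ ⊙ v₁ ⊙ v₀ ′) ⊙ (v₀ ⊙ v₁ ⊙ v₂)) (v₀ ⊙ v₂) refl))
      return (subst (Len (q ++ q′)) (ℕₚ.suc-injective (trans (sym len) len′)) (Len-cong e′ lb))
    where
    len′ : length (q ++ σ ∷ q′) ≡ suc (length (q ++ q′))
    len′ = trans (length-++ q) (trans (ℕₚ.+-suc (length q) (length q′)) (cong suc (sym (length-++ q))))

  In-product : ∀ {f t u} → Refl t → Refl u → f ~ u ++ t → In f t × In f u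
  In-product {f} {t} {u} rt ru e =
      (rt , Refl-cong (~-trans (solve (invo t (Refl-invol rt) ◂ free u ◂ ⟨⟩) (v₀ ⊙ v₁ ⊙ v₀ ′) (v₀ ⊙ v₁ ⊙ v₀) refl) (left-~ t (~-sym e))) (Refl-◁ t ru))
    , (ru , Refl-cong (~-trans (~-sym (tt-cancel t ru)) (left-~ u (~-sym e))) rt)

  -- In a reduced word of `y` every common lower cover deletes one letter, whose inversion lies in
  -- the pencil of `f = y′ y⁻¹`. Of the three letters the middle one contradicts `not-middle`.
  no-K32 : ∀ {y y′ a b c n} → ¬ (y ~ y′) → ¬ (a ~ b) → ¬ (a ~ c) → ¬ (b ~ c) →
    Cov a y → Cov b y → Cov c y → Cov a y′ → Cov b y′ → Cov c y′ →
    Len a n → Len b n → Len c n → Len y (suc n) → ⊥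
  no-K32 {y} {y′} {a} {b} {c} {n} y≁y′ ab ac bc ay by cy ay′ by′ cy′ la lb lc ly = run (do
      let (Y , e , len , red) = reduced ly
          open Search Y e len red
      A ← datum ay ay′ la
      B ← datum by by′ lb
      D ← datum cy cy′ lc
      return (sort A B D ab ac bc))
    where
    f = y′ ++ inv y
    f≁1 : ¬ (f ~ [])
    f≁1 e = y≁y′ (~-trans (~-sym (right-~ y e)) (solve (free y ◂ free y′ ◂ ⟨⟩) ((v₁ ⊙ v₀ ′) ⊙ v₀) v₁ refl))
    module Search (Y : Word) (e : Y ≈ y) (len : length Y ≡ suc n) (red : Red Y) where
      record Datum (b : Word) : Set where
        field
          q q′ : Word
          σ    : S
          eq   : Y ≡ q ++ σ ∷ q′
          b~   : b ~ (q ◁ [ σ ]) ++ Y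
          inF  : In f (q ◁ [ σ ])
          nY   : N Y (q ◁ [ σ ])
          red′ : Red (q ++ q′)
      datum : ∀ {b} → Cov b y → Cov b y′ → Len b n → C (Datum b)
      datum {b} cy cy′ lb = do
        (t , rt , et) ← cy
        (u , ru , eu) ← cy′
        let et′ = ~-trans (return e) et
        nt ← N-cong {t = t} (~-sym (return e)) ~-refl (N-cov rt et lb ly)
        (q , σ , q′ , eq , τ) ← position Y nt
        red′ ← cover-deletion red len eq τ rt et′ lb
        return record
          { q = q ; q′ = q′ ; σ = σ ; eq = eq
          ; b~ = ~-trans (swap-refl rt et′) (right-~ Y τ)
          ; inF = In-cong ~-refl τ (proj₁ (In-product rt ru
              (~-trans (~-++ eu (inv-cong et)) (solve (free u ◂ free b ◂ invo t (Refl-invol rt) ◂ ⟨⟩) ((v₀ ⊙ v₁) ⊙ (v₂ ⊙ v₁) ′) (v₀ ⊙ v₂) refl))))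
          ; nY = N-cong {t = t} ~-refl τ (return nt)
          ; red′ = red′ }
      open Datum
      middle : ∀ {a b c} (A : Datum a) (B : Datum b) (D : Datum c) →
        length (q A) < length (q B) → length (q B) < length (q D) → ⊥
      middle A B D lt lt′ with prefix-< (q A) (q B) (trans (sym (eq A)) (eq B)) lt | prefix-< (q B) (q D) (trans (sym (eq B)) (eq D)) lt′
      ... | e₁ , eq₁ | e₂ , eq₂ = not-middle f≁1 (subst Red (eq B) red) (red′ B) (inF B) (inF A)
              (subst (λ w → N w (q A ◁ [ σ A ])) (sym eq₁) (N-prefix (q A ++ [ σ A ]) e₁ (subst Red eq₁ (red-q B))
                (Position.r-refl {q A} (subst Red (eq A) red)) (Position.after {q A} (subst Red (eq A) red))))
              (inF D) (subst (λ w → N w (q D ◁ [ σ D ])) (eq B) (nY D))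
              (λ n → Position.not-before {q D} (subst Red (eq D) red) (subst (λ w → N w (q D ◁ [ σ D ])) (sym eq₂)
                (N-prefix (q B ++ [ σ B ]) e₂ (subst Red eq₂ (red-q D)) (proj₁ (inF D)) n)))
        where
        red-q : ∀ {b} (B : Datum b) → Red (q B)
        red-q B = Red-prefix (q B) (σ B ∷ q′ B) (subst Red (eq B) red)
      same : ∀ {a b} (A : Datum a) (B : Datum b) → ¬ (a ~ b) → length (q A) ≢ length (q B)
      same A B ne l with prefix-≡ (q A) (q B) (trans (sym (eq A)) (eq B)) l
      ... | qq , ss = ne (~-trans (b~ A) (~-trans (~-reflexive (cong₂ (λ q s → (q ◁ [ s ]) ++ Y) qq ss)) (~-sym (b~ B))))
      sort : ∀ {a b c} (A : Datum a) (B : Datum b) (D : Datum c) → ¬ (a ~ b) → ¬ (a ~ c) → ¬ (b ~ c) → ⊥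
      sort A B D ab ac bc with ℕₚ.<-cmp (length (q A)) (length (q B)) | ℕₚ.<-cmp (length (q B)) (length (q D)) | ℕₚ.<-cmp (length (q A)) (length (q D))
      ... | tri≈ _ l _ | _ | _ = same A B ab l
      ... | _ | tri≈ _ l _ | _ = same B D bc l
      ... | _ | _ | tri≈ _ l _ = same A D ac l
      ... | tri< x _ _ | tri< y _ _ | _ = middle A B D x y
      ... | tri> _ _ x | tri> _ _ y | _ = middle D B A y x
      ... | tri< x _ _ | tri> _ _ y | tri< z _ _ = middle A D B z y
      ... | tri< x _ _ | tri> _ _ y | tri> _ _ z = middle D A B z x
      ... | tri> _ _ x | tri< y _ _ | tri< z _ _ = middle B A D x z
      ... | tri> _ _ x | tri< y _ _ | tri> _ _ z = middle B D A y z

  -- An upper cover `y = t a = u b` has `t` and `u` in the pencil of `f = b a⁻¹`, and by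
  -- `not-middle` the one that comes first in a reduced word of `y` is canonical. For two of the
  -- three covers this happens on the same side, say with canonical `r` and `r′` that are not
  -- inversions of `a`. By `first-crossing` and `at-most-two`, no member of the pencil is then an
  -- inversion of `a`, so `r` is the only one for `r a`. But both `t` and `u` are inversions of that
  -- cover.
  no-K23 : ∀ {a b y₁ y₂ y₃ n} → ¬ (a ~ b) → ¬ (y₁ ~ y₂) → ¬ (y₁ ~ y₃) → ¬ (y₂ ~ y₃) →
    Cov a y₁ → Cov a y₂ → Cov a y₃ → Cov b y₁ → Cov b y₂ → Cov b y₃ →
    Len a n → Len b n → Len y₁ (suc n) → Len y₂ (suc n) → Len y₃ (suc n) → ⊥
  no-K23 {a} {b} {y₁} {y₂} {y₃} {n} a≁b n₁₂ n₁₃ n₂₃ ay₁ ay₂ ay₃ by₁ by₂ by₃ la lb l₁ l₂ l₃ = run (do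
      D₁ ← datum ay₁ by₁ l₁
      D₂ ← datum ay₂ by₂ l₂
      D₃ ← datum ay₃ by₃ l₃
      return (pigeonhole D₁ D₂ D₃ (Datum.first D₁) (Datum.first D₂) (Datum.first D₃)))
    where
    f = b ++ inv a
    f≁1 : ¬ (f ~ [])
    f≁1 e = a≁b (~-trans (~-sym (right-~ a e)) (solve (free a ◂ free b ◂ ⟨⟩) ((v₁ ⊙ v₀ ′) ⊙ v₀) v₁ refl))
    record Datum (y : Word) : Set where
      field
        t u   : Word
        y~ta  : y ~ t ++ a
        y~ub  : y ~ u ++ b
        it    : In f t
        iu    : In f u
        nt    : N y t
        nu    : N y u
        t≁u   : ¬ (t ~ u)
        first : Canonical f t ⊎ Canonical f u
    datum : ∀ {y} → Cov a y → Cov b y → Len y (suc n) → C (Datum y)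
    datum {y} ay by ly = do
        (t , rt , et) ← ay
        (u , ru , eu) ← by
        let f~ut : f ~ u ++ t
            f~ut = ~-trans (~-++ (swap-refl ru eu) (inv-cong (swap-refl rt et)))
              (solve (free u ◂ free y ◂ invo t (Refl-invol rt) ◂ ⟨⟩) ((v₀ ⊙ v₁) ⊙ (v₂ ⊙ v₁) ′) (v₀ ⊙ v₂) refl)
            (it , iu) = In-product rt ru f~ut
            t≁u = λ e → f≁1 (~-trans f~ut (~-trans (left-~ u e) (Refl-invol ru)))
            nt = N-cov rt et la ly
            nu = N-cov ru eu lb ly
            (Y , e , len , red) = reduced ly
        mt ← N-cong {t = t} (~-sym (return e)) ~-refl nt
        mu ← N-cong {t = u} (~-sym (return e)) ~-refl nu
        (q , σ , q′ , eq , τ) ← position Y mt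
        (p , ρ , p′ , eq′ , υ) ← position Y mu
        redt ← cover-deletion red len eq τ rt (~-trans (return e) et) la
        redu ← cover-deletion red len eq′ υ ru (~-trans (return e) eu) lb
        return record { t = t ; u = u ; y~ta = et ; y~ub = eu ; it = it ; iu = iu ; nt = nt ; nu = nu ; t≁u = t≁u
          ; first = earlier Y red t u it iu (return mt) (return mu) t≁u q σ q′ eq τ redt p ρ p′ eq′ υ redu }
      where
      canonical : ∀ Y → Red Y → ∀ t u → In f t → In f u → N Y u → ∀ q σ q′ → Y ≡ q ++ σ ∷ q′ → t ~ q ◁ [ σ ] → Red (q ++ q′) →
        ∀ p ρ p′ → Y ≡ p ++ ρ ∷ p′ → u ~ p ◁ [ ρ ] → length q < length p → Canonical f t
      canonical Y red t u it iu mu q σ q′ refl τ redt p ρ p′ eq′ υ lt = it , λ v iv nv → ~-join λ ne → run (do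
          inj₂ nq ← em (N q v)
            where inj₁ nq → return (before v iv nq)
          inj₂ nq′ ← em (N q ((q ◁ [ σ ]) ◁ v))
            where inj₁ nq′ → return (before _ (In-self (In-cong ~-refl τ it) iv) nq′)
          return (N-palindrome q σ v false false false nq (λ e → ne (~-trans (conj⇒◁ q (~-sym e)) (~-sym τ))) nq′ (N-cong τ ~-refl nv)))
        where
        before : ∀ v → In f v → N q v → ⊥
        before v iv nq with prefix-< q p eq′ lt
        ... | e , pe = not-middle f≁1 red redt (In-cong ~-refl τ it) iv nq iu mu λ k →
          Position.not-before {p} (subst Red eq′ red) (N-cong ~-refl υ (subst (λ w → N w u) (sym pe)
            (N-prefix (q ++ [ σ ]) e (subst Red pe (Red-prefix p (ρ ∷ p′) (subst Red eq′ red))) (proj₁ iu) k)))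
      earlier : ∀ Y → Red Y → ∀ t u → In f t → In f u → N Y t → N Y u → ¬ (t ~ u) →
        ∀ q σ q′ → Y ≡ q ++ σ ∷ q′ → t ~ q ◁ [ σ ] → Red (q ++ q′) →
        ∀ p ρ p′ → Y ≡ p ++ ρ ∷ p′ → u ~ p ◁ [ ρ ] → Red (p ++ p′) → Canonical f t ⊎ Canonical f u
      earlier Y red t u it iu mt mu ne q σ q′ eq τ redt p ρ p′ eq′ υ redu with ℕₚ.<-cmp (length q) (length p)
      ... | tri< lt _ _ = inj₁ (canonical Y red t u it iu mu q σ q′ eq τ redt p ρ p′ eq′ υ lt)
      ... | tri> _ _ gt = inj₂ (canonical Y red u t iu it mt p ρ p′ eq′ υ redu q σ q′ eq τ gt)
      ... | tri≈ _ l _ with prefix-≡ q p (trans (sym eq) eq′) l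
      ...   | refl , refl = ⊥-elim (ne (~-trans τ (~-sym υ)))
    open Datum
    two : ∀ {a r r′ s y y′} → C (∃[ n ] Len a n) → Canonical f r → Canonical f r′ → ¬ (y ~ y′) → y ~ r ++ a → y′ ~ r′ ++ a →
      ¬ N a r → ¬ N a r′ → In f s → N y s → ¬ (s ~ r) → ⊥
    two {a} {r} {r′} {s} {y} {y′} la cr cr′ y≁y′ e e′ nr nr′ is ns s≁r =
        N-++ r a false false (Canonical-N false cr is s≁r) (none (In-conj-self (proj₁ cr) is)) (N-cong e ~-refl ns)
      where
      none : ∀ {v} → In f v → ¬ N a v
      none {v} iv nv = run (do
        (_ , l) ← la
        let (p , ep , _ , red) = reduced l
        (ω , cω , nω) ← first-crossing p f v red iv (N-cong {t = v} (~-sym (return ep)) ~-refl nv)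
        let na = N-cong {t = ω} (return ep) ~-refl nω
        return (at-most-two f≁1 cr cr′ cω
          (λ q → y≁y′ (~-trans e (~-trans (right-~ a q) (~-sym e′))))
          (λ q → nr (N-cong ~-refl (~-sym q) na)) (λ q → nr′ (N-cong ~-refl (~-sym q) na))))
    raise : ∀ {r a y} → Refl r → y ~ r ++ a → N y r → ¬ N a r
    raise {r} r-refl e n k = N-t· r-refl true k (N-cong e ~-refl n)
    both-a : ∀ {y y′} → ¬ (y ~ y′) → (D : Datum y) (D′ : Datum y′) → Canonical f (t D) → Canonical f (t D′) → ⊥
    both-a ne D D′ c c′ = two (return (n , la)) c c′ ne (y~ta D) (y~ta D′)
      (raise (proj₁ (it D)) (y~ta D) (nt D)) (raise (proj₁ (it D′)) (y~ta D′) (nt D′)) (iu D) (nu D) (t≁u D ∘ ~-sym)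
    both-b : ∀ {y y′} → ¬ (y ~ y′) → (D : Datum y) (D′ : Datum y′) → Canonical f (u D) → Canonical f (u D′) → ⊥
    both-b ne D D′ c c′ = two (return (n , lb)) c c′ ne (y~ub D) (y~ub D′)
      (raise (proj₁ (iu D)) (y~ub D) (nu D)) (raise (proj₁ (iu D′)) (y~ub D′) (nu D′)) (it D) (nt D) (t≁u D)
    pigeonhole : (D₁ : Datum y₁) (D₂ : Datum y₂) (D₃ : Datum y₃) →
      Canonical f (t D₁) ⊎ Canonical f (u D₁) → Canonical f (t D₂) ⊎ Canonical f (u D₂) → Canonical f (t D₃) ⊎ Canonical f (u D₃) → ⊥
    pigeonhole D₁ D₂ D₃ (inj₁ c) (inj₁ d) _ = both-a n₁₂ D₁ D₂ c d
    pigeonhole D₁ D₂ D₃ (inj₂ c) (inj₂ d) _ = both-b n₁₂ D₁ D₂ c d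
    pigeonhole D₁ D₂ D₃ (inj₁ c) (inj₂ d) (inj₁ e) = both-a n₁₃ D₁ D₃ c e
    pigeonhole D₁ D₂ D₃ (inj₁ c) (inj₂ d) (inj₂ e) = both-b n₂₃ D₂ D₃ d e
    pigeonhole D₁ D₂ D₃ (inj₂ c) (inj₁ d) (inj₁ e) = both-a n₂₃ D₂ D₃ d e
    pigeonhole D₁ D₂ D₃ (inj₂ c) (inj₁ d) (inj₂ e) = both-b n₁₃ D₁ D₃ c e

-- The Bruhat order and the lifting property

module BruhatOrder (W : CoxeterSystem) where
  open import Data.Nat using (_≤_)
  open CoxeterSystem W
  open Coxeter W renaming (_≈_ to infix 4 _≈_; _≤B_ to infix 4 _≤B_; _ℓ<_ to infix 4 _ℓ<_)
  open Classical ⊥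
  open Words W ⊥
  open Length W
  open WordCovers W using (Cov)

  infix 4 _⊑_
  _⊑_ : Word → Word → Set
  x ⊑ y = C (x ≤B y)

  ⊑-reflexive : ∀ {x y} → x ~ y → x ⊑ y
  ⊑-reflexive e = e >>= return ∘ ≤B-refl

  ≤B-trans : ∀ {x y z} → x ≤B y → y ≤B z → x ≤B z
  ≤B-trans p (≤B-refl e) = ≤B-respʳ e p
    where
    ≤B-respʳ : ∀ {x y z} → y ≈ z → x ≤B y → x ≤B z
    ≤B-respʳ e (≤B-refl f) = ≤B-refl (≈-trans f e)
    ≤B-respʳ e (≤B-step p (r , s , f , a , b , l , l′ , lt)) =
      ≤B-step p (r , s , ≈-trans (≈-sym e) f , a , b , l , Len-cong e l′ , lt)
  ≤B-trans p (≤B-step q st) = ≤B-step (≤B-trans p q) st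

  ⊑-trans : ∀ {x y z} → x ⊑ y → y ⊑ z → x ⊑ z
  ⊑-trans p q = do p ← p ; q ← q ; return (≤B-trans p q)

  ⊑-resp : ∀ {x x′ y y′} → x ~ x′ → y ~ y′ → x ⊑ y → x′ ⊑ y′
  ⊑-resp e f p = ⊑-trans (⊑-reflexive (~-sym e)) (⊑-trans p (⊑-reflexive f))

  ⊑-reflect : ∀ {t x} → Refl t → ¬ N x t → x ⊑ t ++ x
  ⊑-reflect {t} {x} p n = do
    (r , s , e) ← p
    (a , la) ← Len-total x
    (b , lb) ← Len-total (t ++ x)
    let u = inv x ++ r
    f ← ~-trans (~-++ e (~-refl {x})) (solve (free r ◂ free [ s ] ◂ free x ◂ ⟨⟩)
          ((v₀ ⊙ v₁ ⊙ v₀ ′) ⊙ v₂) (v₂ ⊙ ((v₂ ′ ⊙ v₀) ⊙ v₁ ⊙ (v₂ ′ ⊙ v₀) ′)) refl)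
    return (≤B-step (≤B-refl ≈-refl) (u , s , f , a , b , la , lb , ¬N⇒> p n la lb))

  step-reflection : ∀ {v w} → BruhatStep v w → ∃[ t ] (Refl t × w ~ t ++ v × ¬ N v t)
  step-reflection {v} {w} (r , s , e , a , b , la , lb , lt) = t , refl-t , w~tv , λ n → run (do
      f ← w~tv
      return (>⇒¬N la (Len-cong f lb) lt n))
    where
    t = v ◁ (r ◁ [ s ])
    refl-t = Refl-◁ v (Refl-◁ r (Refl-letter s))
    w~tv : w ~ t ++ v
    w~tv = ~-trans (return e) (solve (free v ◂ free r ◂ free [ s ] ◂ ⟨⟩)
      (v₀ ⊙ (v₁ ⊙ v₂ ⊙ v₁ ′)) ((v₀ ⊙ (v₁ ⊙ v₂ ⊙ v₁ ′) ⊙ v₀ ′) ⊙ v₀) refl)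

  ℓ<⇒< : ∀ {v w a b} → v ℓ< w → Len v a → Len w b → a < b
  ℓ<⇒< (_ , _ , p , q , lt) p′ q′ = subst₂ _<_ (Len-unique p p′ ~-refl) (Len-unique q q′ ~-refl) lt

  ≤B-length : ∀ {x y a b} → x ≤B y → Len x a → Len y b → C ((a ≡ b × x ~ y) ⊎ (a < b))
  ≤B-length (≤B-refl e) p q = return (inj₁ (Len-unique p q (return e) , return e))
  ≤B-length (≤B-step {v = v} x≤v (_ , _ , _ , v<w)) p q = do
    (c , r) ← Len-total v
    inj₁ (eq , _) ← ≤B-length x≤v p r
      where inj₂ lt → return (inj₂ (ℕₚ.<-trans lt (ℓ<⇒< v<w r q)))
    return (inj₂ (subst (_< _) (sym eq) (ℓ<⇒< v<w r q)))

  ⊑-Len : ∀ {x y a b} → x ⊑ y → Len x a → Len y b → a ≤ b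
  ⊑-Len {a = a} {b} l p q = decidable-stable (a ℕ.≤? b) (do
    l ← l
    inj₁ (eq , _) ← ≤B-length l p q
      where inj₂ lt → return (ℕₚ.<⇒≤ lt)
    return (ℕₚ.≤-reflexive eq))

  ⊑-Len-≡ : ∀ {x y a} → x ⊑ y → Len x a → Len y a → x ~ y
  ⊑-Len-≡ l p q = do
    l ← l
    inj₁ (_ , e) ← ≤B-length l p q
      where inj₂ lt → impossible (ℕₚ.<-irrefl refl lt)
    e

  ⊑-antisym : ∀ {x y} → x ⊑ y → y ⊑ x → x ~ y
  ⊑-antisym {x} {y} p q = do
    (a , la) ← Len-total x
    (b , lb) ← Len-total y
    ⊑-Len-≡ p la (subst (Len y) (ℕₚ.≤-antisym (⊑-Len q lb la) (⊑-Len p la lb)) lb)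

  ⊑⇒Cov : ∀ {x y a} → x ⊑ y → Len x a → Len y (suc a) → Cov x y
  ⊑⇒Cov {x} {y} l p q = l >>= go
    where
    go : x ≤B y → Cov x y
    go (≤B-refl e) = impossible (ℕₚ.1+n≢n (Len-unique q p (~-sym (return e))))
    go (≤B-step {v = v} x≤v st@(_ , _ , _ , v<w)) = do
      (c , r) ← Len-total v
      let (t , rt , e , _) = step-reflection st
      let c≡a = ℕₚ.≤-antisym (s≤s⁻¹ (ℓ<⇒< v<w r q)) (⊑-Len (return x≤v) p r)
      return (t , rt , ~-trans e (~-++ (~-refl {t}) (~-sym (⊑-Len-≡ (return x≤v) p (subst (Len v) c≡a r)))))

  []⊑ : ∀ x → [] ⊑ x
  []⊑ x = do
    (n , l) ← Len-total x
    let (x′ , e , _ , red) = reduced l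
    ⊑-resp ~-refl (return e) (go x′ red)
    where
    go : ∀ w → Red w → [] ⊑ w
    go []      _   = ⊑-reflexive ~-refl
    go (s ∷ w) red = ⊑-trans (go w (Red-suffix [ s ] w red))
      (⊑-reflect (Refl-letter s) (>⇒¬N (Red-suffix [ s ] w red) red (ℕₚ.n<1+n _)))

  -- Left and right multiplication by a generator behave alike with respect to the Bruhat order.
  record Multiplication (σ : Word → Word) : Set where
    field
      σ-cong : ∀ {x y} → x ~ y → σ x ~ σ y
      σσ     : ∀ x → σ (σ x) ~ x
      σ-Len  : ∀ {x a b} → Len x a → Len (σ x) b → C ((b ≡ suc a × x ⊑ σ x) ⊎ (a ≡ suc b × σ x ⊑ x))
      σ-step : ∀ {t x} → Refl t → ¬ N x t → C (σ x ~ t ++ x ⊎ σ x ⊑ σ (t ++ x))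

    -- The lifting property, along a chain from `x` to `y`: `σ` carries a step to a comparison in
    -- the same direction, unless it interchanges the two ends. In that case the image of the lower
    -- end is the upper end, which is below `m` anyway.
    lift : ∀ {x y m} → x ⊑ y → y ⊑ m → σ y ⊑ m → σ x ⊑ m
    lift l p q = l >>= λ l → go l p q
      where
      go : ∀ {x y m} → x ≤B y → y ⊑ m → σ y ⊑ m → σ x ⊑ m
      go (≤B-refl e) p q = ⊑-resp (σ-cong (~-sym (return e))) ~-refl q
      go {m = m} (≤B-step {v = v} {w} x≤v st) p q = go x≤v (⊑-trans v⊑w p) (do
          inj₁ f ← σ-step rt n
            where inj₂ f → ⊑-trans f (⊑-resp (σ-cong e) ~-refl q)
          ⊑-resp (~-trans e (~-sym f)) ~-refl p)
        where
        v⊑w : v ⊑ w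
        v⊑w = return (≤B-step (≤B-refl ≈-refl) st)
        t = proj₁ (step-reflection st)
        rt = proj₁ (proj₂ (step-reflection st))
        e = proj₁ (proj₂ (proj₂ (step-reflection st)))
        n = proj₂ (proj₂ (proj₂ (step-reflection st)))

    drop : ∀ {x y m} → x ⊑ y → m ⊑ x → m ⊑ σ x → m ⊑ σ y
    drop l p q = l >>= λ l → go l p q
      where
      go : ∀ {x y m} → x ≤B y → m ⊑ x → m ⊑ σ x → m ⊑ σ y
      go (≤B-refl e) p q = ⊑-resp ~-refl (σ-cong (return e)) q
      go (≤B-step {v = v} {w} x≤v st) p q = do
        let (t , rt , e , n) = step-reflection st
        inj₁ f ← σ-step rt n
          where inj₂ f → ⊑-trans (go x≤v p q) (⊑-resp ~-refl (σ-cong (~-sym e)) f)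
        ⊑-resp ~-refl (~-trans (~-sym (σσ v)) (σ-cong (~-trans f (~-sym e)))) (⊑-trans p (return x≤v))

  left : ∀ s → Multiplication (s ∷_)
  left s = record
    { σ-cong = ~-++ {[ s ]} ~-refl
    ; σσ = λ x → tt-cancel x (Refl-letter s)
    ; σ-Len = λ {x} p q → em (N x [ s ]) >>= λ
      { (inj₁ n) → return (inj₂ (Len-down n p q ,
          ⊑-resp ~-refl (tt-cancel x (Refl-letter s)) (⊑-reflect (Refl-letter s) (N-t· (Refl-letter s) true n))))
      ; (inj₂ n) → return (inj₁ (Len-up n p q , ⊑-reflect (Refl-letter s) n)) }
    ; σ-step = step }
    where
    step : ∀ {t x} → Refl t → ¬ N x t → C (s ∷ x ~ t ++ x ⊎ s ∷ x ⊑ s ∷ t ++ x)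
    step {t} {x} r n = em ([ s ] ~ t) >>= λ
      { (inj₁ e) → return (inj₁ (~-++ e ~-refl))
      ; (inj₂ s≁t) → return (inj₂ (⊑-resp ~-refl
          (solve (invo [ s ] (ss-invol s) ◂ free t ◂ free x ◂ ⟨⟩) ((v₀ ⊙ v₁ ⊙ v₀ ′) ⊙ v₀ ⊙ v₂) (v₀ ⊙ v₁ ⊙ v₂) refl)
          (⊑-reflect {[ s ] ◁ t} {s ∷ x} (Refl-◁ [ s ] r) (N-++ [ s ] x false false
            (λ k → s≁t (~-trans (solve (invo [ s ] (ss-invol s) ◂ ⟨⟩) v₀ (v₀ ′ ⊙ v₀ ⊙ v₀) refl)
              (~-trans (conj-cong (~-refl {[ s ]}) (N-letter⁻ k)) (conj-◁ [ s ] t))))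
            (λ k → n (N-cong ~-refl (conj-◁ [ s ] t) k)))))) }

  ⊑-compare : ∀ {t x y a b} → Refl t → y ~ t ++ x → Len x a → Len y b → a < b → x ⊑ y
  ⊑-compare r e p q lt = do
    e ← e
    ⊑-resp ~-refl (~-sym (return e)) (⊑-reflect r (>⇒¬N p (Len-cong e q) lt))

  right : ∀ s → Multiplication (_++ [ s ])
  right s = record
    { σ-cong = λ e → ~-++ e ~-refl
    ; σσ = λ x → solve (invo [ s ] (ss-invol s) ◂ free x ◂ ⟨⟩) ((v₁ ⊙ v₀) ⊙ v₀) v₁ refl
    ; σ-Len = λ {x} {a} {b} p q → em (N (inv x) [ s ]) >>= λ
      { (inj₁ n) → let eq = Len-down n (Len-inv p) (Len-sx⁻¹ x q) in
          return (inj₂ (eq , ⊑-compare (Refl-◁ x (Refl-letter s)) (solve (invo [ s ] (ss-invol s) ◂ free x ◂ ⟨⟩)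
            v₁ ((v₁ ⊙ v₀ ⊙ v₁ ′) ⊙ v₁ ⊙ v₀) refl) q p (ℕₚ.≤-reflexive (sym eq))))
      ; (inj₂ n) → let eq = Len-up n (Len-inv p) (Len-sx⁻¹ x q) in
          return (inj₁ (eq , ⊑-compare (Refl-◁ x (Refl-letter s)) (solve (free [ s ] ◂ free x ◂ ⟨⟩)
            (v₁ ⊙ v₀) ((v₁ ⊙ v₀ ⊙ v₁ ′) ⊙ v₁) refl) p q (ℕₚ.≤-reflexive (sym eq)))) }
    ; σ-step = step }
    where
    Len-sx⁻¹ : ∀ x {b} → Len (x ++ [ s ]) b → Len (s ∷ inv x) b
    Len-sx⁻¹ x {b} q = subst (λ w → Len w b) (reverse-++ x [ s ]) (Len-inv q)
    step : ∀ {t x} → Refl t → ¬ N x t → C (x ++ [ s ] ~ t ++ x ⊎ x ++ [ s ] ⊑ (t ++ x) ++ [ s ])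
    step {t} {x} r n = em ([ s ] ~ conj x t) >>= λ
      { (inj₁ e) → return (inj₁ (~-trans (~-++ (~-refl {x}) e) (solve (free x ◂ free t ◂ ⟨⟩) (v₀ ⊙ v₀ ′ ⊙ v₁ ⊙ v₀) (v₁ ⊙ v₀) refl)))
      ; (inj₂ s≁t) → return (inj₂ (⊑-resp ~-refl (~-reflexive (sym (++-assoc t x [ s ])))
          (⊑-reflect {t} {x ++ [ s ]} r (N-++ x [ s ] false false n (s≁t ∘ N-letter⁻))))) }

-- Subwords and enumeration of lower intervals

module Witnesses (W : CoxeterSystem) where
  open CoxeterSystem W
  open Coxeter W renaming (_≈_ to infix 4 _≈_; _≤B_ to infix 4 _≤B_; _ℓ<_ to infix 4 _ℓ<_)

  -- The desired statement is itself the answer type of the monad, so the classical proof of the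
  -- exchange condition ends in an actual subword instead of a double negation.
  step-subword : ∀ {v w} → BruhatStep v w → ∀ w₀ → w₀ ≈ w → ∃[ v₀ ] (v₀ ⊆ w₀ × v₀ ≈ v)
  step-subword {v} {w} (r , s , e , a , b , ((v′ , e′ , refl) , _) , (_ , minimal) , lt) w₀ e₀ = run do
      (true , p) ← Par-total w₀ t
        where (false , p) → shorter (N-t· rt false (Par⇒Is false (return p)))
      (v₀ , _ , sub , f) ← exchange w₀ p
      g ← ~-trans (~-sym f) tw₀~v
      return (v₀ , sub , g)
    where
    open Classical (∃[ v₀ ] (v₀ ⊆ w₀ × v₀ ≈ v))
    open Words W (∃[ v₀ ] (v₀ ⊆ w₀ × v₀ ≈ v))
    open Inversions W (∃[ v₀ ] (v₀ ⊆ w₀ × v₀ ≈ v))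
    t : Word
    t = v ◁ (r ◁ [ s ])
    rt : Refl t
    rt = Refl-◁ v (Refl-◁ r (Refl-letter s))
    tw₀~v : t ++ w₀ ~ v
    tw₀~v = ~-trans (~-++ (~-refl {t}) (~-trans (return e₀) (return e)))
      (solve (free v ◂ free r ◂ invo [ s ] (ss-invol s) ◂ ⟨⟩)
        ((v₀ ⊙ (v₁ ⊙ v₂ ⊙ v₁ ′) ⊙ v₀ ′) ⊙ (v₀ ⊙ (v₁ ⊙ v₂ ⊙ v₁ ′))) v₀ refl)
    -- In this case `t` is an inversion of `v`, and exchange in a shortest word of `v` gives a word
    -- for `w` that is shorter than `v`, against `v ℓ< w`.
    shorter : N (t ++ w₀) t → C (∃[ v₀ ] (v₀ ⊆ w₀ × v₀ ≈ v))
    shorter n = do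
      p ← N-cong (~-trans tw₀~v (~-sym (return e′))) ~-refl n
      (v″ , len , _ , f) ← exchange v′ p
      g ← ~-trans (~-sym f) (~-trans (~-++ (~-refl {t}) (~-trans (return e′) (~-sym tw₀~v)))
            (~-trans (tt-cancel w₀ rt) (return e₀)))
      ⊥-elim (ℕₚ.<-irrefl refl (ℕₚ.<-trans lt (ℕₚ.≤-<-trans (minimal v″ g) (ℕₚ.≤-reflexive len))))

  subword : ∀ {x y} → x ≤B y → ∀ y₀ → y₀ ≈ y → ∃[ x₀ ] (x₀ ⊆ y₀ × x₀ ≈ x)
  subword (≤B-refl e) y₀ e₀ = y₀ , ⊆-refl , ≈-trans e₀ (≈-sym e)
    where open Words W ⊥
  subword (≤B-step x≤v st) y₀ e₀ with step-subword st y₀ e₀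
  ... | v₀ , v₀⊆y₀ , f with subword x≤v v₀ f
  ...   | x₀ , x₀⊆v₀ , g = x₀ , ⊆-trans x₀⊆v₀ v₀⊆y₀ , g

  subwords : Word → List Word
  subwords []      = [ [] ]
  subwords (s ∷ w) = subwords w ++ map (s ∷_) (subwords w)

  ⊆⇒∈-subwords : ∀ {v w} → v ⊆ w → v ∈ subwords w
  ⊆⇒∈-subwords []                    = here refl
  ⊆⇒∈-subwords (_∷ʳ_ s p)            = ∈-++⁺ˡ (⊆⇒∈-subwords p)
  ⊆⇒∈-subwords {w = s ∷ w} (refl ∷ p) = ∈-++⁺ʳ (subwords w) (∈-map⁺ (s ∷_) (⊆⇒∈-subwords p))

  open Words W ⊥ using (≈-refl; ≈-sym; ≈-trans)
  open Classical ⊥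

  Enumerates : (Word → Set) → List Word → Set
  Enumerates Q zs = (∀ z → Q z ⇔ Any (λ z′ → z ≈ z′) zs) × AllPairs (λ a b → ¬ (a ≈ b)) zs

  enumerate : ∀ {y} (Q : Word → Set) → (∀ {z z′} → z ≈ z′ → Q z → Q z′) → (∀ z → Q z → z ≤B y) → C (∃[ zs ] Enumerates Q zs)
  enumerate {y} Q resp below = do
      (zs , all , pairs , any) ← represent (subwords y)
      return (zs , (λ z → mk⇔ (to zs any z) (from zs all z)) , pairs)
    where
    from : ∀ zs → All Q zs → ∀ z → Any (λ z′ → z ≈ z′) zs → Q z
    from (z′ ∷ zs) (q ∷ qs) z (here e)  = resp (≈-sym e) q
    from (z′ ∷ zs) (q ∷ qs) z (there p) = from zs qs z p
    to : ∀ zs → (∀ z → z ∈ subwords y → Q z → Any (λ z′ → z ≈ z′) zs) → ∀ z → Q z → Any (λ z′ → z ≈ z′) zs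
    to zs any z q with subword (below z q) y ≈-refl
    ... | z₀ , sub , e = Any.map (≈-trans (≈-sym e)) (any z₀ (⊆⇒∈-subwords sub) (resp (≈-sym e) q))
    represent : ∀ L → C (∃[ zs ] (All Q zs × AllPairs (λ a b → ¬ (a ≈ b)) zs × (∀ z → z ∈ L → Q z → Any (λ z′ → z ≈ z′) zs)))
    represent []      = return ([] , [] , [] , λ _ ())
    represent (a ∷ L) = do
      (zs , qs , pairs , any) ← represent L
      inj₂ new ← em (Any (λ z′ → a ≈ z′) zs)
        where inj₁ old → return (zs , qs , pairs , λ { z (here refl) _ → old ; z (there i) → any z i })
      inj₁ q ← em (Q a)
        where inj₂ ¬q → return (zs , qs , pairs , λ { z (here refl) q → ⊥-elim (¬q q) ; z (there i) → any z i })
      return (a ∷ zs , q ∷ qs , Allₚ.¬Any⇒All¬ zs new ∷ pairs ,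
        λ { z (here refl) _ → here ≈-refl ; z (there i) p → there (any z i p) })

-- Special matchings and R-polynomials

module Covers {E : Set} (_≤_ : E → E → Set) (rank : E → ℕ) where

  infix 4 _⋖_
  _⋖_ : E → E → Set
  x ⋖ y = x ≤ y × rank y ≡ suc (rank x)

  record Special (w : E) (σ : E → E) : Set where
    field
      stays     : ∀ {x} → x ≤ w → σ x ≤ w
      invol     : ∀ {x} → x ≤ w → σ (σ x) ≡ x
      updown    : ∀ {x} → x ≤ w → (x ⋖ σ x) ⊎ (σ x ⋖ x)
      up-up     : ∀ {x y} → x ≤ y → y ≤ w → x ⋖ σ x → y ⋖ σ y → σ x ≤ σ y
      down-down : ∀ {x y} → x ≤ y → y ≤ w → σ x ⋖ x → σ y ⋖ y → σ x ≤ σ y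
      up-down   : ∀ {x y} → x ≤ y → y ≤ w → x ⋖ σ x → σ y ⋖ y → x ≤ σ y

-- The axioms speak of all lower intervals at once, since the induction on R moves from `w` to
-- elements below it. `matchings` provides two values at `w`, so that matchings with the same value
-- at `w` can be compared through one with another value.
record Diamond (X : Set) : Set₁ where
  infix 4 _≤_ _≟_ _≤?_
  E : Set
  E = X
  field
    _≤_   : E → E → Set
    rank  : E → ℕ
    _≟_   : DecidableEquality E
    _≤?_  : Decidable _≤_
    ≤-refl  : ∀ {x} → x ≤ x
    ≤-trans : ∀ {x y z} → x ≤ y → y ≤ z → x ≤ z
    rank-mono : ∀ {x y} → x ≤ y → rank x ≤ⁿ rank y
    rank-inj  : ∀ {x y} → x ≤ y → rank x ≡ rank y → x ≡ y
  open Covers _≤_ rank public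
  field
    matching : ∀ w → 1 ≤ⁿ rank w → ∃[ σ ] (Special w σ × σ w ⋖ w)
    matchings : ∀ w → 2 ≤ⁿ rank w →
      ∃[ σ ] ∃[ τ ] (Special w σ × Special w τ × σ w ⋖ w × τ w ⋖ w × σ w ≢ τ w)
    no-K32 : ∀ {y y′ a b c} → y ≢ y′ → a ≢ b → a ≢ c → b ≢ c →
      a ⋖ y → b ⋖ y → c ⋖ y → a ⋖ y′ → b ⋖ y′ → c ⋖ y′ → ⊥
    no-K23 : ∀ {a b y y′ y″} → a ≢ b → y ≢ y′ → y ≢ y″ → y′ ≢ y″ →
      a ⋖ y → a ⋖ y′ → a ⋖ y″ → b ⋖ y → b ⋖ y′ → b ⋖ y″ → ⊥

module Theory {X : Set} (D : Diamond X) where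
  open Diamond D

  ⋖-irrefl : ∀ {x y} → x ⋖ y → x ≢ y
  ⋖-irrefl {x} (_ , r) refl = ℕₚ.m≢1+n+m (rank x) {0} r

  ⋖-asym : ∀ {x y} → x ⋖ y → y ⋖ x → ⊥
  ⋖-asym {x} (_ , r) (_ , s) = ℕₚ.m≢1+n+m (rank x) {1} (trans s (cong suc r))

  ⋖-≤-rank : ∀ {x y z} → x ≤ z → x ⋖ y → z ⋖ y → x ≡ z
  ⋖-≤-rank x≤z (_ , r) (_ , s) = rank-inj x≤z (ℕₚ.suc-injective (trans (sym r) s))

  module Sp {w : E} {σ : E → E} (S : Special w σ) where
    open Special S public

    up-image : ∀ {x} → x ≤ w → x ⋖ σ x → σ (σ x) ⋖ σ x
    up-image x≤w u rewrite invol x≤w = u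

    down-image : ∀ {x} → x ≤ w → σ x ⋖ x → σ x ⋖ σ (σ x)
    down-image x≤w d rewrite invol x≤w = d

    up-down-⋖ : ∀ {x y} → x ⋖ y → y ≤ w → x ⋖ σ x → σ y ⋖ y → x ≡ σ y
    up-down-⋖ c y≤w u d = ⋖-≤-rank (up-down (proj₁ c) y≤w u d) c d

    σ-injective : ∀ {x y} → x ≤ w → y ≤ w → σ x ≡ σ y → x ≡ y
    σ-injective x≤w y≤w eq = trans (sym (invol x≤w)) (trans (cong σ eq) (invol y≤w))

    cover-mono : ∀ {x y} → x ⋖ y → y ≤ w → σ x ≢ y → σ x ≤ σ y
    cover-mono c y≤w ne with updown (≤-trans (proj₁ c) y≤w) | updown y≤w
    ... | inj₁ u | inj₁ u′ = up-up (proj₁ c) y≤w u u′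
    ... | inj₁ u | inj₂ d  = ⊥-elim (ne (trans (cong σ (up-down-⋖ c y≤w u d)) (invol y≤w)))
    ... | inj₂ d | inj₁ u  = ≤-trans (proj₁ d) (≤-trans (proj₁ c) (proj₁ u))
    ... | inj₂ d | inj₂ d′ = down-down (proj₁ c) y≤w d d′

    up-⋖ : ∀ {x y} → x ⋖ y → y ≤ w → x ⋖ σ x → σ x ≢ y → y ⋖ σ y
    up-⋖ c y≤w u ne with updown y≤w
    ... | inj₁ u′ = u′
    ... | inj₂ d  = ⊥-elim (ne (trans (cong σ (up-down-⋖ c y≤w u d)) (invol y≤w)))

    up-up-⋖ : ∀ {x y} → x ⋖ y → y ≤ w → x ⋖ σ x → y ⋖ σ y → σ x ⋖ σ y
    up-up-⋖ (l , r) y≤w (l₁ , r₁) (l₂ , r₂) =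
      up-up l y≤w (l₁ , r₁) (l₂ , r₂) , trans r₂ (cong suc (trans r (sym r₁)))

    down-down-⋖ : ∀ {x y} → x ⋖ y → y ≤ w → σ x ⋖ x → σ y ⋖ y → σ x ⋖ σ y
    down-down-⋖ (l , r) y≤w (l₁ , r₁) (l₂ , r₂) =
      down-down l y≤w (l₁ , r₁) (l₂ , r₂) , ℕₚ.suc-injective (trans (sym r₂) (trans r (cong suc r₁)))

    up-below : ∀ {x y} → x ≤ y → y ≤ w → x ⋖ σ x → σ y ⋖ y → σ x ≤ y
    up-below {x} {y} x≤y y≤w u d = subst (σ x ≤_) (invol y≤w)
      (up-up (up-down x≤y y≤w u d) (stays y≤w) u (down-image y≤w d))

    restrict : ∀ {v} → v ≤ w → σ v ⋖ v → Special v σ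
    restrict {v} v≤w dv = record
      { stays     = λ x≤v → case updown (≤-trans x≤v v≤w) of λ where
          (inj₁ u) → up-below x≤v v≤w u dv
          (inj₂ d) → ≤-trans (proj₁ d) x≤v
      ; invol     = λ x≤v → invol (≤-trans x≤v v≤w)
      ; updown    = λ x≤v → updown (≤-trans x≤v v≤w)
      ; up-up     = λ x≤y y≤v → up-up x≤y (≤-trans y≤v v≤w)
      ; down-down = λ x≤y y≤v → down-down x≤y (≤-trans y≤v v≤w)
      ; up-down   = λ x≤y y≤v → up-down x≤y (≤-trans y≤v v≤w)
      }

  rank-⋖ : ∀ {x y n} → x ⋖ y → rank y ≡ suc n → rank x ≡ n
  rank-⋖ (_ , r) s = ℕₚ.suc-injective (trans (sym r) s)

  -- If a matching raises `x`, then `σ z` is above `x`. Otherwise take a coatom `c` of `σ z` above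
  -- `σ x`: when `σ` raises `c`, the element `σ c` is a coatom of `z` above `x`; when it lowers `c`,
  -- already `x ≤ c`, so `σ z` serves.
  graded : ∀ n {x z} → rank z ≡ n → x ≤ z → x ≢ z → ∃[ c ] (x ≤ c × c ⋖ z)
  graded zero {x} r x≤z x≢z = ⊥-elim (x≢z (rank-inj x≤z
    (trans (ℕₚ.n≤0⇒n≡0 (subst (rank x ≤ⁿ_) r (rank-mono x≤z))) (sym r))))
  graded (suc n) {x} {z} r x≤z x≢z with matching z (subst (1 ≤ⁿ_) (sym r) (s≤s z≤n))
  ... | σ , S , d with Special.updown S x≤z
  ... | inj₁ u = σ z , Special.up-down S x≤z ≤-refl u d , d
  ... | inj₂ dx with graded n (rank-⋖ d r) (Special.down-down S x≤z ≤-refl dx d)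
                     (x≢z ∘ Sp.σ-injective S x≤z ≤-refl)
  ... | c , σx≤c , c⋖ with Special.updown S (≤-trans (proj₁ c⋖) (proj₁ d))
  ... | inj₂ dc = σ z , ≤-trans (subst (_≤ c) (Special.invol S x≤z)
                    (Sp.up-below S σx≤c (≤-trans (proj₁ c⋖) (proj₁ d)) (Sp.down-image S x≤z dx) dc)) (proj₁ c⋖) , d
  ... | inj₁ uc = σ c
        , subst (_≤ σ c) (Special.invol S x≤z) (Special.up-up S σx≤c c≤z (Sp.down-image S x≤z dx) uc)
        , subst (σ c ⋖_) (Special.invol S ≤-refl) (Sp.up-up-⋖ S c⋖ (proj₁ d) uc (Sp.down-image S ≤-refl d))
    where c≤z = ≤-trans (proj₁ c⋖) (proj₁ d)

  record Thin (x z : E) : Set where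
    field
      a b : E
      a≢b : a ≢ b
      x⋖a : x ⋖ a
      a⋖z : a ⋖ z
      x⋖b : x ⋖ b
      b⋖z : b ⋖ z
      only : ∀ {y} → x ⋖ y → y ⋖ z → (y ≡ a) ⊎ (y ≡ b)

  rank-2⇒⋖ : ∀ {x y z} → x ≤ y → y ⋖ z → rank z ≡ suc (suc (rank x)) → x ⋖ y
  rank-2⇒⋖ x≤y y⋖z r = x≤y , rank-⋖ y⋖z r

  -- If `σ` raises `x`, the middle elements are `σ z` and `σ x`; otherwise they are transported from
  -- those between `σ x` and `σ z`.
  thin : ∀ n {x z} → rank z ≡ n → x ≤ z → rank z ≡ suc (suc (rank x)) → Thin x z
  thin zero r _ rr = ⊥-elim (ℕₚ.1+n≢0 (trans (sym rr) r))
  thin (suc n) {x} {z} r x≤z rr with matching z (subst (1 ≤ⁿ_) (sym rr) (s≤s z≤n))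
  thin (suc n) {x} {z} r x≤z rr | σ , S , d with Special.updown S x≤z
  ... | inj₁ u = record
    { a = σ z ; b = σ x
    ; a≢b = λ eq → ℕₚ.m≢1+n+m (rank x) {1} (trans (cong rank (sym (Sp.σ-injective S ≤-refl x≤z eq))) rr)
    ; x⋖a = rank-2⇒⋖ (Special.up-down S x≤z ≤-refl u d) d rr ; a⋖z = d
    ; x⋖b = u ; b⋖z = Sp.up-below S x≤z ≤-refl u d , trans rr (cong suc (sym (proj₂ u)))
    ; only = only }
    where
    only : ∀ {y} → x ⋖ y → y ⋖ z → (y ≡ σ z) ⊎ (y ≡ σ x)
    only c c′ with Special.updown S (proj₁ c′)
    ... | inj₁ uy = inj₁ (Sp.up-down-⋖ S c′ ≤-refl uy d)
    ... | inj₂ dy = inj₂ (trans (sym (Special.invol S (proj₁ c′)))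
                      (cong σ (sym (Sp.up-down-⋖ S c (proj₁ c′) u dy))))
  ... | inj₂ dx with thin n (rank-⋖ d r) (Special.down-down S x≤z ≤-refl dx d)
                      (rank-⋖ d (trans rr (cong (suc ∘ suc) (proj₂ dx))))
  ... | T = record
    { a = f a ; b = f b
    ; a≢b = f-inj x⋖a a⋖z x⋖b b⋖z a≢b
    ; x⋖a = proj₁ (f-mid x⋖a a⋖z) ; a⋖z = proj₂ (f-mid x⋖a a⋖z)
    ; x⋖b = proj₁ (f-mid x⋖b b⋖z) ; b⋖z = proj₂ (f-mid x⋖b b⋖z)
    ; only = only′ }
    where
    open Thin T
    σx-up = Sp.down-image S x≤z dx
    σz-up = Sp.down-image S ≤-refl d
    -- `x` itself may lie between `σ x` and `σ z`. Its partner `σ x` is not between `x` and `z`, and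
    -- `σ z` takes its place.
    f : E → E
    f p with p ≟ x
    ... | yes _ = σ z
    ... | no  _ = σ p
    f-up : ∀ {p} → σ x ⋖ p → p ⋖ σ z → p ≢ x → p ⋖ σ p
    f-up c c′ p≢x with Special.updown S (≤-trans (proj₁ c′) (proj₁ d))
    ... | inj₁ u = u
    ... | inj₂ dp = ⊥-elim (p≢x (sym (Sp.σ-injective S x≤z (≤-trans (proj₁ c′) (proj₁ d))
                      (Sp.up-down-⋖ S c (≤-trans (proj₁ c′) (proj₁ d)) σx-up dp))))
    f-mid : ∀ {p} → σ x ⋖ p → p ⋖ σ z → (x ⋖ f p) × (f p ⋖ z)
    f-mid {p} c c′ with p ≟ x
    ... | yes refl = c′ , d
    ... | no p≢x = subst (_⋖ σ p) (Special.invol S x≤z)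
                     (Sp.up-up-⋖ S c p≤z σx-up (f-up c c′ p≢x))
                 , subst (σ p ⋖_) (Special.invol S ≤-refl)
                     (Sp.up-up-⋖ S c′ (proj₁ d) (f-up c c′ p≢x) σz-up)
      where p≤z = ≤-trans (proj₁ c′) (proj₁ d)
    f-inj : ∀ {p q} → σ x ⋖ p → p ⋖ σ z → σ x ⋖ q → q ⋖ σ z → p ≢ q → f p ≢ f q
    f-inj {p} {q} c c′ k k′ p≢q with p ≟ x | q ≟ x
    ... | yes refl | yes refl = λ _ → p≢q refl
    ... | yes refl | no  _    = λ eq → ⋖-asym d (subst (_⋖ σ z) (sym (Sp.σ-injective S ≤-refl (≤-trans (proj₁ k′) (proj₁ d)) eq)) k′)
    ... | no _ | yes refl = λ eq → ⋖-asym d (subst (_⋖ σ z) (Sp.σ-injective S (≤-trans (proj₁ c′) (proj₁ d)) ≤-refl eq) c′)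
    ... | no _ | no _ = p≢q ∘ Sp.σ-injective S (≤-trans (proj₁ c′) (proj₁ d)) (≤-trans (proj₁ k′) (proj₁ d))
    f-of : ∀ {p q y} → p ≡ q → y ≡ f q → y ≡ f p
    f-of refl eq = eq
    fx : f x ≡ σ z
    fx with x ≟ x
    ... | yes _ = refl
    ... | no ne = ⊥-elim (ne refl)
    fσ : ∀ {y} → y ≤ z → σ y ≢ x → f (σ y) ≡ y
    fσ {y} y≤z ne with σ y ≟ x
    ... | yes eq = ⊥-elim (ne eq)
    ... | no _ = Special.invol S y≤z
    only′ : ∀ {y} → x ⋖ y → y ⋖ z → (y ≡ f a) ⊎ (y ≡ f b)
    only′ {y} c c′ with Special.updown S (proj₁ c′)
    ... | inj₁ uy with Sp.up-down-⋖ S c′ ≤-refl uy d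
    ...   | refl with only dx c
    ...     | inj₁ x≡a = inj₁ (f-of (sym x≡a) (sym fx))
    ...     | inj₂ x≡b = inj₂ (f-of (sym x≡b) (sym fx))
    only′ {y} c c′ | inj₂ dy
      with only (Sp.down-down-⋖ S c (proj₁ c′) dx dy) (Sp.down-down-⋖ S c′ ≤-refl dy d)
    ... | inj₁ e = inj₁ (f-of (sym e) (sym (fσ (proj₁ c′) ne)))
      where ne : σ y ≢ x
            ne eq = ⋖-asym c (subst (_⋖ x) (trans (cong σ (sym eq)) (Special.invol S (proj₁ c′))) dx)
    ... | inj₂ e = inj₂ (f-of (sym e) (sym (fσ (proj₁ c′) ne)))
      where ne : σ y ≢ x
            ne eq = ⋖-asym c (subst (_⋖ x) (trans (cong σ (sym eq)) (Special.invol S (proj₁ c′))) dx)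

  rank-2 : ∀ {x a z} → x ⋖ a → a ⋖ z → rank z ≡ suc (suc (rank x))
  rank-2 (_ , r) (_ , s) = trans s (cong suc r)

  thin-third : ∀ {x z a b c} → a ≢ b → a ≢ c → b ≢ c →
    x ⋖ a → a ⋖ z → x ⋖ b → b ⋖ z → x ⋖ c → c ⋖ z → ⊥
  thin-third {x} {z} ab ac bc xa az xb bz xc cz
    with thin _ refl (≤-trans (proj₁ xa) (proj₁ az)) (rank-2 xa az)
  ... | T with Thin.only T xa az | Thin.only T xb bz | Thin.only T xc cz
  ... | inj₁ refl | inj₁ refl | _ = ab refl
  ... | inj₁ refl | inj₂ refl | inj₁ refl = ac refl
  ... | inj₁ refl | inj₂ refl | inj₂ refl = bc refl
  ... | inj₂ refl | inj₂ refl | _ = ab refl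
  ... | inj₂ refl | inj₁ refl | inj₂ refl = ac refl
  ... | inj₂ refl | inj₁ refl | inj₁ refl = bc refl

  thin-other : ∀ {x z a} → x ⋖ a → a ⋖ z → ∃[ b ] (b ≢ a × x ⋖ b × b ⋖ z)
  thin-other xa az with thin _ refl (≤-trans (proj₁ xa) (proj₁ az)) (rank-2 xa az)
  ... | T with Thin.only T xa az
  ... | inj₁ refl = Thin.b T , Thin.a≢b T ∘ sym , Thin.x⋖b T , Thin.b⋖z T
  ... | inj₂ refl = Thin.a T , Thin.a≢b T , Thin.x⋖a T , Thin.a⋖z T

  -- Monotonicity on covers that are not matched pairs suffices: `graded` splits every comparison
  -- into covers. The mixed matching can only be analysed on covers.
  module FromCovers (w : E) (σ : E → E)
    (stays : ∀ {x} → x ≤ w → σ x ≤ w) (invol : ∀ {x} → x ≤ w → σ (σ x) ≡ x)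
    (updown : ∀ {x} → x ≤ w → (x ⋖ σ x) ⊎ (σ x ⋖ x))
    (mono : ∀ {x y} → x ⋖ y → y ≤ w → σ x ≢ y → σ x ≤ σ y) where

    up-image : ∀ {x} → x ≤ w → σ x ⋖ x → σ x ⋖ σ (σ x)
    up-image x≤w d rewrite invol x≤w = d

    coatom-down : ∀ {c z} → c ⋖ z → z ≤ w → σ z ⋖ z → c ≢ σ z → (σ c ⋖ c) × (σ c ⋖ σ z)
    coatom-down {c} {z} cz z≤w d ne with updown (≤-trans (proj₁ cz) z≤w)
    ... | inj₂ dc = dc , mono cz z≤w (λ eq → ne (trans (sym (invol (≤-trans (proj₁ cz) z≤w))) (cong σ eq)))
                  , ℕₚ.suc-injective (trans (sym (proj₂ d)) (trans (proj₂ cz) (cong suc (proj₂ dc))))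
    ... | inj₁ u  = ⊥-elim (ℕₚ.<-irrefl refl (ℕₚ.≤-trans (ℕₚ.≤-reflexive (sym (trans (proj₂ u) (cong suc (ℕₚ.suc-injective (trans (sym (proj₂ cz)) (proj₂ d)))))))
        (rank-mono (mono cz z≤w (λ eq → ne (trans (sym (invol (≤-trans (proj₁ cz) z≤w))) (cong σ eq)))))))

    up-down : ∀ n {x z} → rank z ≡ n → x ≤ z → z ≤ w → x ⋖ σ x → σ z ⋖ z → x ≤ σ z
    up-down zero r _ _ _ d = ⊥-elim (ℕₚ.1+n≢0 (trans (sym (proj₂ d)) r))
    up-down (suc n) {x} {z} r x≤z z≤w u d
      with graded (suc n) r x≤z (λ { refl → ⋖-asym u d })
    ... | c , x≤c , cz with c ≟ σ z
    ... | yes refl = x≤c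
    ... | no ne with coatom-down cz z≤w d ne
    ... | dc , m = ≤-trans (up-down n (rank-⋖ cz r) x≤c (≤-trans (proj₁ cz) z≤w) u dc) (proj₁ m)

    down-down : ∀ n {x z} → rank z ≡ n → x ≤ z → z ≤ w → σ x ⋖ x → σ z ⋖ z → σ x ≤ σ z
    down-down zero r _ _ _ d = ⊥-elim (ℕₚ.1+n≢0 (trans (sym (proj₂ d)) r))
    down-down (suc n) {x} {z} r x≤z z≤w dx d with x ≟ z
    ... | yes refl = ≤-refl
    ... | no x≢z with graded (suc n) r x≤z x≢z
    ... | c , x≤c , cz with c ≟ σ z
    ... | yes refl = ≤-trans (proj₁ dx) x≤c
    ... | no ne with coatom-down cz z≤w d ne
    ... | dc , m = ≤-trans (down-down n (rank-⋖ cz r) x≤c (≤-trans (proj₁ cz) z≤w) dx dc) (proj₁ m)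

    up-up : ∀ n {x z} → rank z ≤ⁿ n → x ≤ z → z ≤ w → x ⋖ σ x → z ⋖ σ z → σ x ≤ σ z
    up-up n {x} {z} r x≤z z≤w ux uz with x ≟ z
    ... | yes refl = ≤-refl
    ... | no x≢z with graded _ refl x≤z x≢z
    up-up zero r x≤z z≤w ux uz | no _ | c , x≤c , cz =
      ⊥-elim (ℕₚ.1+n≢0 (trans (sym (proj₂ cz)) (ℕₚ.n≤0⇒n≡0 r)))
    up-up (suc n) {x} {z} r x≤z z≤w ux uz | no _ | c , x≤c , cz with updown (≤-trans (proj₁ cz) z≤w)
    ... | inj₁ uc = ≤-trans (up-up n (s≤s⁻¹ (subst (_≤ⁿ suc n) (proj₂ cz) r)) x≤c c≤w ux uc)
                      (mono cz z≤w λ { refl → ⋖-asym uz (subst (_⋖ z) (sym (invol c≤w)) cz) })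
      where c≤w = ≤-trans (proj₁ cz) z≤w
    ... | inj₂ dc = ≤-trans (subst (σ x ≤_) (invol c≤w)
                      (up-up n (ℕₚ.≤-trans (rank-mono (proj₁ dc)) (s≤s⁻¹ (subst (_≤ⁿ suc n) (proj₂ cz) r)))
                        (up-down _ refl x≤c c≤w ux dc) (stays c≤w) ux (up-image c≤w dc)))
                      (≤-trans (proj₁ cz) (proj₁ uz))
      where c≤w = ≤-trans (proj₁ cz) z≤w

    special : Special w σ
    special = record
      { stays = stays ; invol = invol ; updown = updown
      ; up-up = λ x≤y → up-up _ ℕₚ.≤-refl x≤y
      ; down-down = λ x≤y → down-down _ refl x≤y
      ; up-down = λ x≤y → up-down _ refl x≤y }

-- Orbits of two special matchings

module TwoMatchings {X : Set} (D : Diamond X) (w : Diamond.E D) (op : Bool → Diamond.E D → Diamond.E D)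
  (sp : ∀ c → Covers.Special (Diamond._≤_ D) (Diamond.rank D) w (op c)) where
  open import Data.Nat using (_+_)
  open Diamond D
  open Theory D
  module O (c : Bool) = Sp (sp c)

  -- The element of height h above u whose outermost letter is c.
  e : E → Bool → ℕ → E
  e u c zero    = u
  e u c (suc h) = op c (e u (not c) h)

  e-not : ∀ u c h → e u (not c) (suc h) ≡ op (not c) (e u c h)
  e-not u c h = cong (λ d → op (not c) (e u d h)) (not-involutive c)

  Bottom : E → Set
  Bottom u = u ≤ w × (∀ c → u ⋖ op c u)

  Distinct : E → ℕ → Set
  Distinct u k = ∀ {h} → 1 ≤ⁿ h → h < k → ∀ c → e u c h ≢ e u (not c) h

  -- The orbit is a polygon with `k + k` vertices: two chains from `u` that meet again only at
  -- height `k`. For `k = 1` the two matchings agree on it.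
  record Size (u : E) (k : ℕ) : Set where
    field
      bottom   : Bottom u
      positive : 1 ≤ⁿ k
      top      : ∀ c d → e u c k ≡ e u d k
      distinct : Distinct u k

  e≤w : ∀ {u} → Bottom u → ∀ c h → e u c h ≤ w
  e≤w b c zero    = proj₁ b
  e≤w b c (suc h) = O.stays c (e≤w b (not c) h)

  op-e : ∀ {u} → Bottom u → ∀ c h → op c (e u c (suc h)) ≡ e u (not c) h
  op-e b c h = O.invol c (e≤w b (not c) h)

  climb : ∀ {u k} → Bottom u → Distinct u k → ∀ h → h < k → ∀ c →
    (e u (not c) h ⋖ e u c (suc h)) × (e u c h ⋖ e u c (suc h))
  climb b ds zero h<k c = proj₂ b c , proj₂ b c
  climb {u} b ds (suc h) h<k c = y-up , x⋖
    where
    h<k′ = ℕₚ.<-trans (ℕₚ.n<1+n h) h<k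
    IH = climb b ds h h<k′ c
    IH′ = climb b ds h h<k′ (not c)
    y = e u (not c) (suc h)
    y≤w = e≤w b (not c) (suc h)
    z⋖y : e u (not c) h ⋖ y
    z⋖y = proj₂ IH′
    y-up : y ⋖ op c y
    y-up = O.up-⋖ c z⋖y y≤w (proj₁ IH) (ds (s≤s z≤n) h<k c)
    x⋖ : e u c (suc h) ⋖ op c y
    x⋖ = O.up-up-⋖ c z⋖y y≤w (proj₁ IH) y-up

  rank-e : ∀ {u k} → Bottom u → Distinct u k → ∀ h → h ≤ⁿ k → ∀ c → rank (e u c h) ≡ h + rank u
  rank-e b ds zero    _   c = refl
  rank-e b ds (suc h) h≤k c = trans (proj₂ (proj₁ (climb b ds h h≤k c))) (cong suc (rank-e b ds h (ℕₚ.<⇒≤ h≤k) (not c)))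

  size : ∀ {u} → Bottom u → ∃[ k ] Size u k
  size {u} b = go (rank w) 1 (s≤s z≤n) (λ { (s≤s _) (s≤s ()) }) (s≤s (ℕₚ.m≤m+n _ _))
    where
    go : ∀ fuel h → 1 ≤ⁿ h → Distinct u h → rank w < h + (fuel + rank u) → ∃[ k ] Size u k
    go fuel h 1≤h ds lt with e u true h ≟ e u false h
    go fuel h 1≤h ds lt | yes eq = h , record { bottom = b ; positive = 1≤h ; top = tp ; distinct = ds }
      where
      tp : ∀ c d → e u c h ≡ e u d h
      tp true true = refl
      tp true false = eq
      tp false true = sym eq
      tp false false = refl
    go zero h 1≤h ds lt | no _ = ⊥-elim (ℕₚ.<⇒≱ lt (subst (_≤ⁿ rank w) (rank-e b ds h ℕₚ.≤-refl true) (rank-mono (e≤w b true h))))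
    go (suc fuel) h 1≤h ds lt | no ne = go fuel (suc h) (s≤s z≤n) ds′ (subst (rank w <_) (ℕₚ.+-suc h _) lt)
      where
      ne′ : ∀ c → e u c h ≢ e u (not c) h
      ne′ true = ne
      ne′ false = ne ∘ sym
      ds′ : Distinct u (suc h)
      ds′ {j} 1≤j (s≤s j≤h) with ℕₚ.m≤n⇒m<n∨m≡n j≤h
      ... | inj₁ j<h  = ds 1≤j j<h
      ... | inj₂ refl = ne′

  module Sz {u k} (s : Size u k) where
    open Size s public
    up : ∀ {h} → h < k → ∀ c → e u (not c) h ⋖ e u c (suc h)
    up {h} h<k c = proj₁ (climb bottom distinct h h<k c)
    up′ : ∀ {h} → h < k → ∀ c → e u c h ⋖ e u c (suc h)
    up′ {h} h<k c = proj₂ (climb bottom distinct h h<k c)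
    up-not : ∀ {h} → h < k → ∀ c → e u c h ⋖ op (not c) (e u c h)
    up-not {h} h<k c = subst (λ d → e u d h ⋖ op (not c) (e u d h)) (not-involutive c) (up h<k (not c))
    in-w : ∀ c h → e u c h ≤ w
    in-w = e≤w bottom
    op-down : ∀ c h → op c (e u c (suc h)) ≡ e u (not c) h
    op-down = op-e bottom
    down : ∀ {h} → h < k → ∀ c → op c (e u c (suc h)) ⋖ e u c (suc h)
    down {h} h<k c = subst (_⋖ e u c (suc h)) (sym (op-down c h)) (up h<k c)
    rank-at : ∀ {h} → h ≤ⁿ k → ∀ c → rank (e u c h) ≡ h + rank u
    rank-at {h} h≤k c = rank-e bottom distinct h h≤k c

  record At (u : E) (k : ℕ) (c : Bool) (h : ℕ) (x : E) : Set where
    constructor at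
    field
      is-size : Size u k
      h≤k     : h ≤ⁿ k
      is-e    : x ≡ e u c h

  At-≤ : ∀ {u k c h x} → At u k c h x → x ≤ w
  At-≤ {c = c} {h} (at s _ refl) = Sz.in-w s c h

  down-type : ∀ {u k c h x} d → At u k c h x → op d x ⋖ x → ∃[ j ] (h ≡ suc j × x ≡ e u d h)
  down-type {h = zero} d (at s _ refl) dn = ⊥-elim (⋖-asym dn (proj₂ (Size.bottom s) d))
  down-type {u} {k} {c} {suc j} d (at s h≤k refl) dn with c Boolₚ.≟ d
  ... | yes refl = j , refl , refl
  ... | no c≢d with ℕₚ.m≤n⇒m<n∨m≡n h≤k
  ...   | inj₂ refl = j , refl , Size.top s c d
  ...   | inj₁ lt = ⊥-elim (⋖-asym dn (subst (λ d → e u c (suc j) ⋖ op d (e u c (suc j))) (Boolₚ.¬-not (c≢d ∘ sym) ⟨not⟩) (Sz.up-not s lt c)))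
    where _⟨not⟩ : d ≡ not c → not c ≡ d
          p ⟨not⟩ = sym p

  At-op : ∀ {u k c h x} → At u k c h x → ∀ d → ∃[ c′ ] ∃[ h′ ] At u k c′ h′ (op d x)
  At-op {u} {k} {c} {h} (at s h≤k refl) d with O.updown d (Sz.in-w s c h)
  ... | inj₂ dn with down-type d (at s h≤k refl) dn
  ...   | j , refl , eq = not d , j , at s (ℕₚ.<⇒≤ h≤k) (trans (cong (op d) eq) (Sz.op-down s d j))
  At-op {u} {k} {c} {zero} (at s h≤k refl) d | inj₁ up = d , 1 , at s (Size.positive s) refl
  At-op {u} {k} {c} {suc j} (at s h≤k refl) d | inj₁ up with c Boolₚ.≟ d
  ... | yes refl = ⊥-elim (⋖-asym up (Sz.down s h≤k c))
  ... | no c≢d with ℕₚ.m≤n⇒m<n∨m≡n h≤k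
  ...   | inj₂ refl = ⊥-elim (⋖-asym up (subst (λ x → op d x ⋖ x) (Size.top s d c) (Sz.down s ℕₚ.≤-refl d)))
  ...   | inj₁ lt = d , suc (suc j) , at s lt (cong (λ b → op d (e u b (suc j))) (Boolₚ.¬-not c≢d))

  orbit : ∀ n {x} → rank x ≡ n → x ≤ w → ∃[ u ] ∃[ k ] ∃[ c ] ∃[ h ] At u k c h x
  orbit n {x} r x≤w with O.updown true x≤w | O.updown false x≤w
  ... | inj₁ a | inj₁ b = x , proj₁ sz , true , 0 , at (proj₂ sz) z≤n refl
    where
    sz = size {x} (x≤w , λ { true → a ; false → b })
  orbit zero r x≤w | inj₂ d | _ = ⊥-elim (ℕₚ.1+n≢0 (trans (sym (proj₂ d)) r))
  orbit zero r x≤w | inj₁ _ | inj₂ d = ⊥-elim (ℕₚ.1+n≢0 (trans (sym (proj₂ d)) r))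
  orbit (suc n) {x} r x≤w | inj₂ d | _ with orbit n (rank-⋖ d r) (O.stays true x≤w)
  ... | u , k , c , h , p with At-op p true
  ... | c′ , h′ , q = u , k , c′ , h′ , subst (At u k c′ h′) (O.invol true x≤w) q
  orbit (suc n) {x} r x≤w | inj₁ _ | inj₂ d with orbit n (rank-⋖ d r) (O.stays false x≤w)
  ... | u , k , c , h , p with At-op p false
  ... | c′ , h′ , q = u , k , c′ , h′ , subst (At u k c′ h′) (O.invol false x≤w) q

  bottom-unique : ∀ h {u k c x u′ k′ c′ h′} → At u k c h x → At u′ k′ c′ h′ x → u ≡ u′
  bottom-unique zero {h′ = zero} (at _ _ p) (at _ _ q) = trans (sym p) q
  bottom-unique zero {h′ = suc j} (at s _ refl) (at s′ lt q) = ⊥-elim (⋖-asym (subst (λ x → op _ x ⋖ x) (sym q) (Sz.down s′ lt _)) (proj₂ (Size.bottom s) _))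
  bottom-unique (suc j) {c = c} (at s lt refl) p′ with down-type c p′ (Sz.down s lt c)
  bottom-unique (suc j) {c = c} (at s lt refl) (at s′ lt′ q) | j′ , refl , eq =
    bottom-unique j (at s (ℕₚ.<⇒≤ lt) (Sz.op-down s c j)) (at s′ (ℕₚ.<⇒≤ lt′) (trans (cong (op c) eq) (Sz.op-down s′ c j′)))

  size-unique : ∀ {u k k′} → Size u k → Size u k′ → k ≡ k′
  size-unique {u} {k} {k′} s s′ with ℕₚ.<-cmp k k′
  ... | tri≈ _ eq _ = eq
  ... | tri< lt _ _ = ⊥-elim (Size.distinct s′ (Size.positive s) lt true (Size.top s true false))
  ... | tri> _ _ gt = ⊥-elim (Size.distinct s (Size.positive s′) gt true (Size.top s′ true false))

  e-distinct : ∀ {u k v j c d h g} → Size u k → Size v j → u ≢ v → h ≤ⁿ k → g ≤ⁿ j → e u c h ≢ e v d g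
  e-distinct s t ne h≤k g≤j eq = ne (bottom-unique _ (at s h≤k refl) (at t g≤j eq))

  parallel : ∀ {v j u k} → Size v j → Size u k → v ⋖ u → ∀ h → h ≤ⁿ j → h ≤ⁿ k → ∀ c → e v c h ⋖ e u c h
  parallel s t c zero _ _ d = c
  parallel s t c (suc h) h<j h<k d = O.up-up-⋖ d (parallel s t c h (ℕₚ.<⇒≤ h<j) (ℕₚ.<⇒≤ h<k) (not d))
    (Sz.in-w t (not d) h) (Sz.up s h<j d) (Sz.up t h<k d)

  -- If `1 < j < k`, both elements of height `j` over `u` cover three elements: the two of height
  -- `j - 1` over `u` and the top of the orbit of `v`, against `no-K32`. If `j > k`, three elements
  -- lie between one of height `k - 1` over `v` and the top of the orbit of `u`, against thinness.
  size-step : ∀ {v j u k} → Size v j → Size u k → v ⋖ u → (j ≡ 1) ⊎ (j ≡ k)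
  size-step {v} {zero} s t c with Size.positive s
  ... | ()
  size-step {v} {suc zero} s t c = inj₁ refl
  size-step {v} {suc (suc j)} {u} {k} s t c with ℕₚ.<-cmp (suc (suc j)) k
  ... | tri≈ _ eq _ = inj₂ eq
  ... | tri< lt _ _ = ⊥-elim (no-K32 (Size.distinct t (s≤s z≤n) lt true)
          (Size.distinct t (s≤s z≤n) lt′ true) (e-distinct t s u≢v (ℕₚ.<⇒≤ lt′) ℕₚ.≤-refl)
          (e-distinct t s u≢v (ℕₚ.<⇒≤ lt′) ℕₚ.≤-refl)
          (Sz.up′ t lt′ true) (Sz.up t lt′ true) (parallel s t c _ ℕₚ.≤-refl (ℕₚ.<⇒≤ lt) true)
          (Sz.up t lt′ false) (Sz.up′ t lt′ false)
          (subst (_⋖ e u false (suc (suc j))) (Size.top s false true) (parallel s t c _ ℕₚ.≤-refl (ℕₚ.<⇒≤ lt) false)))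
    where
    lt′ = ℕₚ.<⇒≤ lt
    u≢v = ⋖-irrefl c ∘ sym
  size-step {v} {suc (suc j)} {u} {zero} s t c | tri> _ _ gt with Size.positive t
  ... | ()
  size-step {v} {suc (suc j)} {u} {suc k} s t c | tri> _ _ gt = ⊥-elim (thin-third
          (Size.distinct s (s≤s z≤n) gt true) (e-distinct s t v≢u (ℕₚ.<⇒≤ gt) (ℕₚ.n≤1+n k))
          (e-distinct s t v≢u (ℕₚ.<⇒≤ gt) (ℕₚ.n≤1+n k))
          (Sz.up′ s (ℕₚ.<⇒≤ gt) true) (parallel s t c (suc k) (ℕₚ.<⇒≤ gt) ℕₚ.≤-refl true)
          (Sz.up s (ℕₚ.<⇒≤ gt) false)
          (subst (e v false (suc k) ⋖_) (Size.top t false true) (parallel s t c (suc k) (ℕₚ.<⇒≤ gt) ℕₚ.≤-refl false))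
          (parallel s t c k (ℕₚ.<⇒≤ (ℕₚ.<⇒≤ gt)) (ℕₚ.n≤1+n k) true) (Sz.up′ t ℕₚ.≤-refl true))
    where
    v≢u = ⋖-irrefl c

  -- The common outermost letter lowers both ends of the cover, then the other letter does, and so
  -- on until the upper end is its bottom `u′`. The height left over at the lower end is `f`.
  shift : ∀ {u k u′ k′} → Size u k → Size u′ k′ → u ≢ u′ → ∀ b a c → a ≤ⁿ k → b ≤ⁿ k′ →
    e u c a ⋖ e u′ c b → ∃[ d ] ∃[ f ] (a ≡ b + f × e u d f ⋖ u′)
  shift s t ne zero a c a≤k b≤k′ cv = c , a , refl , cv
  shift s t ne (suc b) zero c a≤k b≤k′ cv = ⊥-elim (ne (bottom-unique 0 (at {c = c} s z≤n refl) (at {c = not c} {b} t (ℕₚ.<⇒≤ b≤k′)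
    (trans (O.up-down-⋖ c cv (Sz.in-w t c (suc b)) (proj₂ (Size.bottom s) c) (Sz.down t b≤k′ c)) (Sz.op-down t c b)))))
  shift {u} {k} {u′} {k′} s t ne (suc b) (suc a) c a≤k b≤k′ cv
    with shift s t ne b a (not c) (ℕₚ.<⇒≤ a≤k) (ℕₚ.<⇒≤ b≤k′)
      (subst₂ _⋖_ (Sz.op-down s c a) (Sz.op-down t c b)
        (O.down-down-⋖ c cv (Sz.in-w t c (suc b)) (Sz.down s a≤k c) (Sz.down t b≤k′ c)))
  ... | d , f , refl , r = d , f , refl , r

  -- Between orbits of different sizes k ≠ k′ the only covers into a bottom
  -- start at the top or at both elements just below the top.
  close : ∀ {u k u′ k′ c h} → Size u k → Size u′ k′ → u ≢ u′ → 1 ≤ⁿ h → h < k →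
    e u c h ⋖ u′ → e u (not c) h ⋖ u′ → suc h ≡ k
  close {u} {k} {u′} {k′} {c} {h} s t ne 1≤h h<k p q with ℕₚ.m≤n⇒m<n∨m≡n h<k
  ... | inj₂ eq = eq
  ... | inj₁ lt = ⊥-elim (no-K23 (Size.distinct s 1≤h h<k c) (Size.distinct s (s≤s z≤n) lt c)
          (e-distinct {d = c} s t ne (ℕₚ.<⇒≤ lt) z≤n) (e-distinct {d = c} s t ne (ℕₚ.<⇒≤ lt) z≤n)
          (Sz.up′ s h<k c) (subst (e u c h ⋖_) (sym (e-not u c h)) (Sz.up-not s h<k c)) p
          (Sz.up s h<k c) (Sz.up′ s h<k (not c)) q)

  -- Let `z` be an element of the orbit just below the given one, and `y` the other element between
  -- `z` and `u′`. If `y` is in the same orbit, `close` applies. If not, the covers from `z` to `y`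
  -- and from `y` to `u′` join different orbits; after `shift` their lower ends have smaller height,
  -- and `size-step` or the induction hypothesis excludes them. The bound on the height is `n`.
  covers-bottom : ∀ n h → h ≤ⁿ n → ∀ {u k u′ k′ c} → Size u k → Size u′ k′ → k ≢ k′ → 1 ≤ⁿ h → h < k →
    e u c h ⋖ u′ → suc h ≡ k × (e u (not c) h ⋖ u′)
  covers-bottom n (suc h) h≤n {u} {k} {u′} {k′} {c} s t k≢k′ _ h<k x⋖
    with thin-other (Sz.up s (ℕₚ.<⇒≤ h<k) c) x⋖
  ... | y , y≢x , z⋖y , y⋖ with y ≟ e u (not c) (suc h)
  ... | yes refl = close s t u≢u′ (s≤s z≤n) h<k x⋖ y⋖ , y⋖
    where
    u≢u′ : u ≢ u′
    u≢u′ refl = k≢k′ (size-unique s t)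
  ... | no y≢x* = ⊥-elim (rest n h (s≤s⁻¹ (ℕₚ.≤-trans h≤n (ℕₚ.n≤1+n n))) h≤n h<k y≢x z⋖y y≢x*)
    where
    y≤w : y ≤ w
    y≤w = ≤-trans (proj₁ y⋖) (Sz.in-w t true 0)
    rest : ∀ n h → h ≤ⁿ n → suc h ≤ⁿ n → suc h < k → y ≢ e u c (suc h) → e u (not c) h ⋖ y → y ≢ e u (not c) (suc h) → ⊥
    rest n zero _ _ h<k y≢x z⋖y y≢x* with size {y} (y≤w , up)
      where
      up : ∀ d → y ⋖ op d y
      up d = O.up-⋖ d z⋖y y≤w (proj₂ (Size.bottom s) d) (ne d)
        where
        ne : ∀ d → op d u ≢ y
        ne d eq with d Boolₚ.≟ c
        ... | yes refl = y≢x (sym eq)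
        ... | no d≢c = y≢x* (trans (sym eq) (cong (λ b → op b u) (Boolₚ.¬-not d≢c)))
    ... | j , sy with size-step s sy z⋖y
    ...   | inj₁ refl = ℕₚ.<-irrefl refl h<k
    ...   | inj₂ refl with size-step sy t y⋖
    ...     | inj₁ refl = ℕₚ.<-irrefl refl h<k
    ...     | inj₂ eq = k≢k′ eq
    rest (suc n) (suc g) _ (s≤s h≤n) h<k y≢x z⋖y y≢x* = case-y (O.updown (not c) y≤w)
      where
      g₁ = suc g
      h<k′ : g₁ < k
      h<k′ = ℕₚ.<⇒≤ h<k
      IH : ∀ {v l v′ l′ d} f → f ≤ⁿ g₁ → Size v l → Size v′ l′ → l ≢ l′ → 1 ≤ⁿ f → f < l → e v d f ⋖ v′ → suc f ≡ l
      IH f f≤h s t ne 1≤f f<l cv = proj₁ (covers-bottom n f (ℕₚ.≤-trans f≤h h≤n) s t ne 1≤f f<l cv)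
      c-up : y ⋖ op c y
      c-up = O.up-⋖ c z⋖y y≤w (Sz.up s h<k′ c) (y≢x ∘ sym)
      case-y : (y ⋖ op (not c) y) ⊎ (op (not c) y ⋖ y) → ⊥
      case-y (inj₁ nc-up) with size {y} (y≤w , up)
        where
        up : ∀ d → y ⋖ op d y
        up d with d Boolₚ.≟ c
        ... | yes refl = c-up
        ... | no d≢c = subst (λ b → y ⋖ op b y) (sym (Boolₚ.¬-not d≢c)) nc-up
      ... | j , sy with k ℕ.≟ j
      ...   | no k≢j = ℕₚ.<⇒≢ h<k (IH g₁ ℕₚ.≤-refl s sy k≢j (s≤s z≤n) h<k′ z⋖y)
      ...   | yes refl with size-step sy t y⋖
      ...     | inj₁ refl = ℕₚ.<-irrefl refl (ℕₚ.≤-trans (s≤s (s≤s z≤n)) h<k)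
      ...     | inj₂ eq = k≢k′ eq
      case-y (inj₂ nc-down) with orbit _ refl y≤w
      ... | v , l , d , b , p with down-type (not c) p nc-down
      case-y (inj₂ nc-down) | v , l , d , suc b , at sv b≤l _ | _ , refl , refl with u ≟ v
      ... | yes refl = y≢x* (cong (e u (not c)) (ℕₚ.+-cancelʳ-≡ (rank u) (suc b) (suc g₁)
              (trans (sym (Sz.rank-at sv b≤l (not c))) (trans (proj₂ z⋖y) (cong suc (Sz.rank-at s (ℕₚ.<⇒≤ h<k′) (not c)))))))
      ... | no u≢v with shift s sv u≢v (suc b) g₁ (not c) (ℕₚ.<⇒≤ h<k′) b≤l z⋖y
      ... | d′ , zero , eq , cv with size-step s sv cv
      ...   | inj₁ refl = ℕₚ.<-irrefl refl (ℕₚ.≤-trans (s≤s (s≤s z≤n)) h<k)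
      ...   | inj₂ refl = ℕₚ.<⇒≢ h<k (trans (cong suc eq′) (IH (suc b) (ℕₚ.≤-reflexive (sym eq′)) sv t k≢k′ (s≤s z≤n) (subst (_< k) eq′ h<k′) y⋖))
        where
        eq′ : g₁ ≡ suc b
        eq′ = trans eq (ℕₚ.+-identityʳ _)
      case-y (inj₂ nc-down) | v , l , d , suc b , at sv b≤l _ | _ , refl , refl | no u≢v | d′ , suc f , eq , cv with k ℕ.≟ l
      ... | no k≢l = ℕₚ.<⇒≢ (ℕₚ.≤-trans (s≤s (s≤s f≤h)) h<k) (IH (suc f) f≤h s sv k≢l (s≤s z≤n) (ℕₚ.≤-trans (s≤s f≤h) h<k′) cv)
        where
        f≤h : suc f ≤ⁿ g₁
        f≤h = subst (suc f ≤ⁿ_) (sym eq) (ℕₚ.m≤n+m (suc f) (suc b))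
      ... | yes refl = ℕₚ.<⇒≢ (ℕₚ.≤-trans (s≤s (s≤s b≤h)) h<k) (IH (suc b) b≤h sv t k≢k′ (s≤s z≤n) (ℕₚ.≤-trans (s≤s b≤h) h<k′) y⋖)
        where
        b≤h : suc b ≤ⁿ g₁
        b≤h = subst (suc b ≤ⁿ_) (sym eq) (ℕₚ.m≤m+n (suc b) (suc f))

-- The mixed matching

module Mixed {X : Set} (D : Diamond X) (w : Diamond.E D) (op : Bool → Diamond.E D → Diamond.E D)
  (sp : ∀ c → Covers.Special (Diamond._≤_ D) (Diamond.rank D) w (op c)) (m : ℕ) where
  open import Data.Nat using (_+_)
  open Diamond D
  open Theory D
  open TwoMatchings D w op sp

  letter : E → Bool
  letter x with x ≤? w
  -- An arbitrary value: only elements below `w` have an orbit.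
  ... | no _  = true
  ... | yes p = ⌊ proj₁ (proj₂ (orbit _ refl p)) ℕ.≟ m ⌋

  At-size : ∀ {u k c h x u′ k′ c′ h′} → At u k c h x → At u′ k′ c′ h′ x → k ≡ k′
  At-size p q with bottom-unique _ p q
  ... | refl = size-unique (At.is-size p) (At.is-size q)

  letter-At : ∀ {u k c h x} → At u k c h x → letter x ≡ ⌊ k ℕ.≟ m ⌋
  letter-At {x = x} p with x ≤? w
  ... | no x≰w  = ⊥-elim (x≰w (At-≤ p))
  ... | yes x≤w = cong (λ k → ⌊ k ℕ.≟ m ⌋)
          (At-size (proj₂ (proj₂ (proj₂ (proj₂ (orbit _ refl x≤w))))) p)

  mixed : E → E
  mixed x = op (letter x) x

  letter-op : ∀ {x} → x ≤ w → ∀ d → letter (op d x) ≡ letter x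
  letter-op x≤w d with orbit _ refl x≤w
  ... | _ , _ , _ , _ , p with At-op p d
  ... | _ , _ , q = trans (letter-At q) (sym (letter-At p))

  -- The one case of monotonicity not inherited from either matching: the ends of a cover follow
  -- different letters. No letter matches `x` with `y`, since their orbits differ. In the remaining
  -- cases the cover is brought to a bottom by `shift`; there either the lower orbit has size 1,
  -- where the letters agree, or both elements just below its top lie under `u′`, so that the
  -- letters can be exchanged.
  cross : ∀ {u k c h x u′ k′ c′ h′ y} → At u k c h x → At u′ k′ c′ h′ y → k ≢ k′ → x ⋖ y →
    ∀ A → op A x ≤ op (not A) y
  cross {u} {k} {_} {_} {x} {u′} {k′} {_} {_} {y} p p′ k≢k′ x⋖y A =
      go (O.updown A (At-≤ p)) (O.updown B (At-≤ p)) (O.updown A (At-≤ p′)) (O.updown B (At-≤ p′))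
    where
    B = not A
    s = At.is-size p
    t = At.is-size p′
    y≤w = At-≤ p′
    u≢u′ : u ≢ u′
    u≢u′ refl = k≢k′ (size-unique s t)
    ne : ∀ d → op d x ≢ y
    ne d refl with At-op p d
    ... | _ , _ , q = u≢u′ (bottom-unique _ q p′)
    bottom-of : ∀ {u k c h x} → At u k c h x → x ⋖ op A x → x ⋖ op B x → x ≡ u
    bottom-of {h = zero} (at _ _ refl) _ _ = refl
    bottom-of {c = c} {suc h} (at s h<k refl) a b with c Boolₚ.≟ A
    ... | yes refl = ⊥-elim (⋖-asym a (Sz.down s h<k c))
    ... | no c≢A   = ⊥-elim (⋖-asym (subst (λ d → _ ⋖ op d _) (sym (Boolₚ.¬-not c≢A)) b) (Sz.down s h<k c))
    not-top : ∀ {u k} (s : Size u k) {a} → suc a ≤ⁿ k → e u B (suc a) ⋖ op A (e u B (suc a)) → suc a < k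
    not-top {u} s {a} le up with ℕₚ.m≤n⇒m<n∨m≡n le
    ... | inj₁ lt   = lt
    ... | inj₂ refl = ⊥-elim (⋖-asym up (subst (λ z → op A z ⋖ z) (Size.top s A B) (Sz.down s le A)))
    go : (x ⋖ op A x) ⊎ (op A x ⋖ x) → (x ⋖ op B x) ⊎ (op B x ⋖ x) →
         (y ⋖ op A y) ⊎ (op A y ⋖ y) → (y ⋖ op B y) ⊎ (op B y ⋖ y) → op A x ≤ op B y
    go (inj₂ d) _ _ (inj₁ u) = ≤-trans (proj₁ d) (≤-trans (proj₁ x⋖y) (proj₁ u))
    go _ (inj₁ xB) _ (inj₂ d) = ⊥-elim (ne B (trans (cong (op B) (O.up-down-⋖ B x⋖y y≤w xB d)) (O.invol B y≤w)))
    go (inj₁ xA) _ (inj₂ d) _ = ⊥-elim (ne A (trans (cong (op A) (O.up-down-⋖ A x⋖y y≤w xA d)) (O.invol A y≤w)))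
    go (inj₂ xA) (inj₂ xB) _ (inj₂ yB) with down-type A p xA | down-type B p xB | down-type B p′ yB
    ... | a , refl , eqA | _ , refl , eqB | b , refl , eqy
      with shift s t u≢u′ (suc b) (suc a) B (At.h≤k p) (At.h≤k p′) (subst₂ _⋖_ eqB eqy x⋖y)
    ... | d , f , eq , cv = finish f eq cv
      where
      k≡ : suc a ≡ k
      k≡ with ℕₚ.m≤n⇒m<n∨m≡n (At.h≤k p)
      ... | inj₂ eq = eq
      ... | inj₁ lt = ⊥-elim (Size.distinct s (s≤s z≤n) lt A (trans (sym eqA) eqB))
      Ax : op A x ≡ e u B a
      Ax = trans (cong (op A) eqA) (Sz.op-down s A a)
      By : ∀ {j} → b ≡ j → op B y ≡ e u′ (not B) j
      By refl = trans (cong (op B) eqy) (Sz.op-down t B b)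
      finish : ∀ f → suc a ≡ suc b + f → e u d f ⋖ u′ → op A x ≤ op B y
      finish zero eq cv with size-step s t cv
      ... | inj₂ k≡k′ = ⊥-elim (k≢k′ k≡k′)
      ... | inj₁ k≡1 with trans k≡ k≡1
      ...   | refl = subst₂ _≤_ (sym Ax) (sym (By (sym (trans (ℕₚ.suc-injective eq) (ℕₚ.+-identityʳ b))))) (proj₁ cv)
      finish (suc f) eq cv with covers-bottom _ (suc f) ℕₚ.≤-refl s t k≢k′ (s≤s z≤n)
                              (subst (suc f <_) k≡ (subst (suc f <_) (sym eq) (s≤s (ℕₚ.m≤n+m (suc f) b)))) cv
      ... | eq′ , cv′ = subst₂ _≤_ (sym (trans Ax (cong (e u B) (sym f≡a)))) (sym (By b≡0)) (pick B)
        where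
        f≡a : suc f ≡ a
        f≡a = ℕₚ.suc-injective (trans eq′ (sym k≡))
        b≡0 : b ≡ 0
        b≡0 = ℕₚ.+-cancelʳ-≡ (suc f) b 0 (trans (sym (ℕₚ.suc-injective eq)) (sym f≡a))
        pick : ∀ c → e u c (suc f) ≤ u′
        pick c with c Boolₚ.≟ d
        ... | yes refl = proj₁ cv
        ... | no c≢d = subst (λ c → e u c (suc f) ≤ u′) (sym (Boolₚ.¬-not c≢d)) (proj₁ cv′)
    go (inj₁ xA) (inj₂ xB) (inj₁ yA) (inj₂ yB) with down-type B p xB | down-type B p′ yB
    ... | a , refl , refl | b , refl , refl
      with shift s t u≢u′ (suc b) (suc a) B (At.h≤k p) (At.h≤k p′) x⋖y
    ... | d , zero , eq , cv with size-step s t cv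
    ...   | inj₂ k≡k′ = ⊥-elim (k≢k′ k≡k′)
    ...   | inj₁ refl = ⊥-elim (ℕₚ.<⇒≱ (not-top s (At.h≤k p) xA) (s≤s z≤n))
    go (inj₁ xA) (inj₂ xB) (inj₁ yA) (inj₂ yB) | a , refl , refl | b , refl , refl | d , suc f , eq , cv
      with not-top s (At.h≤k p) xA
    ... | lt with covers-bottom _ (suc f) ℕₚ.≤-refl s t k≢k′ (s≤s z≤n)
                    (ℕₚ.≤-trans (s≤s (ℕₚ.m≤n+m (suc f) (suc b))) (subst (λ z → suc z ≤ⁿ k) eq lt)) cv
    ...   | eq′ , _ = ⊥-elim (ℕₚ.<⇒≢ (ℕₚ.≤-trans (s≤s (s≤s (ℕₚ.m≤n+m (suc f) b))) (subst (λ z → suc z ≤ⁿ k) eq lt)) eq′)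
    go (inj₁ xA) (inj₁ xB) _ (inj₁ yB) with bottom-of p xA xB | bottom-of p′ (O.up-⋖ A x⋖y y≤w xA (ne A)) yB
    ... | refl | refl with size-step s t x⋖y
    ...   | inj₂ k≡k′ = ⊥-elim (k≢k′ k≡k′)
    ...   | inj₁ refl = subst (_≤ op B y) (Size.top s B A) (O.up-up B (proj₁ x⋖y) y≤w xB yB)
    go (inj₁ xA) (inj₂ xB) (inj₁ yA) (inj₁ yB) with down-type B p xB | bottom-of p′ yA yB
    ... | a , refl , refl | refl with not-top s (At.h≤k p) xA
    ...   | lt with covers-bottom _ (suc a) ℕₚ.≤-refl s t k≢k′ (s≤s z≤n) lt x⋖y
    ...     | refl , cv = subst (_≤ op B u′) (Size.top s B A) (O.up-up B (proj₁ cv) y≤w (Sz.up s lt B) yB)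

  -- The matching that follows op true on the orbits of size m and op false elsewhere.
  mixed-special : Special w mixed
  mixed-special = FromCovers.special w mixed
    (λ {x} x≤w → O.stays (letter x) x≤w)
    (λ {x} x≤w → trans (cong (λ c → op c (op (letter x) x)) (letter-op x≤w (letter x))) (O.invol (letter x) x≤w))
    (λ {x} x≤w → O.updown (letter x) x≤w)
    mono
    where
    mono : ∀ {x y} → x ⋖ y → y ≤ w → mixed x ≢ y → mixed x ≤ mixed y
    mono {x} {y} x⋖y y≤w ne with letter x Boolₚ.≟ letter y
    ... | yes eq = subst (λ c → mixed x ≤ op c y) eq (O.cover-mono (letter x) x⋖y y≤w ne)
    ... | no l≢l with orbit _ refl (≤-trans (proj₁ x⋖y) y≤w) | orbit _ refl y≤w
    ...   | _ , _ , _ , _ , p | _ , _ , _ , _ , p′ =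
      subst (λ c → mixed x ≤ op c y) (sym (Boolₚ.¬-not (l≢l ∘ sym)))
        (cross p p′ (λ { refl → l≢l (trans (letter-At p) (sym (letter-At p′))) }) x⋖y (letter x))

-- R-polynomials of a poset and their independence of the matching

module RPolynomial {X : Set} (D : Diamond X) {V : Set} (_≈_ : V → V → Set) (≈-equiv : IsEquivalence _≈_)
  (mix : V → V → V) (0# 1# : V)
  (mix-cong : ∀ {a b c d} → a ≈ b → c ≈ d → mix a c ≈ mix b d)
  (medial : ∀ a b c d → mix (mix a b) (mix c d) ≈ mix (mix a c) (mix b d))
  (mix-0 : mix 0# 0# ≈ 0#) where
  open import Data.Nat using (_+_)
  open Diamond D
  open Theory D
  open IsEquivalence ≈-equiv renaming (refl to ≈-refl; sym to ≈-sym; trans to ≈-trans; reflexive to ≈-reflexive)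

  -- One step of the R-recursion, where `y` is the partner of `x`. Testing `y ≤? x` separates
  -- descents from ascents.
  t : (E → V) → E → E → V
  t f x y with y ≤? x
  ... | yes _ = f y
  ... | no  _ = mix (f x) (f y)

  t-down : ∀ f {x y} → y ⋖ x → t f x y ≡ f y
  t-down f {x} {y} d with y ≤? x
  ... | yes _ = refl
  ... | no y≰x = ⊥-elim (y≰x (proj₁ d))

  t-up : ∀ f {x y} → x ⋖ y → t f x y ≡ mix (f x) (f y)
  t-up f {x} {y} u with y ≤? x
  ... | yes y≤x = ⊥-elim (ℕₚ.<⇒≱ (ℕₚ.≤-reflexive (sym (proj₂ u))) (rank-mono y≤x))
  ... | no  _ = refl

  t-cong : ∀ f g x y → f x ≈ g x → f y ≈ g y → t f x y ≈ t g x y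
  t-cong f g x y p q with y ≤? x
  ... | yes _ = q
  ... | no  _ = mix-cong p q

  t-mix : ∀ f g x y → t (λ z → mix (f z) (g z)) x y ≈ mix (t f x y) (t g x y)
  t-mix f g x y with y ≤? x
  ... | yes _ = ≈-refl
  ... | no  _ = medial _ _ _ _

  -- The action of a matching on functions, dual to that of a standard
  -- generator of the Hecke algebra.
  T : (E → E) → (E → V) → E → V
  T σ f x = t f x (σ x)

  module _ {w σ} (S : Special w σ) where
    T-at-down : ∀ f {x} → x ≤ w → x ⋖ σ x → f x ≡ T σ f (σ x)
    T-at-down f x≤w u = sym (trans (t-down f (Sp.up-image S x≤w u)) (cong f (Special.invol S x≤w)))

    -- The quadratic relation `T² = (q - 1) T + q` of the Hecke algebra.
    T-square : ∀ f {x} → x ≤ w → T σ (T σ f) x ≈ mix (T σ f x) (f x)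
    T-square f {x} x≤w with Special.updown S x≤w
    ... | inj₁ u = ≈-trans (≈-reflexive (t-up _ u)) (mix-cong ≈-refl (≈-reflexive (sym (T-at-down f x≤w u))))
    ... | inj₂ d = ≈-trans (≈-reflexive (t-down _ d)) (≈-trans (≈-reflexive (t-up f (Sp.down-image S x≤w d)))
                     (mix-cong (≈-reflexive (sym (t-down f d))) (≈-reflexive (cong f (Special.invol S x≤w)))))

  σ₀ : ∀ w → 1 ≤ⁿ rank w → E → E
  σ₀ w p = proj₁ (matching w p)

  -- The number is fuel and starts as `rank w`. One matching is chosen for every element;
  -- `calculates` shows that every other one gives the same values.
  Rₙ : ℕ → E → E → V
  Rₙ zero x w with x ≟ w
  ... | yes _ = 1#
  ... | no  _ = 0#
  Rₙ (suc n) x w with 1 ℕ.≤? rank w | x ≤? w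
  ... | yes p | yes _ = T (σ₀ w p) (λ z → Rₙ n z (σ₀ w p w)) x
  ... | yes _ | no _  = 0#
  ... | no _  | _     = 0#

  R : E → E → V
  R x w = Rₙ (rank w) x w

  R-≰ : ∀ {x w} → ¬ x ≤ w → R x w ≡ 0#
  R-≰ {x} {w} = go (rank w)
    where
    go : ∀ n → ¬ x ≤ w → Rₙ n x w ≡ 0#
    go zero ne with x ≟ w
    ... | yes refl = ⊥-elim (ne ≤-refl)
    ... | no _ = refl
    go (suc n) ne with 1 ℕ.≤? rank w | x ≤? w
    ... | yes _ | yes p = ⊥-elim (ne p)
    ... | yes _ | no _  = refl
    ... | no _  | _     = refl

  R-step : ∀ {x w} (p : 1 ≤ⁿ rank w) → x ≤ w → R x w ≡ T (σ₀ w p) (λ z → R z (σ₀ w p w)) x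
  R-step {x} {w} p x≤w = go (rank w) refl
    where
    go : ∀ n → rank w ≡ n → Rₙ n x w ≡ T (σ₀ w p) (λ z → R z (σ₀ w p w)) x
    go zero r = ⊥-elim (ℕₚ.<⇒≱ p (ℕₚ.≤-reflexive r))
    go (suc n) r with 1 ℕ.≤? rank w | x ≤? w
    ... | yes p′ | yes _ with ℕₚ.≤-irrelevant p p′
    ...   | refl = cong (λ k → t (λ z → Rₙ k z (σ₀ w p w)) x (σ₀ w p x)) (sym (rank-⋖ (proj₂ (proj₂ (matching w p))) r))
    go (suc n) r | yes _ | no x≰w = ⊥-elim (x≰w x≤w)
    go (suc n) r | no ¬p | _ = ⊥-elim (¬p p)

  R-refl : ∀ w → R w w ≡ 1#
  R-refl w = go _ refl
    where
    go : ∀ n {w} → rank w ≡ n → R w w ≡ 1#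
    go zero {w} r rewrite r with w ≟ w
    ... | yes _ = refl
    ... | no ne = ⊥-elim (ne refl)
    go (suc n) {w} r = trans (R-step p ≤-refl) (trans (t-down _ d) (go n (rank-⋖ d r)))
      where p = subst (1 ≤ⁿ_) (sym r) (s≤s z≤n)
            d = proj₂ (proj₂ (matching w p))

  Calculates : E → (E → E) → Set
  Calculates w σ = ∀ {x} → x ≤ w → R x w ≈ T σ (λ z → R z (σ w)) x

  module _ {w σ} (S : Special w σ) where
    -- Both sides of the recursion at `v` vanish outside the elements below `v`. It therefore holds
    -- at all points below `w`, as needed when operators of matchings of `w` are composed.
    T-R-≰ : ∀ {v x} → v ≤ w → σ v ⋖ v → x ≤ w → ¬ x ≤ v → T σ (λ z → R z (σ v)) x ≈ 0#
    T-R-≰ {v} {x} v≤w d x≤w x≰v with Special.updown S x≤w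
    ... | inj₁ u = ≈-trans (≈-reflexive (t-up _ u)) (≈-trans (mix-cong
            (≈-reflexive (R-≰ λ q → x≰v (≤-trans q (proj₁ d))))
            (≈-reflexive (R-≰ λ q → x≰v (≤-trans (proj₁ u) (≤-trans q (proj₁ d)))))) mix-0)
    ... | inj₂ dx = ≈-trans (≈-reflexive (t-down _ dx)) (≈-reflexive (R-≰ λ q → x≰v
            (subst₂ _≤_ (Special.invol S x≤w) (Special.invol S v≤w)
              (Special.up-up S q (Special.stays S v≤w) (Sp.down-image S x≤w dx) (Sp.down-image S v≤w d)))))

  module Agree (w : E) (op : Bool → E → E) (sp : ∀ c → Special w (op c))
    (down : ∀ c → op c w ⋖ w) (differ : op true w ≢ op false w)
    (IH : ∀ {v σ} → rank v < rank w → Special v σ → σ v ⋖ v → Calculates v σ) where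
    open TwoMatchings D w op sp

    calc : ∀ {v σ} → v ≤ w → rank v < rank w → Special w σ → σ v ⋖ v →
      ∀ {x} → x ≤ w → R x v ≈ T σ (λ z → R z (σ v)) x
    calc {v} v≤w lt S d {x} x≤w with x ≤? v
    ... | yes x≤v = IH lt (Sp.restrict S v≤w d) d x≤v
    ... | no x≰v  = ≈-trans (≈-reflexive (R-≰ x≰v)) (≈-sym (T-R-≰ S v≤w d x≤w x≰v))

    word : Bool → ℕ → (E → V) → E → V
    word c zero    g = g
    word c (suc h) g = T (op c) (word (not c) h g)

    inner : Bool → ℕ → Bool
    inner c zero    = c
    inner c (suc h) = inner (not c) h

    word-snoc : ∀ c h g → word c (suc h) g ≡ word c h (T (op (inner c h)) g)
    word-snoc c zero    g = refl
    word-snoc c (suc h) g = cong (T (op c)) (word-snoc (not c) h g)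

    word-mix : ∀ c h f g {x} → x ≤ w → word c h (λ z → mix (f z) (g z)) x ≈ mix (word c h f x) (word c h g x)
    word-mix c zero    f g x≤w = ≈-refl
    word-mix c (suc h) f g x≤w = ≈-trans
      (t-cong _ _ _ _ (word-mix (not c) h f g x≤w) (word-mix (not c) h f g (O.stays c x≤w)))
      (t-mix _ _ _ _)

    word-cong : ∀ c h {f g} → (∀ {x} → x ≤ w → f x ≈ g x) → ∀ {x} → x ≤ w → word c h f x ≈ word c h g x
    word-cong c zero    eq x≤w = eq x≤w
    word-cong c (suc h) eq x≤w = t-cong _ _ _ _ (word-cong (not c) h eq x≤w) (word-cong (not c) h eq (O.stays c x≤w))

    -- Induction downwards from the top, with `j` the distance to it; at the top both words descend
    -- to `g u`. Below it `x` is the lower partner of `y = op a x`, so a value at `x` is the value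
    -- at `y` after one more operator. The quadratic relation then removes a double letter at the
    -- left end of one word and, after the braid relation at `y`, at the right end of the other.
    braid : ∀ {u m} → Size u m → ∀ g j h c d → j + h ≡ m → word d m g (e u c h) ≈ word (not d) m g (e u c h)
    braid {u} {m} s g zero h c d refl = ≈-trans (at-top d) (≈-sym (at-top (not d)))
      where
      descend : ∀ d h → h ≤ⁿ m → word d h g (e u d h) ≈ g u
      descend d zero    _  = ≈-refl
      descend d (suc h) lt = ≈-trans (≈-reflexive (trans (t-down _ (Sz.down s lt d)) (cong (word (not d) h g) (Sz.op-down s d h))))
        (descend (not d) h (ℕₚ.<⇒≤ lt))
      at-top : ∀ d → word d m g (e u c m) ≈ g u
      at-top d = ≈-trans (≈-reflexive (cong (word d m g) (Size.top s c d))) (descend d m ℕₚ.≤-refl)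
    braid {u} {zero} s g (suc j) h c d ()
    braid {u} {m@(suc m₁)} s g (suc j) h c d eq = pick d
      where
      a = not c
      x = e u c h
      x≤w = Sz.in-w s c h
      h<m : h < m
      h<m = subst (h <_) eq (s≤s (ℕₚ.m≤n+m h j))
      up : x ⋖ op a x
      up = Sz.up-not s h<m c
      y = op a x
      y≤w = O.stays a x≤w
      IHy : ∀ g d → word d m g y ≈ word (not d) m g y
      IHy g d = subst (λ z → word d m g z ≈ word (not d) m g z) (e-not u c h)
        (braid s g j (suc h) a d (trans (ℕₚ.+-suc j h) eq))
      lower : ∀ f → f x ≡ T (op a) f y
      lower f = T-at-down (sp a) f x≤w up
      b = inner (not a) m₁
      g′ = T (op b) g
      main : word a m g x ≈ word (not a) m g x
      main = ≈-trans (≈-reflexive (lower _)) (≈-trans (T-square (sp a) _ y≤w)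
        (≈-sym (≈-trans (≈-reflexive (lower _))
        (≈-trans (≈-reflexive (cong (λ f → f y) (word-snoc a m g)))
        (≈-trans (IHy g′ a)
        (≈-trans (≈-reflexive (cong (λ f → f y) (word-snoc (not a) m₁ g′)))
        (≈-trans (word-cong (not a) m₁ (λ z≤w → T-square (sp b) g z≤w) y≤w)
        (≈-trans (word-mix (not a) m₁ g′ g y≤w)
        (mix-cong (≈-trans (≈-reflexive (cong (λ f → f y) (sym (word-snoc (not a) m₁ g)))) (≈-sym (IHy g a))) ≈-refl)))))))))
      pick : ∀ d → word d m g x ≈ word (not d) m g x
      pick d with d Boolₚ.≟ a
      ... | yes refl = main
      ... | no d≢a = subst (λ d → word d m g x ≈ word (not d) m g x) (sym (Boolₚ.¬-not d≢a))
              (subst (λ c → word (not a) m g x ≈ word c m g x) (sym (not-involutive a)) (≈-sym main))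

    agree : ∀ {x} → x ≤ w → T (op true) (λ z → R z (op true w)) x ≈ T (op false) (λ z → R z (op false w)) x
    agree {x} x≤w with orbit _ refl ≤-refl
    ... | u , m , c , h , p with down-type true p (down true) | down-type false p (down false)
    ... | j , refl , w≡t | _ , refl , w≡f = result
      where
      s = At.is-size p
      m≡ : suc j ≡ m
      m≡ with ℕₚ.m≤n⇒m<n∨m≡n (At.h≤k p)
      ... | inj₂ eq = eq
      ... | inj₁ lt = ⊥-elim (Size.distinct s (s≤s z≤n) lt true (trans (sym w≡t) w≡f))
      op-w : ∀ c → op c w ≡ e u (not c) j
      op-w true  = trans (cong (op true) w≡t) (Sz.op-down s true j)
      op-w false = trans (cong (op false) w≡f) (Sz.op-down s false j)
      rank-w : rank w ≡ m + rank u
      rank-w = trans (cong rank w≡t) (trans (Sz.rank-at s (At.h≤k p) true) (cong (_+ rank u) m≡))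
      -- This makes `op true u` of smaller rank than `w`, so that the induction hypothesis is
      -- available there.
      1<m : 1 < m
      1<m = pos j refl
        where
        pos : ∀ i → j ≡ i → 1 < m
        pos (suc i) j≡ = subst (1 <_) (trans (cong suc (sym j≡)) m≡) (s≤s (s≤s z≤n))
        pos zero    j≡ = ⊥-elim (differ (trans (op-w true) (trans (cong (e u false) j≡)
          (trans (sym (cong (e u true) j≡)) (sym (op-w false))))))
      g : E → V
      g z = R z u
      rank-lt : ∀ {h} → h < m → ∀ c → rank (e u c h) < rank w
      rank-lt {h} h<m c = subst₂ _<_ (sym (Sz.rank-at s (ℕₚ.<⇒≤ h<m) c)) (sym rank-w) (ℕₚ.+-monoˡ-< (rank u) h<m)
      R-word : ∀ h → h < m → ∀ c {x} → x ≤ w → R x (e u c h) ≈ word c h g x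
      R-word zero    _   c x≤w = ≈-refl
      R-word (suc h) h<m c {x} x≤w = ≈-trans (calc (Sz.in-w s c (suc h)) (rank-lt h<m c) (sp c) (Sz.down s (ℕₚ.<⇒≤ h<m) c) x≤w)
        (t-cong _ _ _ _ (lower x≤w) (lower (O.stays c x≤w)))
        where
        lower : ∀ {z} → z ≤ w → R z (op c (e u c (suc h))) ≈ word (not c) h g z
        lower {z} z≤w = ≈-trans (≈-reflexive (cong (R z) (Sz.op-down s c h))) (R-word h (ℕₚ.<⇒≤ h<m) (not c) z≤w)
      as-word : ∀ c → T (op c) (λ z → R z (op c w)) x ≈ word c m g x
      as-word c = subst (λ m → T (op c) (λ z → R z (op c w)) x ≈ word c m g x) m≡
        (t-cong _ _ _ _ (lower x≤w) (lower (O.stays c x≤w)))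
        where
        lower : ∀ {z} → z ≤ w → R z (op c w) ≈ word (not c) j g z
        lower {z} z≤w = ≈-trans (≈-reflexive (cong (R z) (op-w c))) (R-word j (ℕₚ.≤-reflexive m≡) (not c) z≤w)
      module Mx = Mixed D w op sp m
      -- op true and the mixed matching both calculate R below op true u.
      one-step : ∀ {z} → z ≤ w → Mx.letter z ≡ false → T (op true) g z ≈ T (op false) g z
      one-step {z} z≤w lz = ≈-trans (≈-sym (via (sp true) (Sz.op-down s true 0)))
          (≈-trans (via Mx.mixed-special mixed-v) (≈-reflexive (cong (λ c → t g z (op c z)) lz)))
        where
        v = e u true 1
        letter-v : Mx.letter v ≡ true
        letter-v = trans (Mx.letter-At (at {c = true} {1} s (ℕₚ.<⇒≤ 1<m) refl)) yes-m
          where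
          yes-m : ⌊ m ℕ.≟ m ⌋ ≡ true
          yes-m with m ℕ.≟ m
          ... | yes _ = refl
          ... | no ne = ⊥-elim (ne refl)
        mixed-v : Mx.mixed v ≡ u
        mixed-v = trans (cong (λ c → op c v) letter-v) (Sz.op-down s true 0)
        via : ∀ {σ} → Special w σ → σ v ≡ u → R z v ≈ T σ g z
        via {σ} S eq = ≈-trans (calc (Sz.in-w s true 1) (rank-lt 1<m true) S (subst (_⋖ v) (sym eq) (proj₂ (Size.bottom s) true)) z≤w)
          (≈-reflexive (cong (λ y → T σ (λ z → R z y) z) eq))
      -- On these orbits both letters act alike on `g` by `one-step`. The quadratic relation then
      -- gives the words for either letter the same recursion in their length, with equal initial
      -- values.
      words-agree : ∀ {u′ k} → k ≢ m → ∀ h → (∀ c {z c′ h′} → At u′ k c′ h′ z → word c h g z ≈ word (not c) h g z) ×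
        (∀ c {z c′ h′} → At u′ k c′ h′ z → word c (suc h) g z ≈ word (not c) (suc h) g z)
      words-agree {u′} {k} k≢m zero = (λ _ _ → ≈-refl) , one
        where
        letter-no : ⌊ k ℕ.≟ m ⌋ ≡ false
        letter-no with k ℕ.≟ m
        ... | yes eq = ⊥-elim (k≢m eq)
        ... | no _ = refl
        one : ∀ c {z c′ h′} → At u′ k c′ h′ z → T (op c) g z ≈ T (op (not c)) g z
        one true  q = one-step (At-≤ q) (trans (Mx.letter-At q) letter-no)
        one false q = ≈-sym (one true q)
      words-agree {u′} {k} k≢m (suc h) = P₁ , P₂
        where
        P₀ = proj₁ (words-agree {u′} k≢m h)
        P₁ = proj₂ (words-agree {u′} k≢m h)
        expand : ∀ c {z c′ h′} → At u′ k c′ h′ z →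
          word c (suc (suc h)) g z ≈ mix (word c (suc h) g z) (word (not c) h g z)
        expand c q = ≈-trans (t-cong _ _ _ _ (≈-sym (P₁ c q)) (≈-sym (P₁ c (proj₂ (proj₂ (At-op q c))))))
          (T-square (sp c) _ (At-≤ q))
        P₂ : ∀ c {z c′ h′} → At u′ k c′ h′ z → word c (suc (suc h)) g z ≈ word (not c) (suc (suc h)) g z
        P₂ c q = ≈-trans (expand c q) (≈-trans (mix-cong (P₁ c q) (P₀ (not c) q)) (≈-sym (expand (not c) q)))
      result : T (op true) (λ z → R z (op true w)) x ≈ T (op false) (λ z → R z (op false w)) x
      result with orbit _ refl x≤w
      ... | u′ , k , c′ , h′ , q with k ℕ.≟ m
      ...   | no k≢m = ≈-trans (as-word true) (≈-trans (proj₁ (words-agree k≢m m) true q) (≈-sym (as-word false)))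
      ...   | yes refl = ≈-trans (as-word true) (≈-trans
                (subst (λ x → word true k g x ≈ word false k g x) (sym (At.is-e q))
                  (braid (At.is-size q) g (k ℕ.∸ h′) h′ c′ true (ℕₚ.m∸n+n≡m (At.h≤k q)))) (≈-sym (as-word false)))

  -- Stated for all special matchings and not only for multiplications, since `Agree` uses the
  -- induction hypothesis for the restricted mixed matching.
  calculates : ∀ n {w σ} → rank w < n → Special w σ → σ w ⋖ w → Calculates w σ
  calculates (suc n) {w} {σ} lt S d {x} x≤w = ≈-trans (≈-reflexive (R-step p x≤w)) (≈-sym same)
    where
    p : 1 ≤ⁿ rank w
    p = subst (1 ≤ⁿ_) (sym (proj₂ d)) (s≤s z≤n)
    S₀ = proj₁ (proj₂ (matching w p))
    d₀ = proj₂ (proj₂ (matching w p))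
    two : ∀ {σ τ} → Special w σ → Special w τ → σ w ⋖ w → τ w ⋖ w → σ w ≢ τ w →
      T σ (λ z → R z (σ w)) x ≈ T τ (λ z → R z (τ w)) x
    two {σ} {τ} S S′ d d′ ne = Agree.agree w op (λ { true → S ; false → S′ }) (λ { true → d ; false → d′ }) ne
        (λ lt′ → calculates n (ℕₚ.<-≤-trans lt′ (s≤s⁻¹ lt))) x≤w
      where
      op : Bool → E → E
      op true  = σ
      op false = τ
    same : T σ (λ z → R z (σ w)) x ≈ T (σ₀ w p) (λ z → R z (σ₀ w p w)) x
    same with σ w ≟ σ₀ w p w
    ... | no ne = two S S₀ d d₀ ne
    ... | yes eq with ℕₚ.m≤n⇒m<n∨m≡n p
    ...   | inj₂ 1≡ = ≈-reflexive (cong₂ (λ v y → t (λ z → R z v) x y) eq σx≡)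
      where
      up-only : ∀ {τ} → Special w τ → x ≢ w → τ x ≡ w
      up-only {τ} S x≢w with Special.updown S x≤w
      ... | inj₁ u  = rank-inj (Special.stays S x≤w) (ℕₚ.≤-antisym (rank-mono (Special.stays S x≤w))
                        (subst₂ _≤ⁿ_ 1≡ (sym (proj₂ u)) (s≤s z≤n)))
      ... | inj₂ dx = ⊥-elim (x≢w (rank-inj x≤w (ℕₚ.≤-antisym (rank-mono x≤w) (subst₂ _≤ⁿ_ 1≡ (sym (proj₂ dx)) (s≤s z≤n)))))
      σx≡ : σ x ≡ σ₀ w p x
      σx≡ with x ≟ w
      ... | yes refl = eq
      ... | no x≢w = trans (up-only S x≢w) (sym (up-only S₀ x≢w))
    -- `σ` and the chosen matching have the same value at `w`, so `two` does not apply to them; one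
    -- of the two matchings provided has a different value and links them.
    ...   | inj₁ 2≤ with matchings w 2≤
    ...     | τ , τ′ , Sτ , Sτ′ , dτ , dτ′ , ne with τ w ≟ σ w
    ...       | no ne′ = ≈-trans (two S Sτ d dτ (ne′ ∘ sym)) (two Sτ S₀ dτ d₀ (λ q → ne′ (trans q (sym eq))))
    ...       | yes eq′ = ≈-trans (two S Sτ′ d dτ′ (λ q → ne (trans eq′ q))) (two Sτ′ S₀ dτ′ d₀ (λ q → ne (trans eq′ (trans eq (sym q)))))

-- Parabolic R-polynomials

module Sums (M : CommutativeMonoid 0ℓ 0ℓ) where
  open CommutativeMonoid M renaming (Carrier to V; refl to ≈-refl; sym to ≈-sym; trans to ≈-trans; _∙_ to _⊕_; ε to 0#; ∙-cong to ⊕-cong; identityˡ to ⊕-identityˡ; identityʳ to ⊕-identityʳ)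
  open Summation M public
  open SetoidReasoning setoid

  sum-zero : ∀ {n} (g : Fin n → V) → (∀ i → g i ≈ 0#) → sum g ≈ 0#
  sum-zero {n} g z = ≈-trans (sum-cong-≋ z) (sum-replicate-zero n)

  sum-single : ∀ {n} (g : Fin n → V) i → (∀ j → j ≢ i → g j ≈ 0#) → sum g ≈ g i
  sum-single {suc n} g i z = begin
    sum g                            ≈⟨ sum-remove {i = i} g ⟩
    g i ⊕ sum (λ j → g (punchIn i j)) ≈⟨ ⊕-cong ≈-refl (sum-zero (λ j → g (punchIn i j)) λ j → z _ (Finₚ.punchInᵢ≢i i j)) ⟩
    g i ⊕ 0#                         ≈⟨ ⊕-identityʳ _ ⟩
    g i                              ∎

  module _ {n} (D : Diamond (Fin n)) {w σ} (S : Diamond.Special D w σ) where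
    open Diamond D hiding (E)
    open Theory D

    data Side (z : Fin n) : Set where
      up   : z ≤ w → z ⋖ σ z → Side z
      down : z ≤ w → σ z ⋖ z → Side z
      out  : ¬ z ≤ w → Side z

    side : ∀ z → Side z
    side z with z ≤? w
    ... | no z≰w  = out z≰w
    ... | yes z≤w with Special.updown S z≤w
    ...   | inj₁ u = up z≤w u
    ...   | inj₂ d = down z≤w d

    on-up : (Fin n → V) → Fin n → V
    on-up g z with side z
    ... | up _ _ = g z
    ... | _      = 0#

    on-down : (Fin n → V) → Fin n → V
    on-down g z with side z
    ... | down _ _ = g z
    ... | _        = 0#

    on-down-≡ : ∀ g {z} → z ≤ w → σ z ⋖ z → on-down g z ≡ g z
    on-down-≡ g {z} l d with side z
    ... | up _ u   = ⊥-elim (⋖-asym u d)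
    ... | down _ _ = refl
    ... | out z≰w  = ⊥-elim (z≰w l)

    on-down-up : ∀ g {z} → z ≤ w → z ⋖ σ z → on-down g z ≡ 0#
    on-down-up g {z} l u with side z
    ... | up _ _   = refl
    ... | down _ d = ⊥-elim (⋖-asym u d)
    ... | out z≰w  = refl

    -- Extending `σ` by the identity outside the elements below `w` gives a permutation of the whole
    -- index set, by which sums can be reindexed.
    flip : Fin n → Fin n
    flip z with z ≤? w
    ... | yes _ = σ z
    ... | no  _ = z

    flip-≤ : ∀ {z} → z ≤ w → flip z ≡ σ z
    flip-≤ {z} l with z ≤? w
    ... | yes _  = refl
    ... | no z≰w = ⊥-elim (z≰w l)

    flip-≰ : ∀ {z} → ¬ z ≤ w → flip z ≡ z
    flip-≰ {z} n with z ≤? w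
    ... | yes z≤w = ⊥-elim (n z≤w)
    ... | no  _   = refl

    flip-invol : ∀ z → flip (flip z) ≡ z
    flip-invol z with z ≤? w
    ... | yes z≤w = trans (flip-≤ (Special.stays S z≤w)) (Special.invol S z≤w)
    ... | no  z≰w = flip-≰ z≰w

    on-down-flip : ∀ g z → on-down g (flip z) ≡ on-up (g ∘ σ) z
    on-down-flip g z with side z
    ... | up l u rewrite flip-≤ l = on-down-≡ g (Special.stays S l) (Sp.up-image S l u)
    ... | down l d rewrite flip-≤ l = on-down-up g (Special.stays S l) (Sp.down-image S l d)
    ... | out z≰w rewrite flip-≰ z≰w with side z
    ...   | up _ _ = refl
    ...   | down l _ = ⊥-elim (z≰w l)
    ...   | out _ = refl

    pairs : (g : Fin n → V) → (∀ {z} → ¬ z ≤ w → g z ≈ 0#) → sum g ≈ sum (on-up (λ z → g z ⊕ g (σ z)))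
    pairs g vanish = begin
      sum g                                             ≈⟨ sum-cong-≋ split ⟩
      sum (λ z → on-up g z ⊕ on-down g z)               ≈⟨ ∑-distrib-+ (on-up g) (on-down g) ⟩
      sum (on-up g) ⊕ sum (on-down g)                   ≈⟨ ⊕-cong ≈-refl (sum-permute (on-down g) (permutation flip flip flip-invol flip-invol)) ⟩
      sum (on-up g) ⊕ sum (on-down g ∘ flip)            ≈⟨ ⊕-cong ≈-refl (sum-cong-≋ λ z → reflexive (on-down-flip g z)) ⟩
      sum (on-up g) ⊕ sum (on-up (g ∘ σ))               ≈⟨ ∑-distrib-+ (on-up g) (on-up (g ∘ σ)) ⟨
      sum (λ z → on-up g z ⊕ on-up (g ∘ σ) z)           ≈⟨ sum-cong-≋ join ⟩
      sum (on-up (λ z → g z ⊕ g (σ z)))                 ∎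
      where
      split : ∀ z → g z ≈ on-up g z ⊕ on-down g z
      split z with side z
      ... | up _ _   = ≈-sym (⊕-identityʳ _)
      ... | down _ _ = ≈-sym (⊕-identityˡ _)
      ... | out z≰w  = ≈-trans (vanish z≰w) (≈-sym (⊕-identityˡ _))
      join : ∀ z → on-up g z ⊕ on-up (g ∘ σ) z ≈ on-up (λ z → g z ⊕ g (σ z)) z
      join z with side z
      ... | up _ _   = ≈-refl
      ... | down _ _ = ⊕-identityˡ _
      ... | out _    = ⊕-identityˡ _

    pairwise : (g h : Fin n → V) → (∀ {z} → ¬ z ≤ w → g z ≈ 0#) → (∀ {z} → ¬ z ≤ w → h z ≈ 0#) →
      (∀ {z} → z ≤ w → z ⋖ σ z → g z ⊕ g (σ z) ≈ h z ⊕ h (σ z)) → sum g ≈ sum h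
    pairwise g h g-out h-out eq = ≈-trans (pairs g g-out) (≈-trans (sum-cong-≋ pointwise) (≈-sym (pairs h h-out)))
      where
      pointwise : ∀ z → on-up (λ z → g z ⊕ g (σ z)) z ≈ on-up (λ z → h z ⊕ h (σ z)) z
      pointwise z with side z
      ... | up l u   = eq l u
      ... | down _ _ = ≈-refl
      ... | out _    = ≈-refl

-- The operators mix a b = (q-1)a + qb, c = -x and κ = q-1-x on ℤ[q].
record Operators (M : CommutativeMonoid 0ℓ 0ℓ) : Set where
  open CommutativeMonoid M renaming (Carrier to V; refl to ≈-refl; sym to ≈-sym; trans to ≈-trans; _∙_ to _⊕_; ε to 0#)
  field
    mix      : V → V → V
    mix-cong : ∀ {a b a′ b′} → a ≈ a′ → b ≈ b′ → mix a b ≈ mix a′ b′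
    mix-⊕    : ∀ a b a′ b′ → mix (a ⊕ a′) (b ⊕ b′) ≈ mix a b ⊕ mix a′ b′
    mix-0    : mix 0# 0# ≈ 0#
    medial   : ∀ a b a′ b′ → mix (mix a b) (mix a′ b′) ≈ mix (mix a a′) (mix b b′)
    c        : V → V
    c-cong   : ∀ {a b} → a ≈ b → c a ≈ c b
    c-0      : c 0# ≈ 0#
    c-mix    : ∀ a b → c (mix a b) ≈ mix (c a) (c b)
    κ        : V → V
    κ-cong   : ∀ {a b} → a ≈ b → κ a ≈ κ b
    κ-⊕      : ∀ a b → κ (a ⊕ b) ≈ κ a ⊕ κ b
    κ-0      : κ 0# ≈ 0#
    -- Both values of `x` are roots of `x² = (q - 1) x + q`, that is, `-x (q - 1 - x) = q`. This is
    -- where the two choices of `x` come from.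
    absorb   : ∀ a b → mix a b ⊕ c a ≈ κ (a ⊕ c b)

-- Deodhar's expansion of parabolic R-polynomials

module Expansion {n} (D : Diamond (Fin n)) (M : CommutativeMonoid 0ℓ 0ℓ) (O : Operators M) (1# : CommutativeMonoid.Carrier M)
  (J : Fin n → Set) (J? : ∀ z → Dec (J z)) (p : Fin n → Fin n) (p-J : ∀ z → J (p z)) (p≤ : ∀ z → Diamond._≤_ D (p z) z)
  (p-max : ∀ {y z} → J y → Diamond._≤_ D y z → Diamond._≤_ D y (p z)) where
  open CommutativeMonoid M renaming (Carrier to V; refl to ≈-refl; sym to ≈-sym; trans to ≈-trans; _∙_ to _⊕_; ε to 0#; ∙-cong to ⊕-cong; identityˡ to ⊕-identityˡ; identityʳ to ⊕-identityʳ)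
  open Sums M
  open Operators O
  open Diamond D
  open Theory D
  open RPolynomial D _≈_ isEquivalence mix 0# 1# mix-cong medial mix-0
  open SetoidReasoning setoid

  cⁿ : ℕ → V → V
  cⁿ zero    a = a
  cⁿ (suc k) a = c (cⁿ k a)

  -- A summand of Deodhar's formula, the sum of `(-x)^ℓ(h) R(u h, v)` over `h` in the subgroup
  -- generated by `H`. The elements `z = u h` are those with `p z = u`, and `ℓ(h)` is the difference
  -- of the ranks of `z` and `u`.
  φ : E → E → V → V
  φ u z a with p z ≟ u
  ... | yes _ = cⁿ (rank z ∸ rank u) a
  ... | no  _ = 0#

  φ-yes : ∀ {u z} a → p z ≡ u → φ u z a ≡ cⁿ (rank z ∸ rank u) a
  φ-yes {u} {z} a eq with p z ≟ u
  ... | yes _ = refl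
  ... | no ne = ⊥-elim (ne eq)

  φ-no : ∀ {u z} a → p z ≢ u → φ u z a ≡ 0#
  φ-no {u} {z} a ne with p z ≟ u
  ... | yes eq = ⊥-elim (ne eq)
  ... | no _   = refl

  cⁿ-0 : ∀ k → cⁿ k 0# ≈ 0#
  cⁿ-0 zero    = ≈-refl
  cⁿ-0 (suc k) = ≈-trans (c-cong (cⁿ-0 k)) c-0

  cⁿ-cong : ∀ k {a b} → a ≈ b → cⁿ k a ≈ cⁿ k b
  cⁿ-cong zero    e = e
  cⁿ-cong (suc k) e = c-cong (cⁿ-cong k e)

  cⁿ-mix : ∀ k a b → cⁿ k (mix a b) ≈ mix (cⁿ k a) (cⁿ k b)
  cⁿ-mix zero    a b = ≈-refl
  cⁿ-mix (suc k) a b = ≈-trans (c-cong (cⁿ-mix k a b)) (c-mix _ _)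

  φ-0 : ∀ u z {a} → a ≈ 0# → φ u z a ≈ 0#
  φ-0 u z e with p z ≟ u
  ... | yes _ = ≈-trans (cⁿ-cong (rank z ∸ rank u) e) (cⁿ-0 (rank z ∸ rank u))
  ... | no  _ = ≈-refl

  φ-cong : ∀ u z {a b} → a ≈ b → φ u z a ≈ φ u z b
  φ-cong u z e with p z ≟ u
  ... | yes _ = cⁿ-cong (rank z ∸ rank u) e
  ... | no  _ = ≈-refl

  F : E → E → V
  F u v = sum (λ z → φ u z (R z v))

  ≤-antisym : ∀ {x y} → x ≤ y → y ≤ x → x ≡ y
  ≤-antisym x≤y y≤x = rank-inj x≤y (ℕₚ.≤-antisym (rank-mono x≤y) (rank-mono y≤x))

  p-unique : ∀ {y z} → J y → y ≤ z → (∀ {x} → J x → x ≤ z → x ≤ y) → p z ≡ y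
  p-unique j l m = ≤-antisym (m (p-J _) (p≤ _)) (p-max j l)

  F-≰ : ∀ {u v} → ¬ u ≤ v → F u v ≈ 0#
  F-≰ {u} {v} u≰v = sum-zero (λ z → φ u z (R z v)) zero-term
    where
    zero-term : ∀ z → φ u z (R z v) ≈ 0#
    zero-term z with z ≤? v
    ... | no z≰v  = φ-0 u z (reflexive (R-≰ z≰v))
    ... | yes z≤v = reflexive (φ-no (R z v) λ eq → u≰v (≤-trans (subst (_≤ z) eq (p≤ z)) z≤v))

  F-refl : ∀ {v} → J v → F v v ≈ 1#
  F-refl {v} j = ≈-trans (sum-single (λ z → φ v z (R z v)) v zero-term) (reflexive (trans (φ-yes (R v v) (p-unique j ≤-refl λ _ l → l))
      (trans (cong (λ k → cⁿ k (R v v)) (ℕₚ.n∸n≡0 (rank v))) (R-refl v))))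
    where
    zero-term : ∀ z → z ≢ v → φ v z (R z v) ≈ 0#
    zero-term z z≢v with z ≤? v
    ... | no z≰v  = φ-0 v z (reflexive (R-≰ z≰v))
    ... | yes z≤v = reflexive (φ-no (R z v) λ eq → z≢v (≤-antisym z≤v (subst (_≤ z) eq (p≤ z))))

  -- The properties of left multiplication by a descent of w with respect to minimal coset representatives.
  record Parabolic (w : E) (σ : E → E) : Set where
    field
      special : Special w σ
      lowers  : σ w ⋖ w
      J-down  : ∀ {u} → u ≤ w → J u → σ u ⋖ u → J (σ u)
      p-down  : ∀ {z} → z ≤ w → σ (p z) ⋖ p z → σ z ⋖ z
      p-stop  : ∀ {u y} → u ≤ w → J u → u ⋖ σ u → ¬ J (σ u) → J y → y ≤ σ u → y ≤ u

  mix-sum : ∀ {k} (g h : Fin k → V) → mix (sum g) (sum h) ≈ sum (λ z → mix (g z) (h z))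
  mix-sum {zero}  g h = mix-0
  mix-sum {suc k} g h = ≈-trans (mix-⊕ _ _ _ _) (⊕-cong ≈-refl (mix-sum (g ∘ Fin.suc) (h ∘ Fin.suc)))

  κ-sum : ∀ {k} (g : Fin k → V) → κ (sum g) ≈ sum (κ ∘ g)
  κ-sum {zero}  g = κ-0
  κ-sum {suc k} g = ≈-trans (κ-⊕ _ _) (⊕-cong ≈-refl (κ-sum (g ∘ Fin.suc)))

  module _ {v σ} (P : Parabolic v σ) where
    open Parabolic P
    open Sp special

    private
      v′ = σ v

    f : E → V
    f z = R z v′

    p≤v : ∀ {z} → z ≤ v → p z ≤ v
    p≤v l = ≤-trans (p≤ _) l

    p-up : ∀ {z} → z ≤ v → z ⋖ σ z → p z ⋖ σ (p z)
    p-up l u with updown (p≤v l)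
    ... | inj₁ pu = pu
    ... | inj₂ pd = ⊥-elim (⋖-asym u (p-down l pd))

    p-moves : ∀ {z} → z ≤ v → z ⋖ σ z → J (σ (p z)) → p (σ z) ≡ σ (p z)
    p-moves {z} l u j = p-unique j (up-up (p≤ z) l (p-up l u) u) below
      where
      below : ∀ {y} → J y → y ≤ σ z → y ≤ σ (p z)
      below {y} jy y≤ with updown (≤-trans y≤ (stays l))
      ... | inj₁ yu = ≤-trans (p-max jy (subst (y ≤_) (invol l) (up-down y≤ (stays l) yu (up-image l u)))) (proj₁ (p-up l u))
      ... | inj₂ yd = subst (_≤ σ (p z)) (invol y≤v) (up-up
              (p-max (J-down y≤v jy yd) (subst (σ y ≤_) (invol l) (down-down y≤ (stays l) yd (up-image l u))))
              (p≤v l) (down-image y≤v yd) (p-up l u))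
        where y≤v = ≤-trans y≤ (stays l)

    p-stays : ∀ {z} → z ≤ v → z ⋖ σ z → ¬ J (σ (p z)) → p (σ z) ≡ p z
    p-stays {z} l u ¬j = p-unique (p-J z) (≤-trans (p≤ z) (proj₁ u)) below
      where
      below : ∀ {y} → J y → y ≤ σ z → y ≤ p z
      below {y} jy y≤ with updown (≤-trans y≤ (stays l))
      ... | inj₁ yu = p-max jy (subst (y ≤_) (invol l) (up-down y≤ (stays l) yu (up-image l u)))
      ... | inj₂ yd = p-stop (p≤v l) (p-J z) (p-up l u) ¬j jy (subst (_≤ σ (p z)) (invol y≤v) (up-up
              (p-max (J-down y≤v jy yd) (subst (σ y ≤_) (invol l) (down-down y≤ (stays l) yd (up-image l u))))
              (p≤v l) (down-image y≤v yd) (p-up l u)))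
        where y≤v = ≤-trans y≤ (stays l)

    R-up : ∀ {z} → z ≤ v → z ⋖ σ z → R z v ≈ mix (f z) (f (σ z))
    R-up l u = ≈-trans (calculates _ (ℕₚ.n<1+n _) special lowers l) (reflexive (t-up f u))

    R-down : ∀ {z} → z ≤ v → z ⋖ σ z → R (σ z) v ≈ f z
    R-down l u = ≈-trans (calculates _ (ℕₚ.n<1+n _) special lowers (stays l))
      (reflexive (trans (t-down f (up-image l u)) (cong f (invol l))))

    outside : ∀ u {z} → ¬ z ≤ v → φ u z (R z v) ≈ 0#
    outside u z≰v = φ-0 u _ (reflexive (R-≰ z≰v))

    outside′ : ∀ u {z} → ¬ z ≤ v → φ u z (f z) ≈ 0#
    outside′ u z≰v = φ-0 u _ (reflexive (R-≰ λ l → z≰v (≤-trans l (proj₁ lowers))))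

    rank-σ : ∀ {z} → z ⋖ σ z → ∀ {u} → u ⋖ σ u → rank (σ z) ∸ rank (σ u) ≡ rank z ∸ rank u
    rank-σ (_ , r) (_ , s) = cong₂ _∸_ r s

    -- In the group, left multiplication by a generator either moves the coset of `z` to another one
    -- or maps it to itself, according to whether it takes the minimal representative to a minimal
    -- representative.
    data Behaviour (z : E) : Set where
      moves : J (σ (p z)) → p (σ z) ≡ σ (p z) → Behaviour z
      stops : ¬ J (σ (p z)) → p (σ z) ≡ p z → Behaviour z

    behaviour : ∀ {z} → z ≤ v → z ⋖ σ z → Behaviour z
    behaviour {z} l u with J? (σ (p z))
    ... | yes j = moves j (p-moves l u j)
    ... | no ¬j = stops ¬j (p-stays l u ¬j)

    up≢down : ∀ {x y} → x ⋖ σ x → σ y ⋖ y → x ≢ y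
    up≢down u d refl = ⋖-asym u d

    zeros : ∀ {a b} → a ≡ 0# → b ≡ 0# → a ⊕ b ≈ 0#
    zeros refl refl = ⊕-identityˡ 0#

    -- In a pair `z`, `σ z` only `σ z` can contribute on the left and only `z` on the right. The
    -- matching lowers both the element and the representative, so the exponents of `c` agree.
    F-down : ∀ {u} → u ≤ v → J u → σ u ⋖ u → F u v ≈ F (σ u) v′
    F-down {u} u≤v ju d = pairwise D special _ _ (outside u) (outside′ (σ u)) pair
      where
      pair : ∀ {z} → z ≤ v → z ⋖ σ z →
        φ u z (R z v) ⊕ φ u (σ z) (R (σ z) v) ≈ φ (σ u) z (f z) ⊕ φ (σ u) (σ z) (f (σ z))
      pair {z} l uz with behaviour l uz
      ... | stops ¬j eq = ≈-trans (zeros (φ-no _ (up≢down (p-up l uz) d)) (φ-no _ λ e → up≢down (p-up l uz) d (trans (sym eq) e)))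
              (≈-sym (zeros (φ-no _ λ e → other e) (φ-no _ λ e → other (trans (sym eq) e))))
        where
        other : p z ≢ σ u
        other e = ¬j (subst J (sym (trans (cong σ e) (invol u≤v))) ju)
      ... | moves j eq with p z ≟ σ u
      ...   | yes e = begin
        φ u z (R z v) ⊕ φ u (σ z) (R (σ z) v)           ≈⟨ ⊕-cong (reflexive (φ-no _ (up≢down (p-up l uz) d))) (φ-cong u (σ z) (R-down l uz)) ⟩
        0# ⊕ φ u (σ z) (f z)                            ≈⟨ ⊕-identityˡ _ ⟩
        φ u (σ z) (f z)                                 ≡⟨ φ-yes _ (trans eq (trans (cong σ e) (invol u≤v))) ⟩
        cⁿ (rank (σ z) ∸ rank u) (f z)                  ≡⟨ cong (λ k → cⁿ k (f z)) (cong₂ _∸_ (proj₂ uz) (proj₂ d)) ⟩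
        cⁿ (rank z ∸ rank (σ u)) (f z)                  ≈⟨ ⊕-identityʳ _ ⟨
        cⁿ (rank z ∸ rank (σ u)) (f z) ⊕ 0#             ≡⟨ cong (cⁿ (rank z ∸ rank (σ u)) (f z) ⊕_) (φ-no {σ u} {σ z} (f (σ z))
                                                            λ e′ → up≢down (p-up l uz) d (σ-injective (p≤v l) u≤v (trans (sym eq) e′))) ⟨
        cⁿ (rank z ∸ rank (σ u)) (f z) ⊕ φ (σ u) (σ z) (f (σ z)) ∎
      ...   | no ne = ≈-trans (zeros (φ-no _ (up≢down (p-up l uz) d)) (φ-no _ λ e → ne (trans (sym (invol (p≤v l))) (cong σ (trans (sym eq) e)))))
              (≈-sym (zeros refl (φ-no _ λ e → up≢down (p-up l uz) d (σ-injective (p≤v l) u≤v (trans (sym eq) e)))))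

    zero-mix : ∀ {a b a′ b′} → a ≡ 0# → b ≡ 0# → a′ ≡ 0# → b′ ≡ 0# → mix a b ⊕ mix a′ b′ ≈ 0#
    zero-mix refl refl refl refl = ≈-trans (⊕-cong mix-0 mix-0) (⊕-identityˡ 0#)

    F-up : ∀ {u} → u ≤ v → u ⋖ σ u → J (σ u) → F u v ≈ mix (F u v′) (F (σ u) v′)
    F-up {u} u≤v uu j = ≈-trans (pairwise D special _ (λ z → mix (φ u z (f z)) (φ (σ u) z (f z))) (outside u)
        (λ z≰v → ≈-trans (mix-cong (outside′ u z≰v) (outside′ (σ u) z≰v)) mix-0) pair) (≈-sym (mix-sum {n} _ _))
      where
      ud = up-image u≤v uu
      pair : ∀ {z} → z ≤ v → z ⋖ σ z → φ u z (R z v) ⊕ φ u (σ z) (R (σ z) v) ≈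
        mix (φ u z (f z)) (φ (σ u) z (f z)) ⊕ mix (φ u (σ z) (f (σ z))) (φ (σ u) (σ z) (f (σ z)))
      pair {z} l uz = cases (behaviour l uz)
        where
        pu = p-up l uz
        pd = up-image (p≤v l) pu
        cases : Behaviour z → φ u z (R z v) ⊕ φ u (σ z) (R (σ z) v) ≈
          mix (φ u z (f z)) (φ (σ u) z (f z)) ⊕ mix (φ u (σ z) (f (σ z))) (φ (σ u) (σ z) (f (σ z)))
        cases (stops ¬j eq) = ≈-trans (zeros (φ-no _ p≢u) (φ-no _ pσ≢u))
            (≈-sym (zero-mix (φ-no _ p≢u) (φ-no _ (up≢down pu ud)) (φ-no _ pσ≢u) (φ-no _ (up≢down pu ud ∘ trans (sym eq)))))
          where
          p≢u : p z ≢ u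
          p≢u e = ¬j (subst (J ∘ σ) (sym e) j)
          pσ≢u : p (σ z) ≢ u
          pσ≢u = p≢u ∘ trans (sym eq)
        cases (moves jz eq) = go (p z ≟ u)
          where
          pσ≢u : p (σ z) ≢ u
          pσ≢u e = up≢down uu pd (trans (sym e) eq)
          go : Dec (p z ≡ u) → φ u z (R z v) ⊕ φ u (σ z) (R (σ z) v) ≈
            mix (φ u z (f z)) (φ (σ u) z (f z)) ⊕ mix (φ u (σ z) (f (σ z))) (φ (σ u) (σ z) (f (σ z)))
          go (no ne) = ≈-trans (zeros (φ-no _ ne) (φ-no _ pσ≢u)) (≈-sym (zero-mix (φ-no _ ne) (φ-no _ (up≢down pu ud)) (φ-no _ pσ≢u)
            (φ-no _ λ e → ne (σ-injective (p≤v l) u≤v (trans (sym eq) e)))))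
          go (yes e) = begin
              φ u z (R z v) ⊕ φ u (σ z) (R (σ z) v)   ≈⟨ ⊕-cong (reflexive (φ-yes _ e)) (reflexive (φ-no _ pσ≢u)) ⟩
              k (R z v) ⊕ 0#                          ≈⟨ ⊕-identityʳ _ ⟩
              k (R z v)                               ≈⟨ ≈-trans (cⁿ-cong (rank z ∸ rank u) (R-up l uz)) (cⁿ-mix (rank z ∸ rank u) _ _) ⟩
              mix (k (f z)) (k (f (σ z)))             ≈⟨ mix-cong (⊕-identityʳ _) (⊕-identityˡ _) ⟨
              mix (k (f z) ⊕ 0#) (0# ⊕ k (f (σ z)))   ≈⟨ mix-⊕ _ _ _ _ ⟩
              mix (k (f z)) 0# ⊕ mix 0# (k (f (σ z))) ≈⟨ ⊕-cong
                (mix-cong (reflexive (φ-yes _ e)) (reflexive (φ-no _ (up≢down pu ud))))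
                (mix-cong (reflexive (φ-no _ pσ≢u)) (reflexive (trans (φ-yes _ (trans eq (cong σ e)))
                  (cong (λ i → cⁿ i (f (σ z))) (rank-σ uz uu))))) ⟨
              mix (φ u z (f z)) (φ (σ u) z (f z)) ⊕ mix (φ u (σ z) (f (σ z))) (φ (σ u) (σ z) (f (σ z))) ∎
            where
            k = cⁿ (rank z ∸ rank u)

    -- The matching keeps the coset of `u`, so both members of a pair contribute, with exponents
    -- that differ by one. `absorb` combines them.
    F-stop : ∀ {u} → u ≤ v → J u → u ⋖ σ u → ¬ J (σ u) → F u v ≈ κ (F u v′)
    F-stop {u} u≤v ju uu ¬j = ≈-trans (pairwise D special _ (λ z → κ (φ u z (f z))) (outside u)
        (λ z≰v → ≈-trans (κ-cong (outside′ u z≰v)) κ-0) pair) (≈-sym (κ-sum {n} _))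
      where
      pair : ∀ {z} → z ≤ v → z ⋖ σ z → φ u z (R z v) ⊕ φ u (σ z) (R (σ z) v) ≈ κ (φ u z (f z)) ⊕ κ (φ u (σ z) (f (σ z)))
      pair {z} l uz = cases (behaviour l uz)
        where
        pd = up-image (p≤v l) (p-up l uz)
        all-zero : p z ≢ u → p (σ z) ≢ u → φ u z (R z v) ⊕ φ u (σ z) (R (σ z) v) ≈ κ (φ u z (f z)) ⊕ κ (φ u (σ z) (f (σ z)))
        all-zero ne ne′ = ≈-trans (zeros (φ-no _ ne) (φ-no _ ne′)) (≈-sym (≈-trans (⊕-cong
          (≈-trans (κ-cong (reflexive (φ-no _ ne))) κ-0) (≈-trans (κ-cong (reflexive (φ-no _ ne′))) κ-0)) (⊕-identityˡ _)))
        cases : Behaviour z → φ u z (R z v) ⊕ φ u (σ z) (R (σ z) v) ≈ κ (φ u z (f z)) ⊕ κ (φ u (σ z) (f (σ z)))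
        cases (moves jz eq) = all-zero (λ e → ¬j (subst (J ∘ σ) e jz)) λ e → up≢down uu pd (trans (sym e) eq)
        cases (stops _ eq) = go (p z ≟ u)
          where
          go : Dec (p z ≡ u) → φ u z (R z v) ⊕ φ u (σ z) (R (σ z) v) ≈ κ (φ u z (f z)) ⊕ κ (φ u (σ z) (f (σ z)))
          go (no ne) = all-zero ne (ne ∘ trans (sym eq))
          go (yes e) = begin
              φ u z (R z v) ⊕ φ u (σ z) (R (σ z) v)             ≈⟨ ⊕-cong (reflexive (φ-yes _ e)) (≈-trans (φ-cong u (σ z) (R-down l uz)) (reflexive φσ)) ⟩
              k (R z v) ⊕ c (k (f z))                           ≈⟨ ⊕-cong (≈-trans (cⁿ-cong (rank z ∸ rank u) (R-up l uz)) (cⁿ-mix (rank z ∸ rank u) _ _)) ≈-refl ⟩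
              mix (k (f z)) (k (f (σ z))) ⊕ c (k (f z))         ≈⟨ absorb _ _ ⟩
              κ (k (f z) ⊕ c (k (f (σ z))))                     ≈⟨ κ-⊕ _ _ ⟩
              κ (k (f z)) ⊕ κ (c (k (f (σ z))))                 ≈⟨ ⊕-cong (κ-cong (reflexive (φ-yes _ e))) (κ-cong (reflexive φσ)) ⟨
              κ (φ u z (f z)) ⊕ κ (φ u (σ z) (f (σ z)))         ∎
            where
            k = cⁿ (rank z ∸ rank u)
            φσ : ∀ {a} → φ u (σ z) a ≡ c (k a)
            φσ {a} = trans (φ-yes _ (trans eq e)) (cong (λ i → cⁿ i a) (trans (cong (_∸ rank u) (proj₂ uz))
              (ℕₚ.+-∸-assoc 1 (rank-mono (subst (_≤ z) e (p≤ z))))))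

  record Recursive (Q : E → E → V) (v : E) (σ : E → E) : Set where
    field
      parabolic : Parabolic v σ
      Q-down : ∀ {u} → u ≤ v → u ≢ v → J u → σ u ⋖ u → Q u v ≈ Q (σ u) (σ v)
      Q-up   : ∀ {u} → u ≤ v → u ≢ v → J u → u ⋖ σ u → J (σ u) → Q u v ≈ mix (Q u (σ v)) (Q (σ u) (σ v))
      Q-stop : ∀ {u} → u ≤ v → u ≢ v → J u → u ⋖ σ u → ¬ J (σ u) → Q u v ≈ κ (Q u (σ v))

  -- `F` obeys the recursion of every parabolic matching. Hence `Q` may bring its own matchings,
  -- unrelated to those chosen to define `R`; this is what allows two groups to be compared with one
  -- `F`.
  expansion : (Q : E → E → V) →
    (∀ {u v} → J u → J v → ¬ u ≤ v → Q u v ≈ 0#) → (∀ {v} → J v → Q v v ≈ 1#) →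
    (∀ v → J v → 1 ≤ⁿ rank v → ∃[ σ ] Recursive Q v σ) →
    ∀ {u v} → J u → J v → Q u v ≈ F u v
  expansion Q Q-≰ Q-refl rec {u} {v} = go (rank v) refl
    where
    go : ∀ k {u v} → rank v ≡ k → J u → J v → Q u v ≈ F u v
    go k {u} {v} r ju jv with u ≤? v | u ≟ v
    ... | no u≰v  | _ = ≈-trans (Q-≰ ju jv u≰v) (≈-sym (F-≰ u≰v))
    ... | yes _   | yes refl = ≈-trans (Q-refl ju) (≈-sym (F-refl ju))
    go zero {u} {v} r ju jv | yes u≤v | no u≢v = ⊥-elim (u≢v (rank-inj u≤v
      (trans (ℕₚ.n≤0⇒n≡0 (subst (rank u ≤ⁿ_) r (rank-mono u≤v))) (sym r))))
    go (suc k) {u} {v} r ju jv | yes u≤v | no u≢v = step (rec v jv (subst (1 ≤ⁿ_) (sym r) (s≤s z≤n)))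
      where
      step : ∃[ σ ] Recursive Q v σ → Q u v ≈ F u v
      step (σ , rc) = cases (updown u≤v)
        where
        open Recursive rc
        open Parabolic parabolic
        open Sp special
        jσv : J (σ v)
        jσv = J-down ≤-refl jv lowers
        IH : ∀ {x} → J x → Q x (σ v) ≈ F x (σ v)
        IH jx = go k (rank-⋖ lowers r) jx jσv
        cases : (u ⋖ σ u) ⊎ (σ u ⋖ u) → Q u v ≈ F u v
        cases (inj₂ d) = ≈-trans (Q-down u≤v u≢v ju d) (≈-trans (IH (J-down u≤v ju d)) (≈-sym (F-down parabolic u≤v ju d)))
        cases (inj₁ uu) = stop? (J? (σ u))
          where
          stop? : Dec (J (σ u)) → Q u v ≈ F u v
          stop? (yes j) = ≈-trans (Q-up u≤v u≢v ju uu j) (≈-trans (mix-cong (IH ju) (IH j)) (≈-sym (F-up parabolic u≤v uu j)))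
          stop? (no ¬j) = ≈-trans (Q-stop u≤v u≢v ju uu ¬j) (≈-trans (κ-cong (IH ju)) (≈-sym (F-stop parabolic u≤v ju uu ¬j)))

-- Coefficient sequences over ℤ

module Polynomials where
  open import Data.Integer using (ℤ; 0ℤ; 1ℤ; _+_; _*_; -_)
  open import Data.Nat using (_≤_)
  open +-*-Solver using (solve; _:=_; _:+_; :-_; con)

  polynomials : CommutativeMonoid 0ℓ 0ℓ
  polynomials = record
    { Carrier = Poly ; _≈_ = _≗ₚ_ ; _∙_ = _+ₚ_ ; ε = 0ₚ
    ; isCommutativeMonoid = record
      { isMonoid = record
        { isSemigroup = record
          { isMagma = record
            { isEquivalence = record { refl = λ _ → refl ; sym = λ p n → sym (p n) ; trans = λ p q n → trans (p n) (q n) }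
            ; ∙-cong = λ p q n → cong₂ _+_ (p n) (q n) }
          ; assoc = λ P Q R n → ℤₚ.+-assoc (P n) (Q n) (R n) }
        ; identity = (λ P n → ℤₚ.+-identityˡ (P n)) , λ P n → ℤₚ.+-identityʳ (P n) }
      ; comm = λ P Q n → ℤₚ.+-comm (P n) (Q n) } }

  open CommutativeMonoid polynomials public using () renaming (refl to ≗-refl; sym to ≗-sym; trans to ≗-trans; ∙-cong to +ₚ-cong)

  sumUpTo-cong : ∀ n {f g : ℕ → ℤ} → (∀ i → f i ≡ g i) → sumUpTo n f ≡ sumUpTo n g
  sumUpTo-cong zero    e = e 0
  sumUpTo-cong (suc n) e = cong₂ _+_ (sumUpTo-cong n e) (e (suc n))

  sumUpTo-+ : ∀ n (f g : ℕ → ℤ) → sumUpTo n (λ i → f i + g i) ≡ sumUpTo n f + sumUpTo n g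
  sumUpTo-+ zero    f g = refl
  sumUpTo-+ (suc n) f g = trans (cong (_+ (f (suc n) + g (suc n))) (sumUpTo-+ n f g))
    (solve 4 (λ a b c d → (a :+ b) :+ (c :+ d) := (a :+ c) :+ (b :+ d)) refl (sumUpTo n f) (sumUpTo n g) (f (suc n)) (g (suc n)))

  sumUpTo-neg : ∀ n (f : ℕ → ℤ) → sumUpTo n (λ i → - f i) ≡ - sumUpTo n f
  sumUpTo-neg zero    f = refl
  sumUpTo-neg (suc n) f = trans (cong (_+ - f (suc n)) (sumUpTo-neg n f)) (sym (ℤₚ.neg-distrib-+ (sumUpTo n f) (f (suc n))))

  sumUpTo-head : ∀ n (f : ℕ → ℤ) → (∀ i → f (suc i) ≡ 0ℤ) → sumUpTo n f ≡ f 0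
  sumUpTo-head zero    f z = refl
  sumUpTo-head (suc n) f z = trans (cong₂ _+_ (sumUpTo-head n f z) (z n)) (ℤₚ.+-identityʳ (f 0))

  sumUpTo-tail : ∀ n (f : ℕ → ℤ) → sumUpTo (suc n) f ≡ f 0 + sumUpTo n (λ i → f (suc i))
  sumUpTo-tail zero    f = refl
  sumUpTo-tail (suc n) f = trans (cong (_+ f (suc (suc n))) (sumUpTo-tail n f)) (ℤₚ.+-assoc (f 0) _ _)

  *ₚ-cong : ∀ {P P′ Q Q′} → P ≗ₚ P′ → Q ≗ₚ Q′ → (P *ₚ Q) ≗ₚ (P′ *ₚ Q′)
  *ₚ-cong p q n = sumUpTo-cong n λ i → cong₂ _*_ (p i) (q (n ∸ i))

  *ₚ-distribʳ : ∀ P A B → ((A +ₚ B) *ₚ P) ≗ₚ ((A *ₚ P) +ₚ (B *ₚ P))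
  *ₚ-distribʳ P A B n = trans (sumUpTo-cong n λ i → ℤₚ.*-distribʳ-+ (P (n ∸ i)) (A i) (B i)) (sumUpTo-+ n _ _)

  *ₚ-neg : ∀ P A → ((-ₚ A) *ₚ P) ≗ₚ (-ₚ (A *ₚ P))
  *ₚ-neg P A n = trans (sumUpTo-cong n λ i → sym (ℤₚ.neg-distribˡ-* (A i) (P (n ∸ i)))) (sumUpTo-neg n _)

  *ₚ-identityˡ : ∀ P → (1ₚ *ₚ P) ≗ₚ P
  *ₚ-identityˡ P n = trans (sumUpTo-head n (λ i → 1ₚ i * P (n ∸ i)) λ i → ℤₚ.*-zeroˡ (P (n ∸ suc i))) (ℤₚ.*-identityˡ (P n))

  shift : Poly → Poly
  shift P zero    = 0ℤ
  shift P (suc n) = P n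

  qₚ-* : ∀ P → (qₚ *ₚ P) ≗ₚ shift P
  qₚ-* P zero    = ℤₚ.*-zeroˡ (P 0)
  qₚ-* P (suc n) = begin
    (qₚ *ₚ P) (suc n)                              ≡⟨ sumUpTo-tail n _ ⟩
    0ℤ * P (suc n) + sumUpTo n (λ i → qₚ (suc i) * P (n ∸ i)) ≡⟨ cong₂ _+_ (ℤₚ.*-zeroˡ (P (suc n))) (sumUpTo-head n (λ i → qₚ (suc i) * P (n ∸ i)) λ i → ℤₚ.*-zeroˡ (P (n ∸ suc i))) ⟩
    0ℤ + 1ℤ * P n                                  ≡⟨ trans (ℤₚ.+-identityˡ _) (ℤₚ.*-identityˡ (P n)) ⟩
    P n                                            ∎
    where open ≡-Reasoning

  shift-cong : ∀ {P Q} → P ≗ₚ Q → shift P ≗ₚ shift Q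
  shift-cong e zero    = refl
  shift-cong e (suc n) = e n

  neg-cong : ∀ {P Q} → P ≗ₚ Q → (-ₚ P) ≗ₚ (-ₚ Q)
  neg-cong e n = cong -_ (e n)

  xₚ-times : X → Poly → Poly
  xₚ-times x=-1 P = -ₚ P
  xₚ-times x=q  P = shift P

  xₚ-* : ∀ x P → (xₚ x *ₚ P) ≗ₚ xₚ-times x P
  xₚ-* x=-1 P = ≗-trans (*ₚ-neg P 1ₚ) (neg-cong (*ₚ-identityˡ P))
  xₚ-* x=q  P = qₚ-* P

  -- With multiplication by `q` as a shift, the operator laws become linear identities between
  -- finitely many coefficients. The lowest degrees are checked apart, since a shift contributes
  -- zero there.
  mixₚ : Poly → Poly → Poly
  mixₚ P Q = (shift P +ₚ (-ₚ P)) +ₚ shift Q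

  mixₚ-* : ∀ P Q → (((qₚ +ₚ (-ₚ 1ₚ)) *ₚ P) +ₚ (qₚ *ₚ Q)) ≗ₚ mixₚ P Q
  mixₚ-* P Q = +ₚ-cong {x = (qₚ +ₚ (-ₚ 1ₚ)) *ₚ P} {y = shift P +ₚ (-ₚ P)}
    (≗-trans (*ₚ-distribʳ P qₚ (-ₚ 1ₚ)) (+ₚ-cong (qₚ-* P) (xₚ-* x=-1 P))) (qₚ-* Q)

  κₚ : X → Poly → Poly
  κₚ x P = shift P +ₚ ((-ₚ P) +ₚ (-ₚ (xₚ-times x P)))

  κₚ-* : ∀ x P → ((qₚ +ₚ ((-ₚ 1ₚ) +ₚ (-ₚ xₚ x))) *ₚ P) ≗ₚ κₚ x P
  κₚ-* x P = ≗-trans (*ₚ-distribʳ P qₚ _) (+ₚ-cong (qₚ-* P)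
    (≗-trans (*ₚ-distribʳ P (-ₚ 1ₚ) (-ₚ xₚ x)) (+ₚ-cong (xₚ-* x=-1 P) (≗-trans (*ₚ-neg P (xₚ x)) (neg-cong (xₚ-* x P))))))

  cₚ : X → Poly → Poly
  cₚ x=-1 P = P
  cₚ x=q  P = -ₚ shift P

  operators : X → Operators polynomials
  operators x = record
    { mix = mixₚ
    ; mix-cong = λ p q → +ₚ-cong (+ₚ-cong (shift-cong p) (neg-cong p)) (shift-cong q)
    ; mix-⊕ = mix-+
    ; mix-0 = λ { zero → refl ; (suc n) → refl }
    ; medial = medial
    ; c = cₚ x
    ; c-cong = c-cong x
    ; c-0 = c-0 x
    ; c-mix = c-mix x
    ; κ = κₚ x
    ; κ-cong = λ p → +ₚ-cong (shift-cong p) (+ₚ-cong (neg-cong p) (neg-cong (x-cong x p)))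
    ; κ-⊕ = κ-+ x
    ; κ-0 = κ-0 x
    ; absorb = absorb x }
    where
    mix-+ : ∀ a b a′ b′ → mixₚ (a +ₚ a′) (b +ₚ b′) ≗ₚ (mixₚ a b +ₚ mixₚ a′ b′)
    mix-+ a b a′ b′ zero = solve 2 (λ a a′ → con 0ℤ :+ :- (a :+ a′) :+ con 0ℤ := (con 0ℤ :+ :- a :+ con 0ℤ) :+ (con 0ℤ :+ :- a′ :+ con 0ℤ)) refl (a 0) (a′ 0)
    mix-+ a b a′ b′ (suc n) = solve 6 (λ a₁ a a′₁ a′ b b′ → (a :+ a′) :+ :- (a₁ :+ a′₁) :+ (b :+ b′) :=
      (a :+ :- a₁ :+ b) :+ (a′ :+ :- a′₁ :+ b′)) refl (a (suc n)) (a n) (a′ (suc n)) (a′ n) (b n) (b′ n)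
    medial : ∀ a b a′ b′ → mixₚ (mixₚ a b) (mixₚ a′ b′) ≗ₚ mixₚ (mixₚ a a′) (mixₚ b b′)
    medial a b a′ b′ zero = refl
    medial a b a′ b′ (suc zero) = solve 5 (λ a₀ b a′ a₁ b₀ → (con 0ℤ :+ :- a₀ :+ con 0ℤ) :+ :- (a₀ :+ :- a₁ :+ b₀) :+ (con 0ℤ :+ :- a′ :+ con 0ℤ)
      := (con 0ℤ :+ :- a₀ :+ con 0ℤ) :+ :- (a₀ :+ :- a₁ :+ a′) :+ (con 0ℤ :+ :- b₀ :+ con 0ℤ)) refl (a 0) (b 1) (a′ 0) (a 1) (b 0)
    medial a b a′ b′ (suc (suc n)) = solve 8 (λ a₀ a₁ a₂ b₀ b₁ c₀ c₁ d₀ →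
      (a₀ :+ :- a₁ :+ b₀) :+ :- (a₁ :+ :- a₂ :+ b₁) :+ (c₀ :+ :- c₁ :+ d₀)
      := (a₀ :+ :- a₁ :+ c₀) :+ :- (a₁ :+ :- a₂ :+ c₁) :+ (b₀ :+ :- b₁ :+ d₀)) refl
      (a n) (a (suc n)) (a (suc (suc n))) (b n) (b (suc n)) (a′ n) (a′ (suc n)) (b′ n)
    c-cong : ∀ x {a b} → a ≗ₚ b → cₚ x a ≗ₚ cₚ x b
    c-cong x=-1 p = p
    c-cong x=q  p = neg-cong (shift-cong p)
    x-cong : ∀ x {a b} → a ≗ₚ b → xₚ-times x a ≗ₚ xₚ-times x b
    x-cong x=-1 p = neg-cong p
    x-cong x=q  p = shift-cong p
    c-0 : ∀ x → cₚ x 0ₚ ≗ₚ 0ₚ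
    c-0 x=-1 n       = refl
    c-0 x=q  zero    = refl
    c-0 x=q  (suc n) = refl
    c-mix : ∀ x a b → cₚ x (mixₚ a b) ≗ₚ mixₚ (cₚ x a) (cₚ x b)
    c-mix x=-1 a b n = refl
    c-mix x=q  a b zero = refl
    c-mix x=q  a b (suc zero) = solve 1 (λ a → :- (con 0ℤ :+ :- a :+ con 0ℤ) := con 0ℤ :+ :- (:- a) :+ con 0ℤ) refl (a 0)
    c-mix x=q  a b (suc (suc n)) = solve 3 (λ a₀ a₁ b → :- (a₀ :+ :- a₁ :+ b) := :- a₀ :+ :- (:- a₁) :+ :- b) refl (a n) (a (suc n)) (b n)
    κ-0 : ∀ x → κₚ x 0ₚ ≗ₚ 0ₚ
    κ-0 x=-1 zero    = refl
    κ-0 x=-1 (suc n) = refl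
    κ-0 x=q  zero    = refl
    κ-0 x=q  (suc n) = refl
    κ-+ : ∀ x a b → κₚ x (a +ₚ b) ≗ₚ (κₚ x a +ₚ κₚ x b)
    κ-+ x=-1 a b zero = solve 2 (λ a b → con 0ℤ :+ (:- (a :+ b) :+ :- (:- (a :+ b))) := (con 0ℤ :+ (:- a :+ :- (:- a))) :+ (con 0ℤ :+ (:- b :+ :- (:- b)))) refl (a 0) (b 0)
    κ-+ x=-1 a b (suc n) = solve 4 (λ a′ b′ a b → (a′ :+ b′) :+ (:- (a :+ b) :+ :- (:- (a :+ b))) := (a′ :+ (:- a :+ :- (:- a))) :+ (b′ :+ (:- b :+ :- (:- b)))) refl (a n) (b n) (a (suc n)) (b (suc n))
    κ-+ x=q a b zero = solve 2 (λ a b → con 0ℤ :+ (:- (a :+ b) :+ :- con 0ℤ) := (con 0ℤ :+ (:- a :+ :- con 0ℤ)) :+ (con 0ℤ :+ (:- b :+ :- con 0ℤ))) refl (a 0) (b 0)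
    κ-+ x=q a b (suc n) = solve 4 (λ a′ b′ a b → (a′ :+ b′) :+ (:- (a :+ b) :+ :- (a′ :+ b′)) := (a′ :+ (:- a :+ :- a′)) :+ (b′ :+ (:- b :+ :- b′))) refl (a n) (b n) (a (suc n)) (b (suc n))
    absorb : ∀ x a b → (mixₚ a b +ₚ cₚ x a) ≗ₚ κₚ x (a +ₚ cₚ x b)
    absorb x=-1 a b zero = solve 2 (λ a b → (con 0ℤ :+ :- a :+ con 0ℤ) :+ a := con 0ℤ :+ (:- (a :+ b) :+ :- (:- (a :+ b)))) refl (a 0) (b 0)
    absorb x=-1 a b (suc n) = solve 4 (λ a′ b′ a b → (a′ :+ :- a :+ b′) :+ a := (a′ :+ b′) :+ (:- (a :+ b) :+ :- (:- (a :+ b)))) refl (a n) (b n) (a (suc n)) (b (suc n))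
    absorb x=q a b zero = solve 1 (λ a → (con 0ℤ :+ :- a :+ con 0ℤ) :+ (:- con 0ℤ) := con 0ℤ :+ (:- (a :+ (:- con 0ℤ)) :+ :- con 0ℤ)) refl (a 0)
    absorb x=q a b (suc zero) = solve 3 (λ a₀ b₀ a₁ → (a₀ :+ :- a₁ :+ b₀) :+ (:- a₀) := (a₀ :+ (:- con 0ℤ)) :+ (:- (a₁ :+ (:- b₀)) :+ :- (a₀ :+ (:- con 0ℤ)))) refl (a 0) (b 0) (a 1)
    absorb x=q a b (suc (suc n)) = solve 4 (λ a₀ b₀ a₁ b₁ → (a₀ :+ :- a₁ :+ b₀) :+ (:- a₀) := (a₀ :+ (:- b₁)) :+ (:- (a₁ :+ (:- b₀)) :+ :- (a₀ :+ (:- b₁)))) refl (a (suc n)) (b (suc n)) (a (suc (suc n))) (b n)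

  -- For `2k ≥ d` the coefficients of `P` and `P′` vanish; for `2k < d` those of the reversed
  -- polynomials do, and the equation reduces to `P′ k ≡ P k`. It is stated with the polynomials on
  -- opposite sides to avoid subtraction.
  rev-injective : ∀ d {P P′ : Poly} → (∀ k → d ≤ 2 ℕ.* k → P k ≡ 0ℤ) → (∀ k → d ≤ 2 ℕ.* k → P′ k ≡ 0ℤ) →
    (∀ k → revₚ d P k + P′ k ≡ revₚ d P′ k + P k) → P ≗ₚ P′
  rev-injective d {P} {P′} small small′ eq k with d ℕ.≤? 2 ℕ.* k
  ... | yes d≤2k = trans (small k d≤2k) (sym (small′ k d≤2k))
  ... | no d≰2k  = sym (let open ≡-Reasoning in begin
      P′ k              ≡⟨ ℤₚ.+-identityˡ _ ⟨
      0ℤ + P′ k         ≡⟨ cong (_+ P′ k) (vanish P small) ⟨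
      revₚ d P k + P′ k ≡⟨ eq k ⟩
      revₚ d P′ k + P k ≡⟨ cong (_+ P k) (vanish P′ small′) ⟩
      0ℤ + P k          ≡⟨ ℤₚ.+-identityˡ _ ⟩
      P k               ∎)
    where
    k+k≤d : k ℕ.+ k ≤ d
    k+k≤d = subst (_≤ d) (cong (k ℕ.+_) (ℕₚ.+-identityʳ k)) (ℕₚ.<⇒≤ (ℕₚ.≰⇒> d≰2k))
    vanish : ∀ P → (∀ k → d ≤ 2 ℕ.* k → P k ≡ 0ℤ) → revₚ d P k ≡ 0ℤ
    vanish P small with k ℕ.≤? d
    ... | no _    = refl
    ... | yes k≤d = small (d ∸ k) (begin
        d                       ≡⟨ ℕₚ.m∸n+n≡m k≤d ⟨
        (d ∸ k) ℕ.+ k           ≤⟨ ℕₚ.+-monoʳ-≤ (d ∸ k) (ℕₚ.m+n≤o⇒m≤o∸n k k+k≤d) ⟩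
        (d ∸ k) ℕ.+ (d ∸ k)     ≡⟨ cong ((d ∸ k) ℕ.+_) (ℕₚ.+-identityʳ (d ∸ k)) ⟨
        2 ℕ.* (d ∸ k)           ∎)
      where open ℕₚ.≤-Reasoning

  ∑ₚ : {A : Set} → (A → Poly) → List A → Poly
  ∑ₚ t = foldr (λ z acc → t z +ₚ acc) 0ₚ

  module _ {A B : Set} (g : A → B) {t : A → Poly} {t′ : B → Poly} {k : ℕ} where
    ∑ₚ-map : ∀ zs → (∀ z → z ∈ zs → t z k ≡ t′ (g z) k) → ∑ₚ t zs k ≡ ∑ₚ t′ (map g zs) k
    ∑ₚ-map []       eq = refl
    ∑ₚ-map (z ∷ zs) eq = cong₂ _+_ (eq z (here refl)) (∑ₚ-map zs λ z i → eq z (there i))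

    -- The entry equivalent to `u` carries the polynomials still to be compared, so the sums are
    -- related up to that term: each side receives the exceptional value of the other.
    ∑ₚ-map-except : ∀ {_≈_ : A → A → Set} {u α β} zs → AllPairs (λ a b → ¬ (a ≈ b)) zs → Any (λ z → u ≈ z) zs →
      (∀ {a b} → a ≈ b → b ≈ a) → (∀ {a b c} → a ≈ b → b ≈ c → a ≈ c) →
      (∀ z → z ∈ zs → ¬ (u ≈ z) → t z k ≡ t′ (g z) k) → (∀ z → u ≈ z → t z k ≡ α × t′ (g z) k ≡ β) →
      ∑ₚ t zs k + β ≡ ∑ₚ t′ (map g zs) k + α
    ∑ₚ-map-except {u = u} {α} {β} (z ∷ zs) (ne ∷ _) (here e) ≈-sym ≈-trans eq at = begin
        (t z k + ∑ₚ t zs k) + β                ≡⟨ cong₂ (λ a b → (a + b) + β) (proj₁ (at z e))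
          (∑ₚ-map zs λ z′ i → eq z′ (there i) λ f → All.lookup ne i (≈-trans (≈-sym e) f)) ⟩
        (α + ∑ₚ t′ (map g zs) k) + β           ≡⟨ solve 3 (λ α s β → (α :+ s) :+ β := (β :+ s) :+ α) refl α _ β ⟩
        (β + ∑ₚ t′ (map g zs) k) + α           ≡⟨ cong (λ b → (b + ∑ₚ t′ (map g zs) k) + α) (proj₂ (at z e)) ⟨
        (t′ (g z) k + ∑ₚ t′ (map g zs) k) + α  ∎
      where open ≡-Reasoning
    ∑ₚ-map-except {u = u} {α} {β} (z ∷ zs) (ne ∷ distinct) (there p) ≈-sym ≈-trans eq at = begin
        (t z k + ∑ₚ t zs k) + β                   ≡⟨ ℤₚ.+-assoc (t z k) _ β ⟩
        t z k + (∑ₚ t zs k + β)                   ≡⟨ cong₂ _+_ (eq z (here refl) λ f → All.lookupWith (λ n e → n (≈-trans (≈-sym f) e)) ne p)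
          (∑ₚ-map-except zs distinct p ≈-sym ≈-trans (λ z i → eq z (there i)) at) ⟩
        t′ (g z) k + (∑ₚ t′ (map g zs) k + α)     ≡⟨ ℤₚ.+-assoc (t′ (g z) k) _ α ⟨
        (t′ (g z) k + ∑ₚ t′ (map g zs) k) + α     ∎
      where open ≡-Reasoning

open Polynomials

open Classical ⊥

-- Bruhat intervals as finite posets

module MinimalRepresentatives (W : CoxeterSystem) (H : CoxeterSystem.S W → Set) where
  open import Data.Nat using (_+_)
  open CoxeterSystem W
  open Coxeter W renaming (_≈_ to infix 4 _≈_; _≤B_ to infix 4 _≤B_; _ℓ<_ to infix 4 _ℓ<_)
  open Parabolic H using (InWH)
  open Words W ⊥
  open Length W
  open BruhatOrder W

  InWH-cong : ∀ {x y} → x ~ y → InWH x → InWH y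
  InWH-cong e i s h (a , b , la , lb , lt) = e λ e →
    i s h (a , b , Len-cong (≈-++ (≈-sym e) ≈-refl) la , Len-cong (≈-sym e) lb , lt)

  ascent : ∀ {u r a b} → InWH u → H r → Len u a → Len (u ++ [ r ]) b → C (b ≡ suc a × u ⊑ u ++ [ r ])
  ascent {r = r} i h p q = do
    inj₁ up ← Multiplication.σ-Len (right r) p q
      where inj₂ (eq , _) → impossible (i r h (_ , _ , q , p , ℕₚ.≤-reflexive (sym eq)))
    return up

  ⊑-ascent : ∀ {u r} → InWH u → H r → u ⊑ u ++ [ r ]
  ⊑-ascent {u} {r} i h = do
    (a , la) ← Len-total u
    (b , lb) ← Len-total (u ++ [ r ])
    (_ , p) ← ascent i h la lb
    p

  descent : ∀ {z} → ¬ InWH z → C (∃[ r ] (H r × DR r z))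
  descent ¬i = em (∃[ r ] (H r × DR r _)) >>= λ
    { (inj₁ d) → return d
    ; (inj₂ n) → impossible (¬i λ r h d → n (r , h , d)) }

  -- Lifting on the right, as `r` is an ascent of `y`: removing letters of `H` from the right of `z`
  -- keeps every minimal element below it.
  strip : ∀ {y z r} → InWH y → H r → y ⊑ z → y ⊑ z ++ [ r ]
  strip {r = r} i h l = Multiplication.drop (right r) l (⊑-reflexive ~-refl) (⊑-ascent i h)

  -- The last clause records that right factors from `H` do not destroy left descents of the
  -- representative; `p-down` rests on it.
  Projects : Word → Word → Set
  Projects z p = InWH p × p ⊑ z × (∀ y → InWH y → y ⊑ z → y ⊑ p) × (∀ s → s ∷ p ⊑ p → s ∷ z ⊑ z)

  left-descent-++ : ∀ {z r a s} → Len z (suc a) → Len (z ++ [ r ]) a → s ∷ z ++ [ r ] ⊑ z ++ [ r ] → s ∷ z ⊑ z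
  left-descent-++ {z} {r} {a} {s} lz lzr d = do
    (b , lb) ← Len-total (s ∷ z)
    inj₁ (eq , _) ← Multiplication.σ-Len (left s) lz lb
      where inj₂ (_ , p) → p
    (c , lc) ← Len-total (s ∷ z ++ [ r ])
    (d′ , ld) ← Len-total [ r ]
    e ← Multiplication.σσ (right r) (s ∷ z)
    ⊥-elim (ℕₚ.<-irrefl refl (begin-strict
      b         ≤⟨ Len-++ lc ld (Len-cong (≈-sym e) lb) ⟩
      c + d′    ≤⟨ ℕₚ.+-mono-≤ (⊑-Len d lc lzr) (Len-letter ld) ⟩
      a + 1     ≡⟨ ℕₚ.+-comm a 1 ⟩
      suc a     <⟨ ℕₚ.n<1+n _ ⟩
      suc (suc a) ≡⟨ eq ⟨
      b         ∎))
    where open ℕₚ.≤-Reasoning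

  project : ∀ z → C (∃[ p ] Projects z p)
  project z = do
      (k , lz) ← Len-total z
      go k lz
    where
    go : ∀ k {z} → Len z k → C (∃[ p ] Projects z p)
    go k {z} lz = em (InWH z) >>= λ
      { (inj₁ i)  → return (z , i , ⊑-reflexive ~-refl , (λ _ _ l → l) , λ _ d → d)
      ; (inj₂ ¬i) → descent ¬i >>= λ (r , h , a , b , la , lb , lt) →
          further k lz h la (subst (a <_) (Len-unique lb lz ~-refl) lt) }
      where
      further : ∀ k {z r a} → Len z k → H r → Len (z ++ [ r ]) a → a < k → C (∃[ p ] Projects z p)
      further (suc k) {z} {r} {a} lz h la lt = do
        inj₂ (eq , zr⊑z) ← Multiplication.σ-Len (right r) lz la
          where inj₁ (eq , _) → ⊥-elim (ℕₚ.<⇒≱ lt (ℕₚ.≤-trans (ℕₚ.n≤1+n _) (ℕₚ.≤-reflexive (sym eq))))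
        let lzr = subst (Len (z ++ [ r ])) (sym (ℕₚ.suc-injective eq)) la
        (p , i , p⊑ , max , desc) ← go k lzr
        return (p , i , ⊑-trans p⊑ zr⊑z , (λ y j l → max y j (strip j h l)) , λ s d → left-descent-++ lz lzr (desc s d))

  -- A descent `r` of `s u` in `H` would give `ℓ(u r) ≤ 1 + ℓ(s u r) < 1 + ℓ(s u) =
  -- ℓ(u)`, although `r` is an ascent of `u`.
  InWH-down : ∀ {s u} → InWH u → s ∷ u ⊑ u → InWH (s ∷ u)
  InWH-down {s} {u} i d r h (a , b , la , lb , lt) = run do
    (c , lc) ← Len-total u
    inj₂ (eq , _) ← Multiplication.σ-Len (left s) lc lb
      where inj₁ (eq , _) → ⊥-elim (ℕₚ.<⇒≱ (ℕₚ.≤-reflexive (sym eq)) (⊑-Len d lb lc))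
    (e , le) ← Len-total (u ++ [ r ])
    (eq′ , _) ← ascent i h lc le
    (k , lk) ← Len-total [ s ]
    f ← tt-cancel (u ++ [ r ]) (Refl-letter s)
    impossible (ℕₚ.<-irrefl refl (begin-strict
      e         ≤⟨ Len-++ lk la (Len-cong (≈-sym f) le) ⟩
      k + a     ≤⟨ ℕₚ.+-monoˡ-≤ a (Len-letter lk) ⟩
      suc a     <⟨ s≤s lt ⟩
      suc b     ≡⟨ eq ⟨
      c         <⟨ ℕₚ.n<1+n c ⟩
      suc c     ≡⟨ eq′ ⟨
      e         ∎))
    where open ℕₚ.≤-Reasoning

  -- If s u > u is not minimal then s u = u r for some r in H.
  stop : ∀ {s u y} → InWH u → u ⊑ s ∷ u → ¬ InWH (s ∷ u) → InWH y → y ⊑ s ∷ u → y ⊑ u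
  stop {s} {u} i up ¬i j l = do
    (r , h , a , b , la , lb , lt) ← descent ¬i
    (c , lc) ← Len-total u
    (k , lk) ← Len-total [ s ]
    let u⊑sur = strip i h up
        a≤c = s≤s⁻¹ (ℕₚ.≤-trans lt (ℕₚ.≤-trans (Len-++ lk lc lb) (ℕₚ.+-monoˡ-≤ c (Len-letter lk))))
        u~sur = ⊑-Len-≡ u⊑sur lc (subst (Len (s ∷ u ++ [ r ])) (ℕₚ.≤-antisym a≤c (⊑-Len u⊑sur lc la)) la)
    ⊑-resp ~-refl (~-sym u~sur) (strip j h l)

-- Classical choice over a finite index set. Matchings and projections become ordinary functions in
-- this way.
collect : ∀ n {P : Fin n → Set} → (∀ i → C (P i)) → C (∀ i → P i)
collect zero    f = return λ ()
collect (suc n) f = do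
  p ← f Fin.zero
  q ← collect n (f ∘ Fin.suc)
  return λ { Fin.zero → p ; (Fin.suc i) → q i }

-- The elements below the elements elt x, with order, length and membership in W^H tabulated.
record Enumeration (W : CoxeterSystem) (H : CoxeterSystem.S W → Set) {n} (leq : Fin n → Fin n → Bool)
  (rank : Fin n → ℕ) (inH : Fin n → Bool) : Set where
  open Coxeter W using (Word; Len)
  open Coxeter.Parabolic W H using (InWH)
  open Words W ⊥ using (_~_)
  open BruhatOrder W using (_⊑_)
  field
    elt     : Fin n → Word
    elt-Len : ∀ x → Len (elt x) (rank x)
    elt-leq : ∀ x y → Is (leq x y) (elt x ⊑ elt y)
    elt-inH : ∀ x → Is (inH x) (InWH (elt x))
    elt-inj : ∀ {x y} → elt x ~ elt y → x ≡ y
    lower   : ∀ x {w} → w ⊑ elt x → C (∃[ y ] elt y ~ w)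

module Enumerated {W H n leq rank inH} (e : Enumeration W H {n} leq rank inH) where
  open import Data.Nat using (_+_)
  open CoxeterSystem W
  open Coxeter W renaming (_≈_ to infix 4 _≈_; _≤B_ to infix 4 _≤B_; _ℓ<_ to infix 4 _ℓ<_)
  open Words W ⊥
  open Length W
  open BruhatOrder W
  open Enumeration e

  infix 4 _≤_ _≤?_
  _≤_ : Fin n → Fin n → Set
  x ≤ y = leq x y ≡ true

  _≤?_ : ∀ x y → Dec (x ≤ y)
  x ≤? y = leq x y Boolₚ.≟ true

  open Covers _≤_ rank

  to-⊑ : ∀ {x y} → x ≤ y → elt x ⊑ elt y
  to-⊑ {x} {y} l with leq x y | elt-leq x y
  ... | true | p = p

  from-⊑ : ∀ {x y} → elt x ⊑ elt y → x ≤ y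
  from-⊑ {x} {y} p with leq x y | elt-leq x y
  ... | true  | _  = refl
  ... | false | ¬p = ⊥-elim (¬p p)

  ≤-refl : ∀ {x} → x ≤ x
  ≤-refl = from-⊑ (⊑-reflexive ~-refl)

  ≤-trans : ∀ {x y z} → x ≤ y → y ≤ z → x ≤ z
  ≤-trans p q = from-⊑ (⊑-trans (to-⊑ p) (to-⊑ q))

  rank-mono : ∀ {x y} → x ≤ y → rank x ≤ⁿ rank y
  rank-mono l = ⊑-Len (to-⊑ l) (elt-Len _) (elt-Len _)

  rank-inj : ∀ {x y} → x ≤ y → rank x ≡ rank y → x ≡ y
  rank-inj {x} {y} l r = elt-inj (⊑-Len-≡ (to-⊑ l) (elt-Len x) (subst (Len (elt y)) (sym r) (elt-Len y)))

  ⋖? : ∀ x y → Dec (x ⋖ y)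
  ⋖? x y = (x ≤? y) ×-dec (rank y ℕ.≟ suc (rank x))

  ⋖⇒Cov : ∀ {x y} → x ⋖ y → WordCovers.Cov W (elt x) (elt y)
  ⋖⇒Cov {x} {y} (l , r) = ⊑⇒Cov (to-⊑ l) (elt-Len x) (subst (Len (elt y)) r (elt-Len y))

  Len-at : ∀ {x k} → rank x ≡ k → Len (elt x) k
  Len-at refl = elt-Len _

  record Acts (μ : Word → Word) (w : Fin n) (σ : Fin n → Fin n) : Set where
    field
      acts    : ∀ {x} → x ≤ w → elt (σ x) ~ μ (elt x)
      special : Special w σ
      lowers  : σ w ⋖ w

  action : ∀ {μ} → Multiplication μ → ∀ w → μ (elt w) ⊑ elt w → C (∃[ σ ] Acts μ w σ)
  action {μ} M w desc = do
      f ← collect n image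
      return ((λ x → proj₁ (f x)) , result (λ x → proj₁ (f x)) λ {x} → proj₂ (f x))
    where
    open Multiplication M
    image : ∀ x → C (∃[ y ] (x ≤ w → elt y ~ μ (elt x)))
    image x with x ≤? w
    -- An arbitrary value: `Acts` constrains `σ` only below `w`.
    ... | no x≰w  = return (x , λ l → ⊥-elim (x≰w l))
    ... | yes x≤w = do
      (y , p) ← lower w (lift (to-⊑ x≤w) (⊑-reflexive ~-refl) desc)
      return (y , λ _ → p)
    result : ∀ σ → (∀ {x} → x ≤ w → elt (σ x) ~ μ (elt x)) → Acts μ w σ
    result σ acts = record { acts = acts ; special = sp ; lowers = low (updown ≤-refl) }
      where
      stays : ∀ {x} → x ≤ w → σ x ≤ w
      stays l = from-⊑ (⊑-resp (~-sym (acts l)) ~-refl (lift (to-⊑ l) (⊑-reflexive ~-refl) desc))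
      above : ∀ {x y} → x ≤ w → elt y ⊑ μ (elt x) → y ≤ σ x
      above l p = from-⊑ (⊑-resp ~-refl (~-sym (acts l)) p)
      below : ∀ {x y} → x ≤ w → μ (elt x) ⊑ elt y → σ x ≤ y
      below l p = from-⊑ (⊑-resp (~-sym (acts l)) ~-refl p)
      updown : ∀ {x} → x ≤ w → (x ⋖ σ x) ⊎ (σ x ⋖ x)
      updown {x} l = decidable-stable (⋖? x (σ x) ⊎-dec ⋖? (σ x) x) do
        f ← acts l
        inj₁ (r , p) ← σ-Len (elt-Len x) (Len-cong f (elt-Len (σ x)))
          where inj₂ (r , p) → return (inj₂ (below l p , r))
        return (inj₁ (above l p , r))
      up⇒⊑ : ∀ {x} → x ≤ w → x ⋖ σ x → elt x ⊑ μ (elt x)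
      up⇒⊑ l u = ⊑-resp ~-refl (acts l) (to-⊑ (proj₁ u))
      down⇒⊑ : ∀ {x} → x ≤ w → σ x ⋖ x → μ (elt x) ⊑ elt x
      down⇒⊑ l d = ⊑-resp (acts l) ~-refl (to-⊑ (proj₁ d))
      low : (w ⋖ σ w) ⊎ (σ w ⋖ w) → σ w ⋖ w
      low (inj₂ d) = d
      low (inj₁ u) = ⊥-elim (ℕₚ.<⇒≱ (ℕₚ.≤-reflexive (sym (proj₂ u))) (rank-mono (stays ≤-refl)))
      sp : Special w σ
      sp = record
        { stays = stays
        ; invol = λ {x} l → elt-inj (~-trans (acts (stays l)) (~-trans (σ-cong (acts l)) (σσ (elt x))))
        ; updown = updown
        ; up-up = λ x≤y y≤w ux uy → below (≤-trans x≤y y≤w) (⊑-resp ~-refl (~-sym (acts y≤w))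
            (lift (to-⊑ x≤y) (up⇒⊑ y≤w uy) (⊑-reflexive ~-refl)))
        ; down-down = λ x≤y y≤w dx dy → above y≤w (⊑-resp (~-sym (acts (≤-trans x≤y y≤w))) ~-refl
            (drop (to-⊑ x≤y) (down⇒⊑ (≤-trans x≤y y≤w) dx) (⊑-reflexive ~-refl)))
        ; up-down = λ x≤y y≤w ux dy → above y≤w (drop (to-⊑ x≤y) (⊑-reflexive ~-refl) (up⇒⊑ (≤-trans x≤y y≤w) ux))
        }

  acts-distinct : ∀ {μ ν w σ τ} → Acts μ w σ → Acts ν w τ → ¬ (μ (elt w) ~ ν (elt w)) → σ w ≢ τ w
  acts-distinct a b ne eq = ne (~-trans (~-sym (Acts.acts a ≤-refl)) (~-trans (~-reflexive (cong elt eq)) (Acts.acts b ≤-refl)))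

  -- A first letter s and a last letter r of reduced words of elt w.
  descents : ∀ w → 1 ≤ⁿ rank w → ∃[ s ] (s ∷ elt w ⊑ elt w ×
    (2 ≤ⁿ rank w → ∃[ r ] (elt w ++ [ r ] ⊑ elt w × ¬ (s ∷ elt w ~ elt w ++ [ r ]))))
  descents w 1≤ with reduced (elt-Len w)
  ... | [] , _ , eq , _ = ⊥-elim (ℕₚ.<⇒≢ 1≤ eq)
  ... | s ∷ w′ , e , eq , red = s , left-descent , λ 2≤ → second (initLast w′) e red (subst (2 ≤ⁿ_) (sym eq) 2≤)
    where
    left-descent : s ∷ elt w ⊑ elt w
    left-descent = ⊑-resp (~-trans (~-sym (tt-cancel w′ (Refl-letter s))) (~-++ {[ s ]} ~-refl (return e))) (return e)
      (⊑-reflect (Refl-letter s) (>⇒¬N (Red-suffix [ s ] w′ red) red (ℕₚ.n<1+n _)))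
    second : ∀ {w′} → Data.List.Base.InitLast w′ → s ∷ w′ ≈ elt w → Red (s ∷ w′) → 2 ≤ⁿ suc (length w′) →
      ∃[ r ] (elt w ++ [ r ] ⊑ elt w × ¬ (s ∷ elt w ~ elt w ++ [ r ]))
    second [] _ _ (s≤s ())
    second (u ∷ʳ′ r) e red _ = r , right-descent , distinct
      where
      module M = Multiplication (right r)
      wr~su : elt w ++ [ r ] ~ s ∷ u
      wr~su = ~-trans (~-++ (~-sym (return e)) (~-refl {[ r ]})) (M.σσ (s ∷ u))
      longer : length (s ∷ u ++ [ r ]) ≡ suc (length (s ∷ u))
      longer = cong suc (trans (length-++ u) (ℕₚ.+-comm (length u) 1))
      right-descent : elt w ++ [ r ] ⊑ elt w
      right-descent = do
        inj₁ (_ , p) ← M.σ-Len (Red-prefix (s ∷ u) [ r ] red) red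
          where inj₂ (eq , _) → ⊥-elim (ℕₚ.m≢1+n+m (length (s ∷ u)) {1} (trans eq (cong suc longer)))
        ⊑-resp (~-sym wr~su) (return e) p
      -- Equality would give `elt w ~ s ∷ elt w ++ [ r ] ~ u`, an expression with two letters less.
      distinct : ¬ (s ∷ elt w ~ elt w ++ [ r ])
      distinct f = ℕₚ.<⇒≱ {length u} {length (s ∷ u ++ [ r ])} (ℕₚ.≤-trans (ℕₚ.n≤1+n _) (ℕₚ.≤-reflexive (sym longer)))
        (Len-min red (~-trans (~-sym (tt-cancel u (Refl-letter s))) (~-trans (~-++ {[ s ]} ~-refl (~-sym (~-trans f wr~su)))
          (~-trans (tt-cancel (elt w) (Refl-letter s)) (~-sym (return e))))))

  -- The first matching is recorded as a left multiplication, because the parabolic recursion is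
  -- stated for left descents. The second one only has to be special with another value at `w`.
  Matched : Fin n → Set
  Matched w = 1 ≤ⁿ rank w → ∃[ σ ] ((∃[ s ] Acts (s ∷_) w σ) ×
    (2 ≤ⁿ rank w → ∃[ τ ] (Special w τ × τ w ⋖ w × σ w ≢ τ w)))

  matched : C (∀ w → Matched w)
  matched = collect n table
    where
    table : ∀ w → C (Matched w)
    table w with 1 ℕ.≤? rank w
    ... | no ¬p = return (⊥-elim ∘ ¬p)
    ... | yes p with descents w p
    ...   | s , l , second = do
      (σ , a) ← action (left s) w l
      t ← other σ a (2 ℕ.≤? rank w)
      return λ _ → σ , (s , a) , t
      where
      other : ∀ σ → Acts (s ∷_) w σ → Dec (2 ≤ⁿ rank w) → C (2 ≤ⁿ rank w → ∃[ τ ] (Special w τ × τ w ⋖ w × σ w ≢ τ w))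
      other σ a (no ¬q) = return (⊥-elim ∘ ¬q)
      other σ a (yes q) with second q
      ... | r , l′ , ne = do
        (τ , b) ← action (right r) w l′
        return λ _ → τ , Acts.special b , Acts.lowers b , acts-distinct a b ne

  diamond : (∀ w → Matched w) → Diamond (Fin n)
  diamond m = record
    { _≤_ = _≤_ ; rank = rank ; _≟_ = Finₚ._≟_ ; _≤?_ = _≤?_
    ; ≤-refl = ≤-refl ; ≤-trans = ≤-trans ; rank-mono = rank-mono ; rank-inj = rank-inj
    ; matching = λ w p → let (σ , (_ , a) , _) = m w p in σ , Acts.special a , Acts.lowers a
    ; matchings = λ w p → let (σ , (_ , a) , f) = m w (ℕₚ.≤-trans (s≤s z≤n) p) ; (τ , S , l , ne) = f p in
        σ , τ , Acts.special a , S , Acts.lowers a , l , ne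
    ; no-K32 = λ {y} {y′} {a} {b} {c} y≢ a≢b a≢c b≢c p₁ p₂ p₃ q₁ q₂ q₃ →
        let k = proj₂ p₁
            at : ∀ {b} → b ⋖ y → rank b ≡ rank a
            at q = ℕₚ.suc-injective (trans (sym (proj₂ q)) k) in
        WordCovers.no-K32 W (y≢ ∘ elt-inj) (a≢b ∘ elt-inj) (a≢c ∘ elt-inj) (b≢c ∘ elt-inj)
          (⋖⇒Cov p₁) (⋖⇒Cov p₂) (⋖⇒Cov p₃) (⋖⇒Cov q₁) (⋖⇒Cov q₂) (⋖⇒Cov q₃)
          (elt-Len a) (Len-at (at p₂)) (Len-at (at p₃)) (Len-at k)
    ; no-K23 = λ {a} {b} {y} {y′} {y″} a≢b n₁ n₂ n₃ p₁ p₂ p₃ q₁ q₂ q₃ →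
        WordCovers.no-K23 W (a≢b ∘ elt-inj) (n₁ ∘ elt-inj) (n₂ ∘ elt-inj) (n₃ ∘ elt-inj)
          (⋖⇒Cov p₁) (⋖⇒Cov p₂) (⋖⇒Cov p₃) (⋖⇒Cov q₁) (⋖⇒Cov q₂) (⋖⇒Cov q₃)
          (elt-Len a) (Len-at (ℕₚ.suc-injective (trans (sym (proj₂ q₁)) (proj₂ p₁)))) (Len-at (proj₂ p₁)) (Len-at (proj₂ p₂)) (Len-at (proj₂ p₃))
    }

  open Coxeter.Parabolic W H using (InWH)
  open MinimalRepresentatives W H

  J : Fin n → Set
  J x = inH x ≡ true

  to-InWH : ∀ {x} → J x → InWH (elt x)
  to-InWH {x} j with inH x | elt-inH x
  ... | true | i = i

  from-InWH : ∀ {x} → InWH (elt x) → J x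
  from-InWH {x} i with inH x | elt-inH x
  ... | true  | _  = refl
  ... | false | ¬i = ⊥-elim (¬i i)

  Projection : Fin n → Fin n → Set
  Projection z p = J p × p ≤ z × (∀ y → J y → y ≤ z → y ≤ p)

  projection : C (∀ z → ∃[ p ] Projection z p)
  projection = collect n λ z → do
    (p , i , p⊑z , max , _) ← project (elt z)
    (y , e) ← lower z p⊑z
    return (y , from-InWH (InWH-cong (~-sym e) i) , from-⊑ (⊑-resp (~-sym e) ~-refl p⊑z) ,
      λ y j l → from-⊑ (⊑-resp ~-refl (~-sym e) (max (elt y) (to-InWH j) (to-⊑ l))))

  module _ {w s σ} (A : Acts (s ∷_) w σ) where
    open Acts A

    up⇒⊑ : ∀ {x} → x ≤ w → x ⋖ σ x → elt x ⊑ s ∷ elt x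
    up⇒⊑ l u = ⊑-resp ~-refl (acts l) (to-⊑ (proj₁ u))

    down⇒⊑ : ∀ {x} → x ≤ w → σ x ⋖ x → s ∷ elt x ⊑ elt x
    down⇒⊑ l d = ⊑-resp (acts l) ~-refl (to-⊑ (proj₁ d))

    J-down : ∀ {u} → u ≤ w → J u → σ u ⋖ u → J (σ u)
    J-down l j d = from-InWH (InWH-cong (~-sym (acts l)) (InWH-down (to-InWH j) (down⇒⊑ l d)))

    -- A projection is determined by the order, so it agrees with the one built by `project`, whose
    -- left descents are left descents of `z`.
    p-down : ∀ {z p} → Projection z p → z ≤ w → σ p ⋖ p → σ z ⋖ z
    p-down {z} {p} (j , p≤z , max) l d = decidable-stable (⋖? (σ z) z) do
      (p′ , i , p′⊑z , max′ , desc) ← project (elt z)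
      (y , e) ← lower z p′⊑z
      let y≤p = max y (from-InWH (InWH-cong (~-sym e) i)) (from-⊑ (⊑-resp (~-sym e) ~-refl p′⊑z))
          p~p′ = ⊑-antisym (max′ (elt p) (to-InWH j) (to-⊑ p≤z)) (⊑-resp e ~-refl (to-⊑ y≤p))
          sz⊑z = desc s (⊑-resp (~-++ {[ s ]} ~-refl p~p′) p~p′ (down⇒⊑ (≤-trans p≤z l) d))
      inj₁ u ← return (Special.updown special l)
        where inj₂ d → return d
      ⊥-elim (ℕₚ.<⇒≱ (ℕₚ.≤-reflexive (sym (proj₂ u))) (rank-mono (from-⊑ (⊑-resp (~-sym (acts l)) ~-refl sz⊑z))))

    p-stop : ∀ {u y} → u ≤ w → J u → u ⋖ σ u → ¬ J (σ u) → J y → y ≤ σ u → y ≤ u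
    p-stop l j u ¬j jy y≤ = from-⊑ (stop (to-InWH j) (up⇒⊑ l u)
      (λ i → ¬j (from-InWH (InWH-cong (~-sym (acts l)) i))) (to-InWH jy) (⊑-resp ~-refl (acts l) (to-⊑ y≤)))

module _ {n leq rank inH} {W₁ H₁} (e₁ : Enumeration W₁ H₁ {n} leq rank inH) (m₁ : ∀ w → Enumerated.Matched e₁ w)
  (p : Fin n → Fin n) (pr : ∀ z → Enumerated.Projection e₁ z (p z))
  {W H} (e : Enumeration W H leq rank inH) (m : ∀ w → Enumerated.Matched e w)
  (x : X) (R : Coxeter.Word W → Coxeter.Word W → Poly) (isR : Coxeter.Parabolic.IsParabolicR W H x R) where
  open Coxeter W renaming (_≈_ to infix 4 _≈_; _≤B_ to infix 4 _≤B_; _ℓ<_ to infix 4 _ℓ<_)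
  open Words W ⊥
  open Length W
  open BruhatOrder W
  open Enumeration e
  open Enumerated e
  open MinimalRepresentatives W H using (InWH-cong)
  open Covers _≤_ rank

  open Expansion (Enumerated.diamond e₁ m₁) polynomials (operators x) 1ₚ J (λ z → inH z Boolₚ.≟ true) p
    (λ z → proj₁ (pr z)) (λ z → proj₁ (proj₂ (pr z))) (λ {y} {z} → proj₂ (proj₂ (pr z)) y)

  Q : Fin n → Fin n → Poly
  Q u v = R (elt u) (elt v)

  stable : ∀ {P P′ : Poly} → C (P ≗ₚ P′) → P ≗ₚ P′
  stable c k = decidable-stable (_ ℤ.≟ _) (c >>= λ f → return (f k))

  recursive : ∀ v → J v → 1 ≤ⁿ rank v → ∃[ σ ] Recursive Q v σ
  recursive v jv 1≤ with m v 1≤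
  ... | σ , (s , A) , _ = σ , record
      { parabolic = record
        { special = special ; lowers = lowers ; J-down = J-down A ; p-down = λ {z} → p-down A (pr z) ; p-stop = p-stop A }
      ; Q-down = λ {u} l ne j d → stable do
          u<v ← below l ne
          dv ← descends ≤-refl lowers
          du ← descends l d
          f ← acts l
          g ← acts ≤-refl
          return (≗-trans (down-rule _ _ s (to-InWH j) (to-InWH jv) u<v dv du) (wd _ _ _ _ (≈-sym f) (≈-sym g)))
      ; Q-up = λ {u} l ne j uu j′ → stable do
          u<v ← below l ne
          dv ← descends ≤-refl lowers
          f ← acts l
          g ← acts ≤-refl
          return (≗-trans (up-rule _ _ s (to-InWH j) (to-InWH jv) u<v dv (ascends l uu) (InWH-cong (acts l) (to-InWH j′)))
            (≗-trans (mixₚ-* _ _) (Operators.mix-cong (operators x) (wd _ _ _ _ ≈-refl (≈-sym g)) (wd _ _ _ _ (≈-sym f) (≈-sym g)))))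
      ; Q-stop = λ {u} l ne j uu ¬j → stable do
          u<v ← below l ne
          dv ← descends ≤-refl lowers
          g ← acts ≤-refl
          return (≗-trans (stop-rule _ _ s (to-InWH j) (to-InWH jv) u<v dv (ascends l uu)
              (λ i → ¬j (from-InWH (InWH-cong (~-sym (acts l)) i))))
            (≗-trans (κₚ-* x _) (Operators.κ-cong (operators x) (wd _ _ _ _ ≈-refl (≈-sym g)))))
      }
    where
    open Acts A
    wd = proj₁ isR
    down-rule = proj₁ (proj₂ (proj₂ (proj₂ isR)))
    up-rule = proj₁ (proj₂ (proj₂ (proj₂ (proj₂ isR))))
    stop-rule = proj₂ (proj₂ (proj₂ (proj₂ (proj₂ isR))))
    below : ∀ {u} → u ≤ v → u ≢ v → C (elt u <B elt v)
    below l ne = do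
      b ← to-⊑ l
      return (b , λ e → ne (elt-inj (return e)))
    descends : ∀ {u} → u ≤ v → σ u ⋖ u → C (DL s (elt u))
    descends l d = do
      f ← acts l
      return (_ , _ , Len-cong f (elt-Len _) , elt-Len _ , ℕₚ.≤-reflexive (sym (proj₂ d)))
    ascends : ∀ {u} → u ≤ v → u ⋖ σ u → ¬ DL s (elt u)
    ascends l u (a , b , la , lb , lt) = acts l λ f →
      ℕₚ.<-asym lt (subst₂ _<_ (Len-unique (elt-Len _) lb ~-refl) (Len-unique (elt-Len _) la (return f)) (ℕₚ.≤-reflexive (sym (proj₂ u))))

  -- Here `F` is made with matchings from the enumeration `e₁`, while the recursion of `Q` uses left
  -- descents in `W`. The two enumerations share order, rank and `inH`, so taking `e` from either
  -- group gives the same `F`.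
  R-expansion : ∀ {u v} → J u → J v → Q u v ≗ₚ F u v
  R-expansion = expansion Q (λ ju jv u≰v → ≰-rule _ _ (to-InWH ju) (to-InWH jv) (λ l → u≰v (from-⊑ (return l))))
      (λ j → refl-rule _ (to-InWH j)) recursive
    where
    ≰-rule = proj₁ (proj₂ isR)
    refl-rule = proj₁ (proj₂ (proj₂ isR))

-- A left descent lowers `rank` by exactly one and, being a strict step in the common order, lowers
-- `rank′` by at least one. Used in both directions, this shows that the order determines the
-- lengths.
rank-≤ : ∀ {W H W′ H′ n leq rank rank′ inH inH′} → Enumeration W H {n} leq rank inH → Enumeration W′ H′ leq rank′ inH′ →
  ∀ x → rank x ≤ⁿ rank′ x
rank-≤ {W} {n = n} {leq} {rank} {rank′} e e′ x = go (rank x) refl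
  where
  open Enumeration e
  open Enumerated e
  module E′ = Enumerated e′
  open BruhatOrder W using (⊑-resp; Multiplication; left)
  open Length W using (Len-cong)
  open Words W ⊥
  go : ∀ k {x} → rank x ≡ k → k ≤ⁿ rank′ x
  go zero r = z≤n
  go (suc k) {x} r with descents x (subst (1 ≤ⁿ_) (sym r) (s≤s z≤n))
  ... | s , sx⊑x , _ = decidable-stable (suc k ℕ.≤? rank′ x) do
    (σ , a) ← action (left s) x sx⊑x
    let open Acts a
        σx≤x = proj₁ lowers
        r′ = ℕₚ.suc-injective (trans (sym (proj₂ lowers)) r)
    return (ℕₚ.≤-<-trans (go k {σ x} r′) (ℕₚ.≤∧≢⇒< (E′.rank-mono σx≤x)
      λ eq → ℕₚ.1+n≢n (trans (sym (proj₂ lowers)) (cong rank (sym (E′.rank-inj σx≤x eq))))))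

-- Transport along the isomorphism

module Comparison (C₁ C₂ : CoxeterSystem) (H₁ : CoxeterSystem.S C₁ → Set) (H₂ : CoxeterSystem.S C₂ → Set)
  (v₁ : Coxeter.Word C₁) (v₂ : Coxeter.Word C₂) (ψ : Coxeter.Word C₁ → Coxeter.Word C₂) (iso : IntervalIso C₁ C₂ H₁ H₂ v₁ v₂ ψ) where
  private
    module W₁ = Coxeter C₁
    module W₂ = Coxeter C₂
    module O₁ = BruhatOrder C₁
    module O₂ = BruhatOrder C₂
    module A₁ = Words C₁ ⊥
    module A₂ = Words C₂ ⊥
    module I₁ = W₁.Parabolic H₁
    module I₂ = W₂.Parabolic H₂
    module M₂ = MinimalRepresentatives C₂ H₂
    ψ-cong  = proj₁ iso
    ψ-range = proj₁ (proj₂ iso)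
    ψ-inj   = proj₁ (proj₂ (proj₂ iso))
    ψ-surj  = proj₁ (proj₂ (proj₂ (proj₂ iso)))
    ψ-order = proj₁ (proj₂ (proj₂ (proj₂ (proj₂ iso))))
    ψ-H     = proj₁ (proj₂ (proj₂ (proj₂ (proj₂ (proj₂ iso)))))
    ψ-H⁻    = proj₂ (proj₂ (proj₂ (proj₂ (proj₂ (proj₂ iso)))))

  record Common : Set where
    field
      n      : ℕ
      leq    : Fin n → Fin n → Bool
      rank   : Fin n → ℕ
      inH    : Fin n → Bool
      e₁     : Enumeration C₁ H₁ leq rank inH
      e₂     : Enumeration C₂ H₂ leq rank inH
      link   : ∀ x → Enumeration.elt e₂ x ≡ ψ (Enumeration.elt e₁ x)
      locate : ∀ {z} → z W₁.≤B v₁ → ∃[ x ] z W₁.≈ Enumeration.elt e₁ x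

  lookup-injective : ∀ {zs} → AllPairs (λ a b → ¬ (a W₁.≈ b)) zs → ∀ i j → lookup zs i W₁.≈ lookup zs j → i ≡ j
  lookup-injective (_ ∷ _) Fin.zero Fin.zero e = refl
  lookup-injective (a ∷ _) Fin.zero (Fin.suc j) e = ⊥-elim (All.lookup a (∈-lookup j) e)
  lookup-injective (a ∷ _) (Fin.suc i) Fin.zero e = ⊥-elim (All.lookup a (∈-lookup i) (A₁.≈-sym e))
  lookup-injective (_ ∷ p) (Fin.suc i) (Fin.suc j) e = cong Fin.suc (lookup-injective p i j e)

  common : C Common
  common = do
      (zs , all , distinct) ← Witnesses.enumerate C₁ {v₁} (W₁._≤B v₁) (λ e l → O₁.≤B-trans (W₁.≤B-refl (A₁.≈-sym e)) l) (λ _ l → l)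
      build zs all distinct
    where
    build : ∀ zs → (∀ z → (z W₁.≤B v₁) ⇔ Any (λ z′ → z W₁.≈ z′) zs) → AllPairs (λ a b → ¬ (a W₁.≈ b)) zs → C Common
    build zs all distinct = do
        leqs ← collect n λ x → collect n λ y → Is-total (elt x O₁.⊑ elt y)
        Hs ← collect n λ x → Is-total (I₁.InWH (elt x))
        lens₁ ← collect n λ x → Length.Len-total C₁ (elt x)
        lens₂ ← collect n λ x → Length.Len-total C₂ (ψ (elt x))
        bottom ← collect n λ x → O₁.[]⊑ (elt x)
        let e₁ = enumeration₁ leqs Hs lens₁
            e₂ = enumeration₂ bottom leqs Hs lens₂
            -- Each table is first made with the lengths of its own group. The lengths turn out
            -- equal, so the second table can be restated with the ranks of the first.
            ranks = λ x → ℕₚ.≤-antisym (rank-≤ e₂ e₁ x) (rank-≤ e₁ e₂ x)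
        return (record
          { e₁ = e₁
          ; e₂ = record
            { elt-Len = λ x → subst (W₂.Len (ψ (elt x))) (ranks x) (proj₂ (lens₂ x))
            ; elt-leq = Enumeration.elt-leq e₂ ; elt-inH = Enumeration.elt-inH e₂
            ; elt-inj = Enumeration.elt-inj e₂ ; lower = Enumeration.lower e₂ }
          ; link = λ _ → refl ; locate = locate })
      where
      n = length zs
      elt = lookup zs
      Leqs = ∀ x y → ∃[ b ] Is b (elt x O₁.⊑ elt y)
      InHs = ∀ x → ∃[ b ] Is b (I₁.InWH (elt x))
      locate : ∀ {z} → z W₁.≤B v₁ → ∃[ x ] z W₁.≈ elt x
      locate l = let a = Equivalence.to (all _) l in index a , Anyₚ.lookup-index a
      elt≤ : ∀ x → elt x W₁.≤B v₁
      elt≤ x = Equivalence.from (all _) (Any.map (λ { refl → A₁.≈-refl }) (∈-lookup x))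
      inj : ∀ {x y} → elt x A₁.~ elt y → x ≡ y
      inj {x} {y} e = decidable-stable (x Finₚ.≟ y) (e >>= return ∘ lookup-injective distinct x y)
      enumeration₁ : (leqs : Leqs) (Hs : InHs) (lens : ∀ x → ∃[ k ] W₁.Len (elt x) k) →
        Enumeration C₁ H₁ (λ x y → proj₁ (leqs x y)) (proj₁ ∘ lens) (proj₁ ∘ Hs)
      enumeration₁ leqs Hs lens = record
        { elt = elt ; elt-Len = proj₂ ∘ lens ; elt-leq = λ x y → proj₂ (leqs x y) ; elt-inH = proj₂ ∘ Hs
        ; elt-inj = inj
        ; lower = λ x l → l >>= λ l → let (y , e) = locate (O₁.≤B-trans l (elt≤ x)) in return (y , return (A₁.≈-sym e)) }
      enumeration₂ : (∀ x → [] W₁.≤B elt x) → (leqs : Leqs) (Hs : InHs) (lens : ∀ x → ∃[ k ] W₂.Len (ψ (elt x)) k) →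
        Enumeration C₂ H₂ (λ x y → proj₁ (leqs x y)) (proj₁ ∘ lens) (proj₁ ∘ Hs)
      enumeration₂ b leqs Hs lens = record
        { elt = ψ ∘ elt ; elt-Len = proj₂ ∘ lens
        ; elt-leq = λ x y → Is-map (proj₁ (leqs x y)) (λ l → l >>= λ l → return (Equivalence.to (ord x y) l))
            (λ l → l >>= λ l → return (Equivalence.from (ord x y) l)) (proj₂ (leqs x y))
        ; elt-inH = λ x → Is-map (proj₁ (Hs x)) (ψ-H (elt x) (b x) (elt≤ x)) (back x) (proj₂ (Hs x))
        ; elt-inj = λ {x} {y} e → inj (e >>= λ e → return (ψ-inj (elt x) (elt y) (b x) (elt≤ x) (b y) (elt≤ y) e))
        ; lower = λ x {w} l → do
            l ← l
            b′ ← O₂.[]⊑ w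
            let (z , _ , z≤ , e) = ψ-surj w b′ (O₂.≤B-trans l (proj₂ (ψ-range (elt x) (b x) (elt≤ x))))
                (y , f) = locate z≤
            return (y , return (A₂.≈-trans (A₂.≈-sym (ψ-cong z (elt y) f)) e)) }
        where
        ord : ∀ x y → elt x W₁.≤B elt y ⇔ ψ (elt x) W₂.≤B ψ (elt y)
        ord x y = ψ-order (elt x) (elt y) (b x) (elt≤ x) (b y) (elt≤ y)
        back : ∀ x → I₂.InWH (ψ (elt x)) → I₁.InWH (elt x)
        back x i = let (z , c , l , j , e) = ψ-H⁻ (ψ (elt x)) (proj₁ r) (proj₂ r) i in
            MinimalRepresentatives.InWH-cong C₁ H₁ (return (ψ-inj z (elt x) c l (b x) (elt≤ x) e)) j
          where r = ψ-range (elt x) (b x) (elt≤ x)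

  In : W₁.Word → Set
  In = I₁.InIntervalH [] v₁

  ψ-Len : ∀ {z a} → z W₁.≤B v₁ → W₁.Len z a → C (W₂.Len (ψ z) a)
  ψ-Len {z} l lz = do
    c ← common
    let open Common c
        (x , e) = locate l
        r = Length.Len-unique C₁ (Enumeration.elt-Len e₁ x) lz (return (A₁.≈-sym e))
    return (Length.Len-cong C₂ (A₂.≈-sym (ψ-cong z _ e)) (subst₂ W₂.Len (link x) r (Enumeration.elt-Len e₂ x)))

  module _ (x : X) {R₁ R₂} (isR₁ : I₁.IsParabolicR x R₁) (isR₂ : I₂.IsParabolicR x R₂) where
    R-equal : ∀ {u w} → In u → In w → R₁ u w ≗ₚ R₂ (ψ u) (ψ w)
    R-equal {u} {w} (_ , u≤ , iu) (_ , w≤ , iw) k = decidable-stable (_ ℤ.≟ _) do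
      c ← common
      let open Common c
          open Enumeration e₁ using () renaming (elt to elt₁)
          open Enumeration e₂ using () renaming (elt to elt₂)
          module E = Enumerated e₁
          (i , f) = locate u≤
          (j , g) = locate w≤
          ju = E.from-InWH {i} (MinimalRepresentatives.InWH-cong C₁ H₁ (return f) iu)
          jw = E.from-InWH {j} (MinimalRepresentatives.InWH-cong C₁ H₁ (return g) iw)
      m₁ ← E.matched
      m₂ ← Enumerated.matched e₂
      pr ← E.projection
      return (begin
        R₁ u w k                   ≡⟨ proj₁ isR₁ _ _ _ _ f g k ⟩
        R₁ (elt₁ i) (elt₁ j) k     ≡⟨ R-expansion e₁ m₁ (proj₁ ∘ pr) (proj₂ ∘ pr) e₁ m₁ x R₁ isR₁ ju jw k ⟩
        _                          ≡⟨ R-expansion e₁ m₁ (proj₁ ∘ pr) (proj₂ ∘ pr) e₂ m₂ x R₂ isR₂ ju jw k ⟨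
        R₂ (elt₂ i) (elt₂ j) k     ≡⟨ cong₂ (λ a b → R₂ a b k) (link i) (link j) ⟩
        R₂ (ψ (elt₁ i)) (ψ (elt₁ j)) k ≡⟨ proj₁ isR₂ _ _ _ _ (ψ-cong _ _ f) (ψ-cong _ _ g) k ⟨
        R₂ (ψ u) (ψ w) k           ∎)
      where open ≡-Reasoning

    module _ {P₁ P₂} (isP₁ : I₁.IsParabolicP R₁ P₁) (isP₂ : I₂.IsParabolicP R₂ P₂) where
      private
        In-ψ : ∀ {z} → In z → I₂.InIntervalH [] v₂ (ψ z)
        In-ψ {z} (b , l , i) = proj₁ (ψ-range z b l) , proj₂ (ψ-range z b l) , ψ-H z b l i

        ψ-mono : ∀ {y z} → In y → In z → y W₁.≤B z → ψ y W₂.≤B ψ z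
        ψ-mono (b , l , _) (b′ , l′ , _) = Equivalence.to (ψ-order _ _ b l b′ l′)

        ψ-reflect : ∀ {y z} → In y → In z → ψ y W₂.≤B ψ z → y W₁.≤B z
        ψ-reflect (b , l , _) (b′ , l′ , _) = Equivalence.from (ψ-order _ _ b l b′ l′)

        ψ-injective : ∀ {y z} → In y → In z → ψ y W₂.≈ ψ z → y W₁.≈ z
        ψ-injective (b , l , _) (b′ , l′ , _) = ψ-inj _ _ b l b′ l′

        between : ∀ {u w z} → In u → In w → I₁.InIntervalH u w z → In z
        between (b , _) (_ , l , _) (u≤z , z≤w , i) = O₁.≤B-trans b u≤z , O₁.≤B-trans z≤w l , i

        interval-resp : ∀ {u w z z′} → z W₁.≈ z′ → I₁.InIntervalH u w z → I₁.InIntervalH u w z′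
        interval-resp e (u≤ , ≤w , i) = O₁.≤B-trans u≤ (W₁.≤B-refl e) , O₁.≤B-trans (W₁.≤B-refl (A₁.≈-sym e)) ≤w ,
          MinimalRepresentatives.InWH-cong C₁ H₁ (return e) i

      ψ-enumerates : ∀ {u w zs} → In u → In w → I₁.EnumIntervalH u w zs → I₂.EnumIntervalH (ψ u) (ψ w) (map ψ zs)
      ψ-enumerates {u} {w} {zs} iu iw (all , distinct) = (λ y → mk⇔ (to y) (from y)) , distinct-ψ zs in-zs distinct
        where
        in-zs : ∀ z → z ∈ zs → I₁.InIntervalH u w z
        in-zs z i = Equivalence.from (all z) (Any.map (λ { refl → A₁.≈-refl }) i)
        to : ∀ y → I₂.InIntervalH (ψ u) (ψ w) y → Any (λ z → y W₂.≈ z) (map ψ zs)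
        to y (u≤y , y≤w , i) with ψ-H⁻ y (O₂.≤B-trans (proj₁ (In-ψ iu)) u≤y) (O₂.≤B-trans y≤w (proj₁ (proj₂ (In-ψ iw)))) i
        ... | z , b , l , j , e = Anyₚ.map⁺ (Any.map (λ {z′} f → A₂.≈-trans (A₂.≈-sym e) (ψ-cong z z′ f)) (Equivalence.to (all z)
          (ψ-reflect iu (b , l , j) (O₂.≤B-trans u≤y (W₂.≤B-refl (A₂.≈-sym e))) ,
           ψ-reflect (b , l , j) iw (O₂.≤B-trans (W₂.≤B-refl e) y≤w) , j)))
        from : ∀ y → Any (λ z → y W₂.≈ z) (map ψ zs) → I₂.InIntervalH (ψ u) (ψ w) y
        from y p with find (Anyₚ.map⁻ p)
        ... | z , z∈ , e with in-zs z z∈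
        ...   | q@(u≤z , z≤w , _) = O₂.≤B-trans (ψ-mono iu iz u≤z) (W₂.≤B-refl (A₂.≈-sym e)) ,
            O₂.≤B-trans (W₂.≤B-refl e) (ψ-mono iz iw z≤w) , M₂.InWH-cong (return (A₂.≈-sym e)) (proj₂ (proj₂ (In-ψ iz)))
          where iz = between iu iw q
        distinct-ψ : ∀ zs → (∀ z → z ∈ zs → I₁.InIntervalH u w z) → AllPairs (λ a b → ¬ (a W₁.≈ b)) zs →
          AllPairs (λ a b → ¬ (a W₂.≈ b)) (map ψ zs)
        distinct-ψ []       _ [] = []
        distinct-ψ (z ∷ zs) q (ne ∷ d) = Allₚ.map⁺ (All.tabulate λ {z′} i e → All.lookup ne i
            (ψ-injective (between iu iw (q z (here refl))) (between iu iw (q z′ (there i))) e))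
          ∷ distinct-ψ zs (λ z i → q z (there i)) d

      P-equal : ∀ {u w} → In u → In w → P₁ u w ≗ₚ P₂ (ψ u) (ψ w)
      P-equal {u₀} {w} iu₀ iw n₀ = decidable-stable (_ ℤ.≟ _) do
          (a , la) ← Length.Len-total C₁ u₀
          (b , lb) ← Length.Len-total C₁ w
          return (go b lb (suc (b ∸ a)) iu₀ la ℕₚ.≤-refl n₀)
        where
        iw₂ = In-ψ iw
        go : ∀ b → W₁.Len w b → ∀ k {u a} → In u → W₁.Len u a → b ∸ a < k → P₁ u w ≗ₚ P₂ (ψ u) (ψ w)
        go b lb (suc k) {u} {a} iu@(_ , u≤v , hu) la lt n = decidable-stable (_ ℤ.≟ _) do
            inj₁ u≤w ← em (u W₁.≤B w)
              where inj₂ u≰w → return (trans (proj₁ (proj₂ isP₁) u w hu (proj₂ (proj₂ iw)) u≰w n)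
                      (sym (proj₁ (proj₂ isP₂) _ _ (proj₂ (proj₂ iu₂)) (proj₂ (proj₂ iw₂)) (u≰w ∘ ψ-reflect iu iw) n)))
            inj₂ u≉w ← em (u W₁.≈ w)
              where inj₁ u≈w → return (trans (trans (proj₁ isP₁ _ _ _ _ A₁.≈-refl (A₁.≈-sym u≈w) n) (one₁ u hu n))
                      (sym (trans (proj₁ isP₂ _ _ _ _ A₂.≈-refl (ψ-cong _ _ (A₁.≈-sym u≈w)) n) (one₂ (ψ u) (proj₂ (proj₂ iu₂)) n))))
            (zs , enum) ← Witnesses.enumerate C₁ (I₁.InIntervalH u w) interval-resp (λ _ → proj₁ ∘ proj₂)
            la₂ ← ψ-Len u≤v la
            lb₂ ← ψ-Len (proj₁ (proj₂ iw)) lb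
            -- In the sum over the interval the term at `u` is the unknown polynomial itself. All
            -- other terms belong to longer elements, hence to a smaller length difference, and
            -- agree by induction.
            return (rev-injective (b ∸ a)
              (degree₁ u w hu (proj₂ (proj₂ iw)) (u≤w , u≉w) a b la lb)
              (degree₂ (ψ u) (ψ w) (proj₂ (proj₂ iu₂)) (proj₂ (proj₂ iw₂)) (ψ-mono iu iw u≤w , u≉w ∘ ψ-injective iu iw) a b la₂ lb₂)
              (λ k → trans (cong (ℤ._+ P₂ (ψ u) (ψ w) k) (sum₁ u w hu (proj₂ (proj₂ iw)) a b la lb zs enum k))
                (trans (∑ₚ-map-except ψ {λ z → R₁ u z *ₚ P₁ z w} {λ z → R₂ (ψ u) z *ₚ P₂ z (ψ w)} {k} zs (proj₂ enum) (Equivalence.to (proj₁ enum u) (W₁.≤B-refl A₁.≈-refl , u≤w , hu))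
                    A₁.≈-sym A₁.≈-trans (other u≤w zs enum {k}) (here-u u≤w))
                  (cong (ℤ._+ P₁ u w k) (sym (sum₂ (ψ u) (ψ w) (proj₂ (proj₂ iu₂)) (proj₂ (proj₂ iw₂)) a b la₂ lb₂ (map ψ zs)
                    (ψ-enumerates iu iw enum) k)))))
              n)
          where
          iu₂ = In-ψ iu
          one₁ = proj₁ (proj₂ (proj₂ isP₁))
          one₂ = proj₁ (proj₂ (proj₂ isP₂))
          degree₁ = proj₁ (proj₂ (proj₂ (proj₂ isP₁)))
          degree₂ = proj₁ (proj₂ (proj₂ (proj₂ isP₂)))
          sum₁ = proj₂ (proj₂ (proj₂ (proj₂ isP₁)))
          sum₂ = proj₂ (proj₂ (proj₂ (proj₂ isP₂)))
          other : u W₁.≤B w → ∀ zs → I₁.EnumIntervalH u w zs → ∀ {k} z → z ∈ zs → ¬ (u W₁.≈ z) →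
            (R₁ u z *ₚ P₁ z w) k ≡ (R₂ (ψ u) (ψ z) *ₚ P₂ (ψ z) (ψ w)) k
          other u≤w zs enum {m} z z∈ u≉z = decidable-stable (_ ℤ.≟ _) do
              (c , lc) ← Length.Len-total C₁ z
              inj₂ a<c ← O₁.≤B-length (proj₁ q) la lc
                where inj₁ (_ , e) → e >>= impossible ∘ u≉z
              return (*ₚ-cong (R-equal iu iz)
                (go b lb k iz lc (ℕₚ.<-≤-trans (ℕₚ.∸-monoʳ-< a<c (O₁.⊑-Len (return (proj₁ (proj₂ q))) lc lb)) (s≤s⁻¹ lt))) m)
            where
            q = Equivalence.from (proj₁ enum z) (Any.map (λ { refl → A₁.≈-refl }) z∈)
            iz = between iu iw q
          here-u : u W₁.≤B w → ∀ {k} z → u W₁.≈ z →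
            (R₁ u z *ₚ P₁ z w) k ≡ P₁ u w k × (R₂ (ψ u) (ψ z) *ₚ P₂ (ψ z) (ψ w)) k ≡ P₂ (ψ u) (ψ w) k
          here-u u≤w {k} z e =
            trans (*ₚ-cong (≗-trans (proj₁ isR₁ _ _ _ _ A₁.≈-refl (A₁.≈-sym e)) (proj₁ (proj₂ (proj₂ isR₁)) u hu))
              (proj₁ isP₁ _ _ _ _ (A₁.≈-sym e) A₁.≈-refl) k) (*ₚ-identityˡ (P₁ u w) k) ,
            trans (*ₚ-cong (≗-trans (proj₁ isR₂ _ _ _ _ A₂.≈-refl (ψ-cong _ _ (A₁.≈-sym e))) (proj₁ (proj₂ (proj₂ isR₂)) (ψ u) (proj₂ (proj₂ iu₂))))
              (proj₁ isP₂ _ _ _ _ (ψ-cong _ _ (A₁.≈-sym e)) A₂.≈-refl) k) (*ₚ-identityˡ (P₂ (ψ u) (ψ w)) k)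

theorem1p4 : (C₁ C₂ : CoxeterSystem)
    (H₁ : CoxeterSystem.S C₁ → Set) (H₂ : CoxeterSystem.S C₂ → Set)
    (v₁ : Coxeter.Word C₁) (v₂ : Coxeter.Word C₂) →
    Coxeter.Parabolic.InWH C₁ H₁ v₁ → Coxeter.Parabolic.InWH C₂ H₂ v₂ →
    (ψ : Coxeter.Word C₁ → Coxeter.Word C₂) →
    IntervalIso C₁ C₂ H₁ H₂ v₁ v₂ ψ →
    (x : X) →
    (R₁ P₁ : Coxeter.Word C₁ → Coxeter.Word C₁ → Poly) →
    Coxeter.Parabolic.IsParabolicR C₁ H₁ x R₁ →
    Coxeter.Parabolic.IsParabolicP C₁ H₁ R₁ P₁ →
    (R₂ P₂ : Coxeter.Word C₂ → Coxeter.Word C₂ → Poly) →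
    Coxeter.Parabolic.IsParabolicR C₂ H₂ x R₂ →
    Coxeter.Parabolic.IsParabolicP C₂ H₂ R₂ P₂ →
    (u w : Coxeter.Word C₁) →
    Coxeter.Parabolic.InIntervalH C₁ H₁ [] v₁ u →
    Coxeter.Parabolic.InIntervalH C₁ H₁ [] v₁ w →
    (P₁ u w ≗ₚ P₂ (ψ u) (ψ w)) × (R₁ u w ≗ₚ R₂ (ψ u) (ψ w))
theorem1p4 C₁ C₂ H₁ H₂ v₁ v₂ _ _ ψ iso x R₁ P₁ isR₁ isP₁ R₂ P₂ isR₂ isP₂ u w iu iw =
    P-equal x isR₁ isR₂ isP₁ isP₂ iu iw , R-equal x isR₁ isR₂ iu iw
  where open Comparison C₁ C₂ H₁ H₂ v₁ v₂ ψ iso
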